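{- Let $K$ be a finite field with $q$ elements and $n\ge4$. Then \[ |C_4(n)|=\begin{cases} q^{3n}-(q^3+q^2+q)q^{2n}+(q^5+q^4+q^3)q^n-q^6,&\gcd(n,4)=1,\\ q^{3n}-(q^3+q^2+q)q^{2n}+2(q^4+q^2)q^{\frac32n}-(q^5+q^4+q^3)q^n+q^6,&\gcd(n,4)=2,\\ q^{3n}+3(q^3+q^2+q)q^{2n}+2(q^4+q^2)q^{\frac32n}+3(q^5+q^4+q^3)q^n+q^6,&\gcd(n,4)=4. \end{cases} \]
   Context: $C_4(n)$ is the set of tuples $(v_1,\dots,v_n)\in(\mathbb{P}^3(K))^n$ such that for every $i\in\{1,\dots,n\}$ the points $v_i,v_{i+1},v_{i+2},v_{i+3}$ (indices mod $n$) are projectively independent, i.e. their lifts in $K^4$ are linearly independent. -}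

module Defs where

open import Level using (0ℓ)
open import Algebra.Bundles using (CommutativeRing)
open import Data.Nat using (ℕ; NonZero)
import Data.Nat
open import Data.Nat.DivMod using (_mod_)
open import Data.Fin using (Fin; toℕ)
open import Data.Product using (Σ; Σ-syntax; ∃; ∃-syntax; _×_)
open import Relation.Nullary using (¬_)
open import Relation.Binary.PropositionalEquality using (_≡_)

-- Cardinality of a quotient A / ~ :  a map f : A → Fin N whose fibres are
-- exactly the ~-classes and which is surjective, i.e. A/~ ≅ Fin N.
CardQuot : {A : Set} → ℕ → (A → A → Set) → Set
CardQuot {A} N _~_ =
  Σ[ f ∈ (A → Fin N) ]
    ((∀ x y → (f x ≡ f y → x ~ y) × (x ~ y → f x ≡ f y)) ×
     (∀ k → ∃[ x ] f x ≡ k))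

0F 1F 2F 3F : Fin 4
0F = Fin.zero
1F = Fin.suc Fin.zero
2F = Fin.suc (Fin.suc Fin.zero)
3F = Fin.suc (Fin.suc (Fin.suc Fin.zero))

module _ (K : CommutativeRing 0ℓ 0ℓ) where
  open CommutativeRing K

  IsField : Set
  IsField = (¬ (1# ≈ 0#)) × (∀ x → ¬ (x ≈ 0#) → ∃[ y ] (x * y ≈ 1#))

  HasSize : ℕ → Set
  HasSize q = CardQuot {Carrier} q _≈_

  K⁴ : Set
  K⁴ = Fin 4 → Carrier

  NonZeroVec : K⁴ → Set
  NonZeroVec v = ¬ (∀ i → v i ≈ 0#)

  -- points of P^3(K): nonzero vectors of K^4, identified up to nonzero scalars
  P³ : Set
  P³ = Σ K⁴ NonZeroVec

  lift : P³ → K⁴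
  lift (v Data.Product., _) = v

  _∼P_ : P³ → P³ → Set
  x ∼P y = ∃[ c ] ((¬ (c ≈ 0#)) × (∀ i → lift x i ≈ c * lift y i))

  LinIndep4 : (Fin 4 → K⁴) → Set
  LinIndep4 w = ∀ (c : Fin 4 → Carrier) →
    (∀ k → ((c 0F * w 0F k + c 1F * w 1F k) + c 2F * w 2F k) + c 3F * w 3F k ≈ 0#) →
    ∀ j → c j ≈ 0#

  shift : (n : ℕ) .{{_ : NonZero n}} → Fin n → Fin 4 → Fin n
  shift n i j = (toℕ i Data.Nat.+ toℕ j) mod n

  -- underlying set of C_4(n): n-tuples of points such that every 4 cyclically
  -- consecutive ones are projectively independent
  C4Tuple : (n : ℕ) .{{_ : NonZero n}} → Set
  C4Tuple n = Σ[ v ∈ (Fin n → P³) ]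
    (∀ i → LinIndep4 (λ j → lift (v (shift n i j))))

  _∼C_ : {n : ℕ} .{{_ : NonZero n}} → C4Tuple n → C4Tuple n → Set
  x ∼C y = ∀ i → _∼P_ (Data.Product.proj₁ x i) (Data.Product.proj₁ y i)

{-# OPTIONS --safe #-}

-- Send a closed walk v₁, …, vₙ to the flags ⟨vᵢ⟩ ⊂ ⟨vᵢ₋₁, vᵢ⟩ ⊂ ⟨vᵢ₋₂, vᵢ₋₁, vᵢ⟩.  Consecutive
-- flags are in the relative position of the Coxeter element s₁s₂s₃ of S₄, and the closing
-- condition only depends on the relative position of the last flag and the first one.  Hence the
-- walks are counted by powers of M = T₁T₂T₃ in the Hecke algebra of S₄ with parameter q, times
-- the number q⁶[4]_q! of projective bases.  M⁴ is the full twist, which is central; it satisfies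
-- (M⁴ - q¹²)(M⁴ - q⁸)(M⁴ - q⁶)(M⁴ - q⁴)(M⁴ - 1) = 0, so in each residue class of n mod 4 the
-- count obeys a linear recurrence of order 5 and is determined by its first five values.
module Submission where

open import Defs
open import Level using (0ℓ)
open import Algebra.Bundles using (CommutativeRing; RawRing)
open import Algebra.Structures using (IsCommutativeRing)
open import Algebra.Morphism.Structures using (IsRingMonomorphism)
import Algebra.Morphism.RingMonomorphism as RingMonomorphism
open import Data.Bool using (Bool; true; false; T; _∧_; if_then_else_)
open import Data.Empty using (⊥-elim)
open import Data.Unit using (⊤; tt)
open import Data.Product using (Σ-syntax; ∃-syntax; _×_; _,_; proj₁; proj₂)
open import Data.Nat using (ℕ; zero; suc; _≤_; z≤n; s≤s; NonZero)
import Data.Nat as ℕ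
import Data.Nat.Properties as ℕ
open import Data.Nat.DivMod using (_mod_; _%_; m<n⇒m%n≡m; [m+n]%n≡m%n; m%n<n; m*n/n≡m; _divMod_; DivMod; result)
open import Data.Nat.Divisibility using (_∣_; divides; _∣?_; ∣-trans; ∣m∣n⇒∣m+n; ∣m+n∣m⇒∣n; ∣n⇒∣m*n; ∣-refl)
open import Data.Nat.GCD using (gcd; gcd-greatest; gcd[m,n]∣m)
open import Data.Nat.ListAction using (sum)
open import Data.Nat.ListAction.Properties using (sum-++; sum-↭)
import Data.Nat.Tactic.RingSolver as ℕ-Solver
open import Algebra.Properties.CommutativeSemigroup ℕ.+-commutativeSemigroup using (interchange; x∙yz≈y∙xz)
open import Data.Integer using (ℤ; +_)
import Data.Integer as ℤ
import Data.Integer.Properties as ℤ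
open import Data.Integer.Tactic.RingSolver using (solve-∀)
open import Data.Fin using (Fin; zero; suc; toℕ; fromℕ<)
import Data.Fin.Properties as Fin
open import Data.List as List using (List; []; _∷_; _++_; length; map; filter; allFin; cartesianProduct; cartesianProductWith)
open import Data.List.Properties using (map-++; map-∘; length-map; length-++; length-tabulate)
open import Data.List.Membership.Propositional using (_∈_; _∉_)
open import Data.List.Membership.Propositional.Properties using (∈-∃++; ∈-allFin; ∈-lookup; ∈-filter⁺; ∈-filter⁻; ∈-cartesianProduct⁺; ∈-cartesianProductWith⁺; ∈-cartesianProductWith⁻)
open import Data.List.Relation.Unary.Any using (here; there; index)
open import Data.List.Relation.Unary.Any.Properties using (lookup-index)
open import Data.List.Relation.Unary.All as All using ([]; _∷_)
open import Data.List.Relation.Unary.AllPairs using ([]; _∷_)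
open import Data.List.Relation.Unary.Unique.Propositional using (Unique)
open import Data.List.Relation.Unary.Unique.Propositional.Properties using (map⁺; filter⁺; allFin⁺; cartesianProduct⁺; cartesianProductWith⁺)
open import Data.List.Relation.Binary.Permutation.Propositional using (_↭_; ↭-refl; ↭-sym; ↭-trans; prep)
import Data.List.Relation.Binary.Permutation.Propositional.Properties as ↭
open import Data.Vec as Vec using (Vec; []; _∷_; tabulate; lookup; toList)
open import Data.Vec.Properties using (lookup∘tabulate; tabulate∘lookup; tabulate-cong; lookup-map; length-toList; ∷-injective)
open import Data.Vec.Functional using (updateAt)
open import Data.Vec.Functional.Properties using (updateAt-updates; updateAt-minimal)
open import Function using (_∘_; id; const)
open import Relation.Nullary using (Dec; yes; no; does; ¬_; _×-dec_; _→-dec_; ¬?)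
open import Relation.Nullary.Decidable using (map′; dec-true; from-no)
open import Relation.Unary using (Decidable)
open import Relation.Binary.PropositionalEquality
open ≡-Reasoning

-- Representation theory predicts the formula, while the proof runs on a finite check. The count is
-- the trace of the n-th power of the operator "flags in position s₁s₂s₃" on functions on complete
-- flags, hence the sum over the irreducible characters χ of S₄ of the generic degree of χ times the
-- trace of Mⁿ in that representation. There M⁴ is a scalar q^e, so the trace is χ(cⁿ) q^(en/4) for
-- a 4-cycle c; this gives the coefficients in `terms`. What is verified: the five factors M⁴ - q^e,
-- applied in turn to the single table `δ`, reach zero at every permutation, and before each factor
-- four entries have the predicted value. With polynomials in q as table entries, one closed
-- computation serves every q. Two choices keep the counting elementary. The field is carried to
-- `Fin q`, where independence is decidable and a count is a sum of indicators. A projective point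
-- is the vector with leading coordinate 1 on its line; linear maps do not respect these
-- representatives, so a change of basis in a sum over points needs an argument.

⟦_⟧ : {P : Set} → Dec P → ℕ
⟦ P? ⟧ = if does P? then 1 else 0

⟦⟧-true : {P : Set} (P? : Dec P) → P → ⟦ P? ⟧ ≡ 1
⟦⟧-true (yes _) _ = refl
⟦⟧-true (no ¬p) p = ⊥-elim (¬p p)

⟦⟧-false : {P : Set} (P? : Dec P) → ¬ P → ⟦ P? ⟧ ≡ 0
⟦⟧-false (yes p) ¬p = ⊥-elim (¬p p)
⟦⟧-false (no _) _ = refl

⟦⟧-⇔ : {P Q : Set} (P? : Dec P) (Q? : Dec Q) → (P → Q) → (Q → P) → ⟦ P? ⟧ ≡ ⟦ Q? ⟧
⟦⟧-⇔ P? (yes q) f g = ⟦⟧-true P? (g q)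
⟦⟧-⇔ P? (no ¬q) f g = ⟦⟧-false P? (¬q ∘ f)

⟦⟧-× : {P Q : Set} (P? : Dec P) (Q? : Dec Q) → ⟦ P? ×-dec Q? ⟧ ≡ ⟦ P? ⟧ ℕ.* ⟦ Q? ⟧
⟦⟧-× (yes _) (yes _) = refl
⟦⟧-× (yes _) (no _) = refl
⟦⟧-× (no _) _ = refl

-- Finite sums of natural numbers

module _ {A : Set} where

  ∑ : List A → (A → ℕ) → ℕ
  ∑ xs f = sum (map f xs)

  ∑-cong : ∀ xs {f g : A → ℕ} → (∀ x → f x ≡ g x) → ∑ xs f ≡ ∑ xs g
  ∑-cong [] e = refl
  ∑-cong (x ∷ xs) e = cong₂ ℕ._+_ (e x) (∑-cong xs e)

  ∑-const : ∀ xs c → ∑ xs (λ _ → c) ≡ length xs ℕ.* c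
  ∑-const [] c = refl
  ∑-const (x ∷ xs) c = cong (c ℕ.+_) (∑-const xs c)

  ∑-zero : ∀ xs {f : A → ℕ} → (∀ x → f x ≡ 0) → ∑ xs f ≡ 0
  ∑-zero [] e = refl
  ∑-zero (x ∷ xs) e rewrite e x = ∑-zero xs e

  ∑-+ : ∀ xs (f g : A → ℕ) → ∑ xs (λ x → f x ℕ.+ g x) ≡ ∑ xs f ℕ.+ ∑ xs g
  ∑-+ [] f g = refl
  ∑-+ (x ∷ xs) f g = trans (cong (f x ℕ.+ g x ℕ.+_) (∑-+ xs f g)) (interchange (f x) (g x) _ _)

  ∑-*ˡ : ∀ xs c (f : A → ℕ) → ∑ xs (λ x → c ℕ.* f x) ≡ c ℕ.* ∑ xs f
  ∑-*ˡ [] c f = sym (ℕ.*-zeroʳ c)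
  ∑-*ˡ (x ∷ xs) c f = trans (cong (c ℕ.* f x ℕ.+_) (∑-*ˡ xs c f)) (sym (ℕ.*-distribˡ-+ c (f x) _))

  ∑-filter : {P : A → Set} (P? : Decidable P) → ∀ xs f → ∑ (filter P? xs) f ≡ ∑ xs (λ x → ⟦ P? x ⟧ ℕ.* f x)
  ∑-filter P? [] f = refl
  ∑-filter P? (x ∷ xs) f with does (P? x)
  ... | true  = cong₂ ℕ._+_ (sym (ℕ.+-identityʳ (f x))) (∑-filter P? xs f)
  ... | false = ∑-filter P? xs f

  ∑-∉ : ∀ {xs a v} {f : A → ℕ} → (∀ x → x ≢ a → f x ≡ v) → a ∉ xs → ∑ xs f ≡ length xs ℕ.* v
  ∑-∉ {[]} e a∉ = refl
  ∑-∉ {x ∷ xs} e a∉ = cong₂ ℕ._+_ (e x λ { refl → a∉ (here refl) }) (∑-∉ e (a∉ ∘ there))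

  -- All places other than `a` contribute `v`, that is `length xs` - 1 copies; one more `v` on both
  -- sides avoids the subtraction.
  ∑-except : ∀ {xs a v} {f : A → ℕ} → Unique xs → a ∈ xs → (∀ x → x ≢ a → f x ≡ v) →
             ∑ xs f ℕ.+ v ≡ f a ℕ.+ length xs ℕ.* v
  ∑-except {x ∷ xs} {v = v} {f} (x∉ ∷ u) (here refl) e = begin
    f x ℕ.+ ∑ xs f ℕ.+ v           ≡⟨ ℕ.+-assoc (f x) _ v ⟩
    f x ℕ.+ (∑ xs f ℕ.+ v)         ≡⟨ cong (f x ℕ.+_) (cong (ℕ._+ v) (∑-∉ e λ x∈ → All.lookup x∉ x∈ refl)) ⟩
    f x ℕ.+ (length xs ℕ.* v ℕ.+ v)  ≡⟨ cong (f x ℕ.+_) (ℕ.+-comm _ v) ⟩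
    f x ℕ.+ (v ℕ.+ length xs ℕ.* v)  ∎
    where open ≡-Reasoning
  ∑-except {x ∷ xs} {a} {v} {f} (x∉ ∷ u) (there a∈) e = begin
    f x ℕ.+ ∑ xs f ℕ.+ v             ≡⟨ ℕ.+-assoc (f x) _ v ⟩
    f x ℕ.+ (∑ xs f ℕ.+ v)           ≡⟨ cong₂ ℕ._+_ (e x (All.lookup x∉ a∈)) (∑-except u a∈ e) ⟩
    v ℕ.+ (f a ℕ.+ length xs ℕ.* v)    ≡⟨ x∙yz≈y∙xz v (f a) _ ⟩
    f a ℕ.+ (v ℕ.+ length xs ℕ.* v)    ∎
    where open ≡-Reasoning

∑-swap : ∀ {A B : Set} (xs : List A) (ys : List B) (f : A → B → ℕ) →
         ∑ xs (λ x → ∑ ys (f x)) ≡ ∑ ys (λ y → ∑ xs (λ x → f x y))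
∑-swap [] ys f = sym (∑-zero ys λ _ → refl)
∑-swap (x ∷ xs) ys f = trans (cong (∑ ys (f x) ℕ.+_) (∑-swap xs ys f)) (sym (∑-+ ys (f x) _))

∑-product : ∀ {A B C : Set} (h : A → B → C) xs ys (f : C → ℕ) →
            ∑ (cartesianProductWith h xs ys) f ≡ ∑ xs (λ x → ∑ ys (λ y → f (h x y)))
∑-product h [] ys f = refl
∑-product h (x ∷ xs) ys f = begin
  sum (map f (map (h x) ys ++ cartesianProductWith h xs ys))
    ≡⟨ cong sum (map-++ f (map (h x) ys) _) ⟩
  sum (map f (map (h x) ys) ++ map f (cartesianProductWith h xs ys))
    ≡⟨ sum-++ (map f (map (h x) ys)) _ ⟩
  sum (map f (map (h x) ys)) ℕ.+ ∑ (cartesianProductWith h xs ys) f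
    ≡⟨ cong₂ ℕ._+_ (cong sum (sym (map-∘ ys))) (∑-product h xs ys f) ⟩
  ∑ ys (λ y → f (h x y)) ℕ.+ ∑ xs (λ x → ∑ ys (λ y → f (h x y))) ∎
  where open ≡-Reasoning

-- Sums over enumerated finite types

record Enumeration (A : Set) : Set where
  field
    elements : List A
    complete : ∀ x → x ∈ elements
    unique   : Unique elements

-- Pigeonhole: the head of `xs` is cut out of `ys`, and by uniqueness the tail still lies in what is
-- left. This is how an injective self-map of a finite type becomes a permutation of its
-- enumeration.
unique⊆⇒↭ : {A : Set} {xs ys : List A} → Unique xs → (∀ {x} → x ∈ xs → x ∈ ys) →
            length xs ≡ length ys → xs ↭ ys
unique⊆⇒↭ {xs = []} {[]} _ _ _ = ↭-refl
unique⊆⇒↭ {xs = x ∷ xs} {ys} (x∉ ∷ u) xs⊆ys len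
  with us , vs , refl ← ∈-∃++ (xs⊆ys (here refl)) =
  ↭-trans (prep x (unique⊆⇒↭ u ⊆′ (ℕ.suc-injective (trans len (↭.↭-length (↭.shift x us vs))))))
          (↭-sym (↭.shift x us vs))
  where
  ⊆′ : ∀ {z} → z ∈ xs → z ∈ us ++ vs
  ⊆′ z∈ with ↭.∈-resp-↭ (↭.shift x us vs) (xs⊆ys (there z∈))
  ... | here refl = ⊥-elim (All.lookup x∉ z∈ refl)
  ... | there z∈′ = z∈′

module _ {A : Set} (E : Enumeration A) where
  open Enumeration E

  ∑-reindex : (g : A → A) → (∀ {x y} → g x ≡ g y → x ≡ y) → ∀ f →
              ∑ elements (f ∘ g) ≡ ∑ elements f
  ∑-reindex g inj f = trans (cong sum (map-∘ elements))
    (sum-↭ (↭.map⁺ f (unique⊆⇒↭ (map⁺ inj unique) (λ {x} _ → complete x) (length-map g elements))))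

  ∑-split : (a : A) (f : A → ℕ) {v : ℕ} → (∀ x → x ≢ a → f x ≡ v) →
            ∑ elements f ℕ.+ v ≡ f a ℕ.+ length elements ℕ.* v
  ∑-split a f = ∑-except unique (complete a)

  ∑-single : (a : A) (f : A → ℕ) → (∀ x → x ≢ a → f x ≡ 0) → ∑ elements f ≡ f a
  ∑-single a f e = begin
    ∑ elements f                ≡⟨ ℕ.+-identityʳ _ ⟨
    ∑ elements f ℕ.+ 0            ≡⟨ ∑-split a f e ⟩
    f a ℕ.+ length elements ℕ.* 0   ≡⟨ cong (f a ℕ.+_) (ℕ.*-zeroʳ (length elements)) ⟩
    f a ℕ.+ 0                     ≡⟨ ℕ.+-identityʳ _ ⟩
    f a                         ∎
    where open ≡-Reasoning

length-∑ : {A : Set} (xs : List A) → length xs ≡ ∑ xs (λ _ → 1)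
length-∑ xs = trans (sym (ℕ.*-identityʳ (length xs))) (sym (∑-const xs 1))

-- Brings the subtraction-free identity of `∑-split` into the shape of the second clause of `mix`.
except-value : ∀ {S v a q} → S ℕ.+ v ≡ a ℕ.+ q ℕ.* v → + S ≡ (+ a ℤ.- + v) ℤ.+ + q ℤ.* + v
except-value {S} {v} {a} {q} e = begin
  + S                                 ≡⟨ add-sub (+ S) (+ v) ⟩
  (+ S ℤ.+ + v) ℤ.- + v               ≡⟨ cong (λ n → + n ℤ.- + v) e ⟩
  (+ a ℤ.+ + (q ℕ.* v)) ℤ.- + v       ≡⟨ cong (λ z → (+ a ℤ.+ z) ℤ.- + v) (ℤ.pos-* q v) ⟩
  (+ a ℤ.+ + q ℤ.* + v) ℤ.- + v       ≡⟨ exchange (+ a) (+ q) (+ v) ⟩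
  (+ a ℤ.- + v) ℤ.+ + q ℤ.* + v       ∎
  where
  add-sub : ∀ s v → s ≡ (s ℤ.+ v) ℤ.- v
  add-sub = solve-∀
  exchange : ∀ a q v → (a ℤ.+ q ℤ.* v) ℤ.- v ≡ (a ℤ.- v) ℤ.+ q ℤ.* v
  exchange = solve-∀

-- Relative positions and the Hecke action

-- Arrangements of the four indices, generated by exactly the moves that `T₁`, `T₂`, `T₃` make on
-- tables and under which independence is known to be invariant. As the position of a flag ⟨b i⟩ ⊂
-- ⟨b i, b j⟩ ⊂ ⟨b i, b j, b k⟩ relative to that of the frame b, this is an element of S₄.
data Perm : (i j k l : Fin 4) → Set where
  identity : Perm 0F 1F 2F 3F
  swap₁ : ∀ {i j k l} → Perm i j k l → Perm j i k l
  swap₂ : ∀ {i j k l} → Perm i j k l → Perm i k j l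
  swap₃ : ∀ {i j k l} → Perm i j k l → Perm i j l k

record Distinct {A : Set} (i j k l : A) : Set where
  constructor distinct
  field
    i≢j : i ≢ j
    i≢k : i ≢ k
    i≢l : i ≢ l
    j≢k : j ≢ k
    j≢l : j ≢ l
    k≢l : k ≢ l

Perm⇒Distinct : ∀ {i j k l} → Perm i j k l → Distinct i j k l
Perm⇒Distinct identity = distinct (λ ()) (λ ()) (λ ()) (λ ()) (λ ()) (λ ())
Perm⇒Distinct (swap₁ π) with distinct ij ik il jk jl kl ← Perm⇒Distinct π = distinct (ij ∘ sym) jk jl ik il kl
Perm⇒Distinct (swap₂ π) with distinct ij ik il jk jl kl ← Perm⇒Distinct π = distinct ik ij il (jk ∘ sym) kl jl
Perm⇒Distinct (swap₃ π) with distinct ij ik il jk jl kl ← Perm⇒Distinct π = distinct ij il ik jl jk (kl ∘ sym)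

-- Functions on S₄, extended to all quadruples of indices so that no proof of distinctness has to be
-- carried; only the entries at permutations have a geometric meaning.
Table : Set → Set
Table A = Fin 4 → Fin 4 → Fin 4 → Fin 4 → A

infix 5 _<F_
_<F_ : Fin 4 → Fin 4 → Bool
i <F j = toℕ i ℕ.<ᵇ toℕ j

-- The action of a generator satisfying T² = (Q - 1)T + Q. Here `x` is the value after the
-- transposition and `y` the value before; on an ascent all q new flags are in the new position, on
-- a descent one is and the other q - 1 stay in the old one.
mix : ℤ → Bool → ℤ → ℤ → ℤ
mix Q true  x y = Q ℤ.* x
mix Q false x y = (x ℤ.- y) ℤ.+ Q ℤ.* y

T₁ T₂ T₃ M : ℤ → Table ℤ → Table ℤ
T₁ Q g i j k l = mix Q (i <F j) (g j i k l) (g i j k l)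
T₂ Q g i j k l = mix Q (j <F k) (g i k j l) (g i j k l)
T₃ Q g i j k l = mix Q (k <F l) (g i j l k) (g i j k l)
M Q g = T₃ Q (T₂ Q (T₁ Q g))

M^ : ℤ → ℕ → Table ℤ → Table ℤ
M^ Q zero    g = g
M^ Q (suc m) g = M Q (M^ Q m g)

-- The indicator of the longest permutation: a walk closes up without further points exactly when
-- the last flag is opposite to the first. A permutation beginning 3, 2, 1 leaves no choice for the
-- last index.
δ : Table ℤ
δ (suc (suc (suc zero))) (suc (suc zero)) (suc zero) _ = + 1
δ _ _ _ _ = + 0

-- The field and its vectors

record FiniteField (q : ℕ) : Set where
  infixl 6 _+_
  infixl 7 _*_
  infix 8 -_
  infix 9 _⁻¹
  field
    _+_ _*_ : Fin q → Fin q → Fin q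
    -_ _⁻¹ : Fin q → Fin q
    0# 1# : Fin q
    isCommutativeRing : IsCommutativeRing _≡_ _+_ _*_ -_ 0# 1#
    1≢0 : 1# ≢ 0#
    inverse : ∀ x → x ≢ 0# → x * x ⁻¹ ≡ 1#

Fin-enumeration : ∀ q → Enumeration (Fin q)
Fin-enumeration q = record { elements = allFin q ; complete = ∈-allFin ; unique = allFin⁺ q }

module Geometry {q : ℕ} (𝔽 : FiniteField q) where
  open FiniteField 𝔽

  commutativeRing : CommutativeRing 0ℓ 0ℓ
  commutativeRing = record { isCommutativeRing = isCommutativeRing }
  open CommutativeRing commutativeRing using (commutativeSemiring; +-identityˡ; +-identityʳ; *-identityˡ; *-identityʳ;
    zeroˡ; zeroʳ; -‿inverseʳ; -‿inverseˡ; +-assoc; +-comm; *-comm; *-assoc; distribˡ; distribʳ)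
  open import Algebra.Solver.Ring.NaturalCoefficients.Default commutativeSemiring using (solve; _:+_; _:*_; _:=_)

  F : Set
  F = Fin q

  infix 4 _≟_
  _≟_ : (x y : F) → Dec (x ≡ y)
  _≟_ = Fin._≟_

  inverseˡ : ∀ x → x ≢ 0# → x ⁻¹ * x ≡ 1#
  inverseˡ x x≢0 = trans (*-comm _ x) (inverse x x≢0)

  *-cancel-0 : ∀ x y → x ≢ 0# → x * y ≡ 0# → y ≡ 0#
  *-cancel-0 x y x≢0 xy≡0 = begin
    y                ≡⟨ *-identityˡ y ⟨
    1# * y           ≡⟨ cong (_* y) (inverseˡ x x≢0) ⟨
    x ⁻¹ * x * y     ≡⟨ *-assoc _ x y ⟩
    x ⁻¹ * (x * y)   ≡⟨ cong (x ⁻¹ *_) xy≡0 ⟩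
    x ⁻¹ * 0#        ≡⟨ zeroʳ _ ⟩
    0#               ∎

  ⁻¹-nonzero : ∀ x → x ≢ 0# → x ⁻¹ ≢ 0#
  ⁻¹-nonzero x x≢0 e = 1≢0 (trans (sym (inverse x x≢0)) (trans (cong (x *_) e) (zeroʳ x)))

  record V : Set where
    constructor ⟨_,_,_,_⟩
    field x₁ x₂ x₃ x₄ : F

  ⟨⟩-cong : ∀ {a a′ b b′ c c′ d d′} → a ≡ a′ → b ≡ b′ → c ≡ c′ → d ≡ d′ → ⟨ a , b , c , d ⟩ ≡ ⟨ a′ , b′ , c′ , d′ ⟩
  ⟨⟩-cong refl refl refl refl = refl

  infix 4 _≟V_
  _≟V_ : (v w : V) → Dec (v ≡ w)
  ⟨ a , b , c , d ⟩ ≟V ⟨ a′ , b′ , c′ , d′ ⟩ =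
    map′ (λ { (refl , refl , refl , refl) → refl }) (λ { refl → refl , refl , refl , refl })
         (a ≟ a′ ×-dec b ≟ b′ ×-dec c ≟ c′ ×-dec d ≟ d′)

  infixl 6 _⊕_
  infixr 7 _⊙_
  _⊕_ : V → V → V
  ⟨ a , b , c , d ⟩ ⊕ ⟨ a′ , b′ , c′ , d′ ⟩ = ⟨ a + a′ , b + b′ , c + c′ , d + d′ ⟩

  _⊙_ : F → V → V
  s ⊙ ⟨ a , b , c , d ⟩ = ⟨ s * a , s * b , s * c , s * d ⟩

  0V : V
  0V = ⟨ 0# , 0# , 0# , 0# ⟩

  ⊙-identity : ∀ v → 1# ⊙ v ≡ v
  ⊙-identity v = ⟨⟩-cong (*-identityˡ _) (*-identityˡ _) (*-identityˡ _) (*-identityˡ _)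

  ⊙-zeroˡ : ∀ v → 0# ⊙ v ≡ 0V
  ⊙-zeroˡ v = ⟨⟩-cong (zeroˡ _) (zeroˡ _) (zeroˡ _) (zeroˡ _)

  ⊙-zeroʳ : ∀ s → s ⊙ 0V ≡ 0V
  ⊙-zeroʳ s = ⟨⟩-cong (zeroʳ s) (zeroʳ s) (zeroʳ s) (zeroʳ s)

  ⊙-assoc : ∀ s t v → s ⊙ t ⊙ v ≡ (s * t) ⊙ v
  ⊙-assoc s t v = sym (⟨⟩-cong (*-assoc s t _) (*-assoc s t _) (*-assoc s t _) (*-assoc s t _))

  ⊙-distribˡ : ∀ s v w → s ⊙ (v ⊕ w) ≡ s ⊙ v ⊕ s ⊙ w
  ⊙-distribˡ s v w = ⟨⟩-cong (distribˡ s _ _) (distribˡ s _ _) (distribˡ s _ _) (distribˡ s _ _)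

  ⊙-distribʳ : ∀ v s t → (s + t) ⊙ v ≡ s ⊙ v ⊕ t ⊙ v
  ⊙-distribʳ v s t = ⟨⟩-cong (distribʳ _ s t) (distribʳ _ s t) (distribʳ _ s t) (distribʳ _ s t)

  ⊕-identityʳ : ∀ v → v ⊕ 0V ≡ v
  ⊕-identityʳ v = ⟨⟩-cong (+-identityʳ _) (+-identityʳ _) (+-identityʳ _) (+-identityʳ _)

  ⊕-identityˡ : ∀ v → 0V ⊕ v ≡ v
  ⊕-identityˡ v = ⟨⟩-cong (+-identityˡ _) (+-identityˡ _) (+-identityˡ _) (+-identityˡ _)

  ⊕-comm : ∀ v w → v ⊕ w ≡ w ⊕ v
  ⊕-comm v w = ⟨⟩-cong (+-comm _ _) (+-comm _ _) (+-comm _ _) (+-comm _ _)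

  ⊕-assoc : ∀ u v w → (u ⊕ v) ⊕ w ≡ u ⊕ (v ⊕ w)
  ⊕-assoc u v w = ⟨⟩-cong (+-assoc _ _ _) (+-assoc _ _ _) (+-assoc _ _ _) (+-assoc _ _ _)

  ⊕-swapʳ : ∀ u v w → u ⊕ v ⊕ w ≡ u ⊕ w ⊕ v
  ⊕-swapʳ u v w = trans (⊕-assoc u v w) (trans (cong (u ⊕_) (⊕-comm v w)) (sym (⊕-assoc u w v)))

  ⊕-0⊙ : ∀ v w → v ⊕ 0# ⊙ w ≡ v
  ⊕-0⊙ v w = trans (cong (v ⊕_) (⊙-zeroˡ w)) (⊕-identityʳ v)

  ⊕-inverse : ∀ v → v ⊕ (- 1#) ⊙ v ≡ 0V
  ⊕-inverse v = begin
    v ⊕ (- 1#) ⊙ v       ≡⟨ cong (_⊕ (- 1#) ⊙ v) (⊙-identity v) ⟨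
    1# ⊙ v ⊕ (- 1#) ⊙ v  ≡⟨ ⊙-distribʳ v 1# (- 1#) ⟨
    (1# + - 1#) ⊙ v      ≡⟨ cong (_⊙ v) (-‿inverseʳ 1#) ⟩
    0# ⊙ v               ≡⟨ ⊙-zeroˡ v ⟩
    0V                   ∎

  ⊕-inverse-unique : ∀ v w → v ⊕ (- 1#) ⊙ w ≡ 0V → v ≡ w
  ⊕-inverse-unique v w e = begin
    v                            ≡⟨ ⊕-identityʳ v ⟨
    v ⊕ 0V                       ≡⟨ cong (v ⊕_) (trans (⊕-comm _ w) (⊕-inverse w)) ⟨
    v ⊕ ((- 1#) ⊙ w ⊕ w)         ≡⟨ ⊕-assoc v _ w ⟨
    (v ⊕ (- 1#) ⊙ w) ⊕ w         ≡⟨ cong (_⊕ w) e ⟩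
    0V ⊕ w                       ≡⟨ ⊕-identityˡ w ⟩
    w                            ∎

  ⊙-injective : ∀ {s v w} → s ≢ 0# → s ⊙ v ≡ s ⊙ w → v ≡ w
  ⊙-injective {s} {v} {w} s≢0 e = begin
    v                ≡⟨ cancel v ⟨
    s ⁻¹ ⊙ s ⊙ v     ≡⟨ cong (s ⁻¹ ⊙_) e ⟩
    s ⁻¹ ⊙ s ⊙ w     ≡⟨ cancel w ⟩
    w                ∎
    where
    cancel : ∀ u → s ⁻¹ ⊙ s ⊙ u ≡ u
    cancel u = trans (⊙-assoc _ s u) (trans (cong (_⊙ u) (inverseˡ s s≢0)) (⊙-identity u))

  -- Linear independence

  comb : V → V → V → V → V → V
  comb ⟨ t₁ , t₂ , t₃ , t₄ ⟩ a b c d = ((t₁ ⊙ a ⊕ t₂ ⊙ b) ⊕ t₃ ⊙ c) ⊕ t₄ ⊙ d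

  comb-⊙ : ∀ s t a b c d → comb (s ⊙ t) a b c d ≡ s ⊙ comb t a b c d
  comb-⊙ s t a b c d = ⟨⟩-cong (lem _ _ _ _ _ _ _ _ _) (lem _ _ _ _ _ _ _ _ _) (lem _ _ _ _ _ _ _ _ _) (lem _ _ _ _ _ _ _ _ _)
    where
    lem : ∀ s t₁ t₂ t₃ t₄ a b c d → s * t₁ * a + s * t₂ * b + s * t₃ * c + s * t₄ * d ≡ s * (t₁ * a + t₂ * b + t₃ * c + t₄ * d)
    lem = solve 9 (λ s t₁ t₂ t₃ t₄ a b c d →
      s :* t₁ :* a :+ s :* t₂ :* b :+ s :* t₃ :* c :+ s :* t₄ :* d := s :* (t₁ :* a :+ t₂ :* b :+ t₃ :* c :+ t₄ :* d)) refl

  comb-⊕ : ∀ s t a b c d → comb (s ⊕ t) a b c d ≡ comb s a b c d ⊕ comb t a b c d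
  comb-⊕ s t a b c d = ⟨⟩-cong (lem _ _ _ _ _ _ _ _ _ _ _ _) (lem _ _ _ _ _ _ _ _ _ _ _ _) (lem _ _ _ _ _ _ _ _ _ _ _ _) (lem _ _ _ _ _ _ _ _ _ _ _ _)
    where
    lem : ∀ s₁ s₂ s₃ s₄ t₁ t₂ t₃ t₄ a b c d → (s₁ + t₁) * a + (s₂ + t₂) * b + (s₃ + t₃) * c + (s₄ + t₄) * d ≡
      s₁ * a + s₂ * b + s₃ * c + s₄ * d + (t₁ * a + t₂ * b + t₃ * c + t₄ * d)
    lem = solve 12 (λ s₁ s₂ s₃ s₄ t₁ t₂ t₃ t₄ a b c d → (s₁ :+ t₁) :* a :+ (s₂ :+ t₂) :* b :+ (s₃ :+ t₃) :* c :+ (s₄ :+ t₄) :* d :=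
      s₁ :* a :+ s₂ :* b :+ s₃ :* c :+ s₄ :* d :+ (t₁ :* a :+ t₂ :* b :+ t₃ :* c :+ t₄ :* d)) refl

  Ind : V → V → V → V → Set
  Ind a b c d = ∀ t → comb t a b c d ≡ 0V → t ≡ 0V

  Ind-cong : ∀ {a a′ b b′ c c′ d d′} → a ≡ a′ → b ≡ b′ → c ≡ c′ → d ≡ d′ → Ind a b c d ≡ Ind a′ b′ c′ d′
  Ind-cong refl refl refl refl = refl

  abstract
    -- A search through all q⁴ coefficient vectors. It is opaque so that type checking never unfolds
    -- the search; afterwards it is used only through its being a decision.
    Ind? : ∀ a b c d → Dec (Ind a b c d)
    Ind? a b c d = map′ (λ { h ⟨ t₁ , t₂ , t₃ , t₄ ⟩ → h t₁ t₂ t₃ t₄ }) (λ h t₁ t₂ t₃ t₄ → h ⟨ t₁ , t₂ , t₃ , t₄ ⟩)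
      (Fin.all? λ t₁ → Fin.all? λ t₂ → Fin.all? λ t₃ → Fin.all? λ t₄ →
        (comb ⟨ t₁ , t₂ , t₃ , t₄ ⟩ a b c d ≟V 0V) →-dec (⟨ t₁ , t₂ , t₃ , t₄ ⟩ ≟V 0V))

  ind : V → V → V → V → ℕ
  ind a b c d = ⟦ Ind? a b c d ⟧

  ind≡1 : ∀ {a b c d} → Ind a b c d → ind a b c d ≡ 1
  ind≡1 = ⟦⟧-true (Ind? _ _ _ _)

  ind≡0 : ∀ {a b c d} → ¬ Ind a b c d → ind a b c d ≡ 0
  ind≡0 = ⟦⟧-false (Ind? _ _ _ _)

  ind⇒Ind : ∀ {a b c d} → ind a b c d ≡ 1 → Ind a b c d
  ind⇒Ind {a} {b} {c} {d} e with yes h ← Ind? a b c d = h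

  ind-⇔ : ∀ {a b c d a′ b′ c′ d′} → (Ind a b c d → Ind a′ b′ c′ d′) → (Ind a′ b′ c′ d′ → Ind a b c d) →
          ind a b c d ≡ ind a′ b′ c′ d′
  ind-⇔ = ⟦⟧-⇔ (Ind? _ _ _ _) (Ind? _ _ _ _)

  Ind-swap₁₂ : ∀ {a b c d} → Ind a b c d → Ind b a c d
  Ind-swap₁₂ {a} {b} {c} {d} h t@(⟨ t₁ , t₂ , t₃ , t₄ ⟩) e
    with refl ← h ⟨ t₂ , t₁ , t₃ , t₄ ⟩ (trans (cong (λ v → v ⊕ t₃ ⊙ c ⊕ t₄ ⊙ d) (⊕-comm (t₂ ⊙ a) (t₁ ⊙ b))) e) = refl

  Ind-swap₂₃ : ∀ {a b c d} → Ind a b c d → Ind a c b d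
  Ind-swap₂₃ {a} {b} {c} {d} h t@(⟨ t₁ , t₂ , t₃ , t₄ ⟩) e
    with refl ← h ⟨ t₁ , t₃ , t₂ , t₄ ⟩ (trans (cong (_⊕ t₄ ⊙ d) (⊕-swapʳ (t₁ ⊙ a) (t₃ ⊙ b) (t₂ ⊙ c))) e) = refl

  Ind-swap₃₄ : ∀ {a b c d} → Ind a b c d → Ind a b d c
  Ind-swap₃₄ {a} {b} {c} {d} h t@(⟨ t₁ , t₂ , t₃ , t₄ ⟩) e
    with refl ← h ⟨ t₁ , t₂ , t₄ , t₃ ⟩ (trans (⊕-swapʳ (t₁ ⊙ a ⊕ t₂ ⊙ b) (t₄ ⊙ c) (t₃ ⊙ d)) e) = refl

  Ind-scale : ∀ {a b c d s} → s ≢ 0# → Ind a b c d → Ind a b c (s ⊙ d)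
  Ind-scale {a} {b} {c} {d} {s} s≢0 h ⟨ t₁ , t₂ , t₃ , t₄ ⟩ e =
    ⟨⟩-cong (cong V.x₁ eq) (cong V.x₂ eq) (cong V.x₃ eq)
      (*-cancel-0 s t₄ s≢0 (trans (*-comm s t₄) (cong V.x₄ eq)))
    where
    eq : ⟨ t₁ , t₂ , t₃ , t₄ * s ⟩ ≡ 0V
    eq = h _ (trans (cong ((t₁ ⊙ a ⊕ t₂ ⊙ b) ⊕ t₃ ⊙ c ⊕_) (sym (⊙-assoc t₄ s d))) e)

  comb-regroup : ∀ t₁ t₂ t₃ t₄ a b c d r →
                 comb ⟨ t₁ , t₂ , t₃ + t₄ * r , t₄ ⟩ a b c d ≡ comb ⟨ t₁ , t₂ , t₃ , t₄ ⟩ a b c (d ⊕ r ⊙ c)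
  comb-regroup t₁ t₂ t₃ t₄ a b c d r = begin
    u ⊕ (t₃ + t₄ * r) ⊙ c ⊕ t₄ ⊙ d          ≡⟨ cong (λ v → u ⊕ v ⊕ t₄ ⊙ d) (⊙-distribʳ c t₃ (t₄ * r)) ⟩
    u ⊕ (t₃ ⊙ c ⊕ (t₄ * r) ⊙ c) ⊕ t₄ ⊙ d    ≡⟨ cong (_⊕ t₄ ⊙ d) (⊕-assoc u _ _) ⟨
    u ⊕ t₃ ⊙ c ⊕ (t₄ * r) ⊙ c ⊕ t₄ ⊙ d      ≡⟨ ⊕-assoc (u ⊕ t₃ ⊙ c) _ _ ⟩
    u ⊕ t₃ ⊙ c ⊕ ((t₄ * r) ⊙ c ⊕ t₄ ⊙ d)    ≡⟨ cong (u ⊕ t₃ ⊙ c ⊕_) (⊕-comm _ _) ⟩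
    u ⊕ t₃ ⊙ c ⊕ (t₄ ⊙ d ⊕ (t₄ * r) ⊙ c)    ≡⟨ cong (λ v → u ⊕ t₃ ⊙ c ⊕ (t₄ ⊙ d ⊕ v)) (⊙-assoc t₄ r c) ⟨
    u ⊕ t₃ ⊙ c ⊕ (t₄ ⊙ d ⊕ t₄ ⊙ r ⊙ c)      ≡⟨ cong (u ⊕ t₃ ⊙ c ⊕_) (⊙-distribˡ t₄ d (r ⊙ c)) ⟨
    u ⊕ t₃ ⊙ c ⊕ t₄ ⊙ (d ⊕ r ⊙ c)           ∎
    where u = t₁ ⊙ a ⊕ t₂ ⊙ b

  Ind-add : ∀ {a b c d} r → Ind a b c d → Ind a b c (d ⊕ r ⊙ c)
  Ind-add {a} {b} {c} {d} r h ⟨ t₁ , t₂ , t₃ , t₄ ⟩ e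
    with eq ← h ⟨ t₁ , t₂ , t₃ + t₄ * r , t₄ ⟩ (trans (comb-regroup t₁ t₂ t₃ t₄ a b c d r) e)
    -- Once t₄ is 0, the correction t₄ r in the third coefficient disappears.
    with refl ← cong V.x₄ eq =
      ⟨⟩-cong (cong V.x₁ eq) (cong V.x₂ eq)
        (trans (sym (+-identityʳ t₃)) (trans (cong (λ z → t₃ + z) (sym (zeroˡ r))) (cong V.x₃ eq))) refl

  swap₁₂ : ∀ a b c d → ind a b c d ≡ ind b a c d
  swap₁₂ a b c d = ind-⇔ Ind-swap₁₂ Ind-swap₁₂

  swap₂₃ : ∀ a b c d → ind a b c d ≡ ind a c b d
  swap₂₃ a b c d = ind-⇔ Ind-swap₂₃ Ind-swap₂₃

  swap₃₄ : ∀ a b c d → ind a b c d ≡ ind a b d c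
  swap₃₄ a b c d = ind-⇔ Ind-swap₃₄ Ind-swap₃₄

  scale₄ : ∀ a b c d {s} → s ≢ 0# → ind a b c (s ⊙ d) ≡ ind a b c d
  scale₄ a b c d {s} s≢0 = ind-⇔
    (λ h → subst (Ind a b c) (trans (⊙-assoc _ s d) (trans (cong (_⊙ d) (inverseˡ s s≢0)) (⊙-identity d)))
             (Ind-scale (⁻¹-nonzero s s≢0) h))
    (Ind-scale s≢0)

  add₄₃ : ∀ a b c d r → ind a b c (d ⊕ r ⊙ c) ≡ ind a b c d
  add₄₃ a b c d r = ind-⇔ (λ h → subst (Ind a b c) undo (Ind-add (- r) h)) (Ind-add r)
    where
    undo : d ⊕ r ⊙ c ⊕ (- r) ⊙ c ≡ d
    undo = begin
      d ⊕ r ⊙ c ⊕ (- r) ⊙ c     ≡⟨ ⊕-assoc d _ _ ⟩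
      d ⊕ (r ⊙ c ⊕ (- r) ⊙ c)   ≡⟨ cong (d ⊕_) (⊙-distribʳ c r (- r)) ⟨
      d ⊕ (r + - r) ⊙ c         ≡⟨ cong (λ s → d ⊕ s ⊙ c) (-‿inverseʳ r) ⟩
      d ⊕ 0# ⊙ c                ≡⟨ ⊕-0⊙ d c ⟩
      d                         ∎

  ind-0 : ∀ a b c → ind a b c 0V ≡ 0
  ind-0 a b c = ind≡0 λ h → 1≢0 (cong V.x₄ (h ⟨ 0# , 0# , 0# , 1# ⟩ (begin
    0# ⊙ a ⊕ 0# ⊙ b ⊕ 0# ⊙ c ⊕ 1# ⊙ 0V  ≡⟨ cong (0# ⊙ a ⊕ 0# ⊙ b ⊕ 0# ⊙ c ⊕_) (⊙-zeroʳ 1#) ⟩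
    0# ⊙ a ⊕ 0# ⊙ b ⊕ 0# ⊙ c ⊕ 0V       ≡⟨ ⊕-identityʳ _ ⟩
    0# ⊙ a ⊕ 0# ⊙ b ⊕ 0# ⊙ c            ≡⟨ ⊕-0⊙ _ c ⟩
    0# ⊙ a ⊕ 0# ⊙ b                     ≡⟨ ⊕-0⊙ _ b ⟩
    0# ⊙ a                              ≡⟨ ⊙-zeroˡ a ⟩
    0V                                  ∎)))

  -- Sums over projective space

  ∑F : (F → ℕ) → ℕ
  ∑F = ∑ (allFin q)

  ∑F-const : ∀ c → ∑F (λ _ → c) ≡ q ℕ.* c
  ∑F-const c = trans (∑-const (allFin q) c) (cong (ℕ._* c) (length-tabulate {n = q} id))

  pairs : List (F × F)
  pairs = cartesianProduct (allFin q) (allFin q)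

  join : F × F → F × F → V
  join (a , b) (c , d) = ⟨ a , b , c , d ⟩

  V-enumeration : Enumeration V
  V-enumeration = record
    { elements = cartesianProductWith join pairs pairs
    ; complete = λ { ⟨ a , b , c , d ⟩ → ∈-cartesianProductWith⁺ join (∈-pairs a b) (∈-pairs c d) }
    ; unique   = cartesianProductWith⁺ join (λ { refl → refl , refl }) unique-pairs unique-pairs
    }
    where
    ∈-pairs = λ a b → ∈-cartesianProduct⁺ (∈-allFin a) (∈-allFin b)
    unique-pairs = cartesianProduct⁺ (allFin⁺ q) (allFin⁺ q)

  vectors : List V
  vectors = Enumeration.elements V-enumeration

  ∑V-coordinates : ∀ f → ∑ vectors f ≡ ∑F λ a → ∑F λ b → ∑F λ c → ∑F λ d → f ⟨ a , b , c , d ⟩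
  ∑V-coordinates f = begin
    ∑ vectors f
      ≡⟨ ∑-product join pairs pairs f ⟩
    ∑ pairs (λ ab → ∑ pairs (λ cd → f (join ab cd)))
      ≡⟨ ∑-product _,_ (allFin q) (allFin q) _ ⟩
    (∑F λ a → ∑F λ b → ∑ pairs (λ cd → f (join (a , b) cd)))
      ≡⟨ (∑-cong (allFin q) λ a → ∑-cong (allFin q) λ b → ∑-product _,_ (allFin q) (allFin q) _) ⟩
    (∑F λ a → ∑F λ b → ∑F λ c → ∑F λ d → f ⟨ a , b , c , d ⟩) ∎

  infixr 5 _orElse_
  _orElse_ : F → F → F
  a orElse b with a ≟ 0#
  ... | yes _ = b
  ... | no _  = a

  lead : V → F
  lead ⟨ a , b , c , d ⟩ = a orElse b orElse c orElse d

  orElse-0 : ∀ b → 0# orElse b ≡ b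
  orElse-0 b with 0# ≟ 0#
  ... | yes _  = refl
  ... | no 0≢0 = ⊥-elim (0≢0 refl)

  orElse-≢0 : ∀ {a} b → a ≢ 0# → a orElse b ≡ a
  orElse-≢0 {a} b a≢0 with a ≟ 0#
  ... | yes a≡0 = ⊥-elim (a≢0 a≡0)
  ... | no _    = refl

  orElse≡0 : ∀ a b → a orElse b ≡ 0# → a ≡ 0# × b ≡ 0#
  orElse≡0 a b e with a ≟ 0#
  ... | yes a≡0 = a≡0 , e
  ... | no a≢0  = ⊥-elim (a≢0 e)

  orElse-* : ∀ s a b → s ≢ 0# → (s * a) orElse (s * b) ≡ s * (a orElse b)
  orElse-* s a b s≢0 with a ≟ 0#
  ... | yes refl = trans (cong (_orElse (s * b)) (zeroʳ s)) (orElse-0 (s * b))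
  ... | no a≢0   = orElse-≢0 (s * b) (a≢0 ∘ *-cancel-0 s a s≢0)

  lead-0 : lead 0V ≡ 0#
  lead-0 = trans (orElse-0 _) (trans (orElse-0 _) (orElse-0 _))

  lead≡0 : ∀ v → lead v ≡ 0# → v ≡ 0V
  lead≡0 ⟨ a , b , c , d ⟩ e
    with a≡0 , e′ ← orElse≡0 a _ e
    with b≡0 , e″ ← orElse≡0 b _ e′
    with c≡0 , d≡0 ← orElse≡0 c d e″ = ⟨⟩-cong a≡0 b≡0 c≡0 d≡0

  lead-⊙ : ∀ s v → lead (s ⊙ v) ≡ s * lead v
  lead-⊙ s v@(⟨ a , b , c , d ⟩) with s ≟ 0#
  ... | yes refl = trans (cong lead (⊙-zeroˡ v)) (trans lead-0 (sym (zeroˡ (lead v))))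
  ... | no s≢0   = begin
    (s * a) orElse (s * b) orElse (s * c) orElse (s * d)
      ≡⟨ cong (λ x → (s * a) orElse (s * b) orElse x) (orElse-* s c d s≢0) ⟩
    (s * a) orElse (s * b) orElse (s * (c orElse d))
      ≡⟨ cong ((s * a) orElse_) (orElse-* s b _ s≢0) ⟩
    (s * a) orElse (s * (b orElse c orElse d))
      ≡⟨ orElse-* s a _ s≢0 ⟩
    s * lead v ∎

  -- Every line of K⁴ contains exactly one vector with leading coordinate 1, so this lists
  -- projective space without a quotient.
  points : List V
  points = filter (λ v → lead v ≟ 1#) vectors

  ∑P : (V → ℕ) → ℕ
  ∑P = ∑ points

  normal : V → ℕ
  normal v = ⟦ lead v ≟ 1# ⟧

  nonzero : V → ℕ
  nonzero v = ⟦ ¬? (lead v ≟ 0#) ⟧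

  ∑P-normal : ∀ H → ∑P H ≡ ∑ vectors λ v → normal v ℕ.* H v
  ∑P-normal H = ∑-filter (λ v → lead v ≟ 1#) vectors H

  -- By homogeneity of `lead`, the only scalar that normalises a nonzero vector is the inverse of
  -- its leading coordinate, and none normalises the zero vector.
  nonzero-normal : ∀ v → nonzero v ≡ ∑F λ s → normal (s ⊙ v)
  nonzero-normal v with lead v ≟ 0#
  ... | yes e = sym (∑-zero (allFin q) λ s → ⟦⟧-false (lead (s ⊙ v) ≟ 1#) λ e′ →
      1≢0 (trans (sym e′) (trans (lead-⊙ s v) (trans (cong (s *_) e) (zeroʳ s)))))
  ... | no l≢0 = sym (trans (∑-single (Fin-enumeration q) (lead v ⁻¹) _ others)
                           (⟦⟧-true (lead (lead v ⁻¹ ⊙ v) ≟ 1#) (trans (lead-⊙ _ v) (inverseˡ (lead v) l≢0))))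
    where
    others : ∀ s → s ≢ lead v ⁻¹ → normal (s ⊙ v) ≡ 0
    others s s≢ = ⟦⟧-false (lead (s ⊙ v) ≟ 1#) λ e → s≢ (begin
      s                            ≡⟨ *-identityʳ s ⟨
      s * 1#                       ≡⟨ cong (s *_) (inverse (lead v) l≢0) ⟨
      s * (lead v * lead v ⁻¹)     ≡⟨ *-assoc s _ _ ⟨
      s * lead v * lead v ⁻¹       ≡⟨ cong (_* lead v ⁻¹) (trans (sym (lead-⊙ s v)) e) ⟩
      1# * lead v ⁻¹               ≡⟨ *-identityˡ _ ⟩
      lead v ⁻¹                    ∎)

  Homogeneous : (V → ℕ) → Set
  Homogeneous H = ∀ s v → s ≢ 0# → H (s ⊙ v) ≡ H v

  -- Double counting of pairs (s, v) with s v normal. For each of the q - 1 nonzero s, the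
  -- substitution v ↦ s v gives back `∑P H`; the identity says that the sum over nonzero vectors is
  -- (q - 1) `∑P H`.
  ∑-nonzero : ∀ H → Homogeneous H →
              (∑ vectors λ v → nonzero v ℕ.* H v) ℕ.+ ∑P H ≡ q ℕ.* ∑P H
  ∑-nonzero H hom = begin
    (∑ vectors λ v → nonzero v ℕ.* H v) ℕ.+ ∑P H
      ≡⟨ cong (ℕ._+ ∑P H) (∑-cong vectors λ v → trans (ℕ.*-comm (nonzero v) (H v))
           (trans (cong (H v ℕ.*_) (nonzero-normal v)) (sym (∑-*ˡ (allFin q) (H v) _)))) ⟩
    (∑ vectors λ v → ∑F λ s → H v ℕ.* normal (s ⊙ v)) ℕ.+ ∑P H
      ≡⟨ cong (ℕ._+ ∑P H) (∑-swap vectors (allFin q) _) ⟩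
    (∑F λ s → ∑ vectors λ v → H v ℕ.* normal (s ⊙ v)) ℕ.+ ∑P H
      ≡⟨ ∑-split (Fin-enumeration q) 0# _ nonzero-scalar ⟩
    (∑ vectors λ v → H v ℕ.* normal (0# ⊙ v)) ℕ.+ length (allFin q) ℕ.* ∑P H
      ≡⟨ cong₂ ℕ._+_ (∑-zero vectors zero-scalar) (cong (ℕ._* ∑P H) (length-tabulate {n = q} id)) ⟩
    q ℕ.* ∑P H ∎
    where
    zero-scalar : ∀ v → H v ℕ.* normal (0# ⊙ v) ≡ 0
    zero-scalar v = trans (cong (H v ℕ.*_) (⟦⟧-false (lead (0# ⊙ v) ≟ 1#) λ e → 1≢0 (trans (sym e)
      (trans (lead-⊙ 0# v) (zeroˡ _))))) (ℕ.*-zeroʳ (H v))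
    nonzero-scalar : ∀ s → s ≢ 0# → (∑ vectors λ v → H v ℕ.* normal (s ⊙ v)) ≡ ∑P H
    nonzero-scalar s s≢0 = begin
      (∑ vectors λ v → H v ℕ.* normal (s ⊙ v))
        ≡⟨ ∑-cong vectors (λ v → trans (ℕ.*-comm (H v) _) (cong (normal (s ⊙ v) ℕ.*_) (sym (hom s v s≢0)))) ⟩
      (∑ vectors λ v → normal (s ⊙ v) ℕ.* H (s ⊙ v))
        ≡⟨ ∑-reindex V-enumeration (s ⊙_) (⊙-injective s≢0) (λ v → normal v ℕ.* H v) ⟩
      (∑ vectors λ v → normal v ℕ.* H v)
        ≡⟨ ∑P-normal H ⟨
      ∑P H ∎

  -- Both S and T solve X = (q - 1) S, and two distinct elements force q ≥ 2, so the factor can be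
  -- cancelled.
  cancel-q∸1 : ∀ {q} (a b : Fin q) → a ≢ b → ∀ X S T → X ℕ.+ S ≡ q ℕ.* S → X ℕ.+ T ≡ q ℕ.* T → S ≡ T
  cancel-q∸1 {suc zero} zero zero a≢b X S T eS eT = ⊥-elim (a≢b refl)
  cancel-q∸1 {suc (suc p)} a b a≢b X S T eS eT = ℕ.*-cancelˡ-≡ S T (suc p) (trans (sym (drop S eS)) (drop T eT))
    where
    drop : ∀ U → X ℕ.+ U ≡ U ℕ.+ suc p ℕ.* U → X ≡ suc p ℕ.* U
    drop U e = ℕ.+-cancelˡ-≡ U X _ (trans (ℕ.+-comm U X) e)

  comb-injective : ∀ {a b c d} → Ind a b c d → ∀ {s t} → comb s a b c d ≡ comb t a b c d → s ≡ t
  comb-injective {a} {b} {c} {d} h {s} {t} e = ⊕-inverse-unique s t (h _ (begin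
    comb (s ⊕ (- 1#) ⊙ t) a b c d                 ≡⟨ comb-⊕ s _ a b c d ⟩
    comb s a b c d ⊕ comb ((- 1#) ⊙ t) a b c d    ≡⟨ cong₂ _⊕_ e (comb-⊙ (- 1#) t a b c d) ⟩
    comb t a b c d ⊕ (- 1#) ⊙ comb t a b c d      ≡⟨ ⊕-inverse _ ⟩
    0V                                            ∎))

  comb-0 : ∀ a b c d → comb 0V a b c d ≡ 0V
  comb-0 a b c d = begin
    comb 0V a b c d           ≡⟨ cong (λ t → comb t a b c d) (⊙-zeroˡ 0V) ⟨
    comb (0# ⊙ 0V) a b c d    ≡⟨ comb-⊙ 0# 0V a b c d ⟩
    0# ⊙ comb 0V a b c d      ≡⟨ ⊙-zeroˡ _ ⟩
    0V                        ∎

  -- The normal vectors and their images under a linear automorphism are two systems of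
  -- representatives of projective space; both sums are compared with the one over all
  -- nonzero vectors.
  ∑P-basis-change : ∀ {a b c d} → Ind a b c d → ∀ H → Homogeneous H →
                    ∑P H ≡ ∑P (λ t → H (comb t a b c d))
  ∑P-basis-change {a} {b} {c} {d} h H hom =
    cancel-q∸1 1# 0# 1≢0 _ _ _ (∑-nonzero H hom)
      (trans (cong (ℕ._+ ∑P (H ∘ g)) (sym transport)) (∑-nonzero (H ∘ g) λ s t s≢0 →
        trans (cong H (comb-⊙ s t a b c d)) (hom s (g t) s≢0)))
    where
    g : V → V
    g t = comb t a b c d
    transport : (∑ vectors λ t → nonzero t ℕ.* H (g t)) ≡ (∑ vectors λ v → nonzero v ℕ.* H v)
    transport = trans
      (∑-cong vectors λ t → cong (ℕ._* H (g t)) (⟦⟧-⇔ (¬? (lead t ≟ 0#)) (¬? (lead (g t) ≟ 0#))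
        (λ t≢0 e → t≢0 (trans (cong lead (h t (lead≡0 (g t) e))) lead-0))
        (λ gt≢0 e → gt≢0 (trans (cong (lead ∘ g) (lead≡0 t e)) (trans (cong lead (comb-0 a b c d)) lead-0)))))
      (∑-reindex V-enumeration g (comb-injective h) (λ v → nonzero v ℕ.* H v))

  -- In a normal vector a coordinate preceded only by zeros is 0 or 1; this peels off such
  -- coordinates one by one in `∑P-cells`.
  ∑F-01 : ∀ (f : F → ℕ) → (∀ t → t ≢ 0# → t ≢ 1# → f t ≡ 0) → ∑F f ≡ f 0# ℕ.+ f 1#
  ∑F-01 f others = begin
    ∑F f
      ≡⟨ ∑-cong (allFin q) (λ t → split (t ≟ 0#)) ⟩
    (∑F λ t → at-0 t ℕ.+ off-0 t)
      ≡⟨ ∑-+ (allFin q) at-0 off-0 ⟩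
    ∑F at-0 ℕ.+ ∑F off-0
      ≡⟨ cong₂ ℕ._+_ (∑-single (Fin-enumeration q) 0# at-0 λ t t≢0 → cong (ℕ._* f t) (⟦⟧-false (t ≟ 0#) t≢0))
                     (∑-single (Fin-enumeration q) 1# off-0 off-0-others) ⟩
    at-0 0# ℕ.+ off-0 1#
      ≡⟨ cong₂ ℕ._+_ (trans (cong (ℕ._* f 0#) (⟦⟧-true (0# ≟ 0#) refl)) (ℕ.*-identityˡ _))
                     (trans (cong (ℕ._* f 1#) (⟦⟧-true (¬? (1# ≟ 0#)) 1≢0)) (ℕ.*-identityˡ _)) ⟩
    f 0# ℕ.+ f 1# ∎
    where
    at-0 off-0 : F → ℕ
    at-0 t = ⟦ t ≟ 0# ⟧ ℕ.* f t
    off-0 t = ⟦ ¬? (t ≟ 0#) ⟧ ℕ.* f t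
    split : ∀ {t} (t≟0 : Dec (t ≡ 0#)) → f t ≡ ⟦ t≟0 ⟧ ℕ.* f t ℕ.+ ⟦ ¬? t≟0 ⟧ ℕ.* f t
    split {t} (yes _) = sym (trans (ℕ.+-identityʳ _) (ℕ.*-identityˡ (f t)))
    split {t} (no _)  = sym (ℕ.*-identityˡ (f t))
    off-0-others : ∀ t → t ≢ 1# → off-0 t ≡ 0
    off-0-others t t≢1 with t ≟ 0#
    ... | yes _  = refl
    ... | no t≢0 = trans (ℕ.*-identityˡ _) (others t t≢0 t≢1)

  ∑F-orElse : ∀ (rest : F) (K : F → ℕ) → ∀ t → t ≢ 0# → t ≢ 1# → ⟦ t orElse rest ≟ 1# ⟧ ℕ.* K t ≡ 0
  ∑F-orElse rest K t t≢0 t≢1 = cong (ℕ._* K t) (⟦⟧-false (t orElse rest ≟ 1#) λ e → t≢1 (trans (sym (orElse-≢0 rest t≢0)) e))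

  orElse-1 : ∀ rest k → ⟦ 1# orElse rest ≟ 1# ⟧ ℕ.* k ≡ k
  orElse-1 rest k = trans (cong (ℕ._* k) (⟦⟧-true (1# orElse rest ≟ 1#) (orElse-≢0 rest 1≢0))) (ℕ.*-identityˡ k)

  orElse-0-≟ : ∀ rest k → ⟦ 0# orElse rest ≟ 1# ⟧ ℕ.* k ≡ ⟦ rest ≟ 1# ⟧ ℕ.* k
  orElse-0-≟ rest k = cong (λ x → ⟦ x ≟ 1# ⟧ ℕ.* k) (orElse-0 rest)

  -- The position of the leading 1 cuts projective space into affine cells of dimension 0, 1, 2, 3.
  ∑P-cells : ∀ K → ∑P K ≡ K ⟨ 0# , 0# , 0# , 1# ⟩
                     ℕ.+ (∑F λ w → K ⟨ 0# , 0# , 1# , w ⟩)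
                     ℕ.+ (∑F λ v → ∑F λ w → K ⟨ 0# , 1# , v , w ⟩)
                     ℕ.+ (∑F λ u → ∑F λ v → ∑F λ w → K ⟨ 1# , u , v , w ⟩)
  ∑P-cells K = begin
    ∑P K
      ≡⟨ ∑P-normal K ⟩
    (∑ vectors λ v → normal v ℕ.* K v)
      ≡⟨ ∑V-coordinates _ ⟩
    (∑F λ t → ∑F λ u → ∑F λ v → ∑F λ w → ⟦ t orElse u orElse v orElse w ≟ 1# ⟧ ℕ.* K ⟨ t , u , v , w ⟩)
      ≡⟨ ∑F-01 _ (λ t t≢0 t≢1 → ∑-zero (allFin q) λ u → ∑-zero (allFin q) λ v → ∑-zero (allFin q) λ w → ∑F-orElse _ (λ t → K ⟨ t , u , v , w ⟩) t t≢0 t≢1) ⟩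
    (∑F λ u → ∑F λ v → ∑F λ w → ⟦ 0# orElse u orElse v orElse w ≟ 1# ⟧ ℕ.* K ⟨ 0# , u , v , w ⟩) ℕ.+
    (∑F λ u → ∑F λ v → ∑F λ w → ⟦ 1# orElse u orElse v orElse w ≟ 1# ⟧ ℕ.* K ⟨ 1# , u , v , w ⟩)
      ≡⟨ cong₂ ℕ._+_ (∑-cong (allFin q) λ u → ∑-cong (allFin q) λ v → ∑-cong (allFin q) λ w → orElse-0-≟ _ _)
                     (∑-cong (allFin q) λ u → ∑-cong (allFin q) λ v → ∑-cong (allFin q) λ w → orElse-1 _ _) ⟩
    (∑F λ u → ∑F λ v → ∑F λ w → ⟦ u orElse v orElse w ≟ 1# ⟧ ℕ.* K ⟨ 0# , u , v , w ⟩) ℕ.+ cell₄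
      ≡⟨ cong (ℕ._+ cell₄) (∑F-01 _ (λ u u≢0 u≢1 → ∑-zero (allFin q) λ v → ∑-zero (allFin q) λ w → ∑F-orElse _ (λ u → K ⟨ 0# , u , v , w ⟩) u u≢0 u≢1)) ⟩
    (∑F λ v → ∑F λ w → ⟦ 0# orElse v orElse w ≟ 1# ⟧ ℕ.* K ⟨ 0# , 0# , v , w ⟩) ℕ.+
    (∑F λ v → ∑F λ w → ⟦ 1# orElse v orElse w ≟ 1# ⟧ ℕ.* K ⟨ 0# , 1# , v , w ⟩) ℕ.+ cell₄
      ≡⟨ cong (ℕ._+ cell₄) (cong₂ ℕ._+_ (∑-cong (allFin q) λ v → ∑-cong (allFin q) λ w → orElse-0-≟ _ _)
                     (∑-cong (allFin q) λ v → ∑-cong (allFin q) λ w → orElse-1 _ _)) ⟩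
    (∑F λ v → ∑F λ w → ⟦ v orElse w ≟ 1# ⟧ ℕ.* K ⟨ 0# , 0# , v , w ⟩) ℕ.+ cell₃ ℕ.+ cell₄
      ≡⟨ cong (λ x → x ℕ.+ cell₃ ℕ.+ cell₄) (∑F-01 _ (λ v v≢0 v≢1 → ∑-zero (allFin q) λ w → ∑F-orElse _ (λ v → K ⟨ 0# , 0# , v , w ⟩) v v≢0 v≢1)) ⟩
    (∑F λ w → ⟦ 0# orElse w ≟ 1# ⟧ ℕ.* K ⟨ 0# , 0# , 0# , w ⟩) ℕ.+
    (∑F λ w → ⟦ 1# orElse w ≟ 1# ⟧ ℕ.* K ⟨ 0# , 0# , 1# , w ⟩) ℕ.+ cell₃ ℕ.+ cell₄
      ≡⟨ cong (λ x → x ℕ.+ cell₃ ℕ.+ cell₄) (cong₂ ℕ._+_ cell₁-value (∑-cong (allFin q) λ w → orElse-1 _ _)) ⟩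
    K ⟨ 0# , 0# , 0# , 1# ⟩ ℕ.+ cell₂ ℕ.+ cell₃ ℕ.+ cell₄ ∎
    where
    cell₂ = ∑F λ w → K ⟨ 0# , 0# , 1# , w ⟩
    cell₃ = ∑F λ v → ∑F λ w → K ⟨ 0# , 1# , v , w ⟩
    cell₄ = ∑F λ u → ∑F λ v → ∑F λ w → K ⟨ 1# , u , v , w ⟩
    cell₁-value : (∑F λ w → ⟦ 0# orElse w ≟ 1# ⟧ ℕ.* K ⟨ 0# , 0# , 0# , w ⟩) ≡ K ⟨ 0# , 0# , 0# , 1# ⟩
    cell₁-value = trans (∑-single (Fin-enumeration q) 1# _ λ w w≢1 →
        cong (ℕ._* K ⟨ 0# , 0# , 0# , w ⟩) (⟦⟧-false (0# orElse w ≟ 1#) λ e → w≢1 (trans (sym (orElse-0 w)) e)))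
      (trans (cong (ℕ._* K ⟨ 0# , 0# , 0# , 1# ⟩) (⟦⟧-true (0# orElse 1# ≟ 1#) (orElse-0 1#))) (ℕ.*-identityˡ _))

  -- Schubert cells of projective space with respect to the flag ⟨d⟩ ⊂ ⟨d,c⟩ ⊂ ⟨d,c,b⟩.
  ∑P-Schubert : ∀ {a b c d} → ind a b c d ≡ 1 → ∀ H → Homogeneous H →
    ∑P H ≡ H d ℕ.+ (∑F λ w → H (c ⊕ w ⊙ d)) ℕ.+ (∑F λ v → ∑F λ w → H (b ⊕ v ⊙ c ⊕ w ⊙ d))
             ℕ.+ (∑F λ u → ∑F λ v → ∑F λ w → H (a ⊕ u ⊙ b ⊕ v ⊙ c ⊕ w ⊙ d))
  ∑P-Schubert {a} {b} {c} {d} basis H hom =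
    trans (∑P-basis-change (ind⇒Ind basis) H hom) (trans (∑P-cells _)
      (cong₂ ℕ._+_ (cong₂ ℕ._+_ (cong₂ ℕ._+_
        (cong H (trans (cong₂ _⊕_ (trans (⊕-0⊙ _ c) (trans (⊕-0⊙ _ b) (⊙-zeroˡ a))) (⊙-identity d)) (⊕-identityˡ d)))
        (∑-cong (allFin q) λ w → cong (λ x → H (x ⊕ w ⊙ d)) (trans (cong₂ _⊕_ (trans (⊕-0⊙ _ b) (⊙-zeroˡ a)) (⊙-identity c)) (⊕-identityˡ c))))
        (∑-cong (allFin q) λ v → ∑-cong (allFin q) λ w → cong (λ x → H (x ⊕ v ⊙ c ⊕ w ⊙ d)) (trans (cong₂ _⊕_ (⊙-zeroˡ a) (⊙-identity b)) (⊕-identityˡ b))))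
        (∑-cong (allFin q) λ u → ∑-cong (allFin q) λ v → ∑-cong (allFin q) λ w → cong (λ x → H (x ⊕ u ⊙ b ⊕ v ⊙ c ⊕ w ⊙ d)) (⊙-identity a))))

  -- Elementary operations on a quadruple, carried from the last slots to all others by
  -- transpositions

  scale₃ : ∀ a b c d {s} → s ≢ 0# → ind a b (s ⊙ c) d ≡ ind a b c d
  scale₃ a b c d {s} s≢0 = trans (swap₃₄ a b (s ⊙ c) d) (trans (scale₄ a b d c s≢0) (swap₃₄ a b d c))

  scale₂ : ∀ a b c d {s} → s ≢ 0# → ind a (s ⊙ b) c d ≡ ind a b c d
  scale₂ a b c d {s} s≢0 = trans (swap₂₃ a (s ⊙ b) c d) (trans (scale₃ a c b d s≢0) (swap₂₃ a c b d))

  scale₁ : ∀ a b c d {s} → s ≢ 0# → ind (s ⊙ a) b c d ≡ ind a b c d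
  scale₁ a b c d {s} s≢0 = trans (swap₁₂ (s ⊙ a) b c d) (trans (scale₂ b a c d s≢0) (swap₁₂ b a c d))

  add₄₂ : ∀ a b c d r → ind a b c (d ⊕ r ⊙ b) ≡ ind a b c d
  add₄₂ a b c d r = trans (swap₂₃ a b c (d ⊕ r ⊙ b)) (trans (add₄₃ a c b d r) (swap₂₃ a c b d))

  add₄₁ : ∀ a b c d r → ind a b c (d ⊕ r ⊙ a) ≡ ind a b c d
  add₄₁ a b c d r = trans (swap₁₂ a b c (d ⊕ r ⊙ a)) (trans (add₄₂ b a c d r) (swap₁₂ b a c d))

  add₃₂ : ∀ a b c d r → ind a b (c ⊕ r ⊙ b) d ≡ ind a b c d
  add₃₂ a b c d r = trans (swap₃₄ a b (c ⊕ r ⊙ b) d) (trans (add₄₂ a b d c r) (swap₃₄ a b d c))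

  add₃₁ : ∀ a b c d r → ind a b (c ⊕ r ⊙ a) d ≡ ind a b c d
  add₃₁ a b c d r = trans (swap₃₄ a b (c ⊕ r ⊙ a) d) (trans (add₄₁ a b d c r) (swap₃₄ a b d c))

  add₂₁ : ∀ a b c d r → ind a (b ⊕ r ⊙ a) c d ≡ ind a b c d
  add₂₁ a b c d r = trans (swap₂₃ a (b ⊕ r ⊙ a) c d) (trans (add₃₁ a c b d r) (swap₂₃ a c b d))

  add₂₃ : ∀ a b c d r → ind a (b ⊕ r ⊙ c) c d ≡ ind a b c d
  add₂₃ a b c d r = trans (swap₂₃ a (b ⊕ r ⊙ c) c d) (trans (add₃₂ a c b d r) (swap₂₃ a c b d))

  add₁₂ : ∀ a b c d r → ind (a ⊕ r ⊙ b) b c d ≡ ind a b c d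
  add₁₂ a b c d r = trans (swap₁₂ (a ⊕ r ⊙ b) b c d) (trans (add₂₁ b a c d r) (swap₁₂ b a c d))

  add₁₃ : ∀ a b c d r → ind (a ⊕ r ⊙ c) b c d ≡ ind a b c d
  add₁₃ a b c d r = trans (swap₁₂ (a ⊕ r ⊙ c) b c d) (trans (add₂₃ b a c d r) (swap₁₂ b a c d))

  add₃₄ : ∀ a b c d r → ind a b (c ⊕ r ⊙ d) d ≡ ind a b c d
  add₃₄ a b c d r = trans (swap₃₄ a b (c ⊕ r ⊙ d) d) (trans (add₄₃ a b d c r) (swap₃₄ a b d c))

  add₂₄ : ∀ a b c d r → ind a (b ⊕ r ⊙ d) c d ≡ ind a b c d
  add₂₄ a b c d r = trans (swap₂₃ a (b ⊕ r ⊙ d) c d) (trans (add₃₄ a c b d r) (swap₂₃ a c b d))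

  add₁₄ : ∀ a b c d r → ind (a ⊕ r ⊙ d) b c d ≡ ind a b c d
  add₁₄ a b c d r = trans (swap₁₂ (a ⊕ r ⊙ d) b c d) (trans (add₂₄ b a c d r) (swap₁₂ b a c d))

  equal₃₄ : ∀ a b c → ind a b c c ≡ 0
  equal₃₄ a b c = begin
    ind a b c c              ≡⟨ cong (ind a b c) (trans (⊕-identityˡ (1# ⊙ c)) (⊙-identity c)) ⟨
    ind a b c (0V ⊕ 1# ⊙ c)  ≡⟨ add₄₃ a b c 0V 1# ⟩
    ind a b c 0V             ≡⟨ ind-0 a b c ⟩
    0                        ∎

  equal₂₄ : ∀ a b c → ind a b c b ≡ 0
  equal₂₄ a b c = trans (swap₂₃ a b c b) (equal₃₄ a c b)

  equal₁₄ : ∀ a b c → ind a b c a ≡ 0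
  equal₁₄ a b c = trans (swap₁₂ a b c a) (equal₂₄ b a c)

  equal₁₃ : ∀ a b d → ind a b a d ≡ 0
  equal₁₃ a b d = trans (swap₃₄ a b a d) (equal₁₄ a b d)

  equal₁₂ : ∀ a c d → ind a a c d ≡ 0
  equal₁₂ a c d = trans (swap₂₃ a a c d) (equal₁₃ a c d)

  equal₂₃ : ∀ a b d → ind a b b d ≡ 0
  equal₂₃ a b d = trans (swap₃₄ a b b d) (equal₂₄ a b d)

  ind-reverse : ∀ a b c d → ind d c b a ≡ ind a b c d
  ind-reverse a b c d = begin
    ind d c b a  ≡⟨ swap₁₂ d c b a ⟩
    ind c d b a  ≡⟨ swap₂₃ c d b a ⟩
    ind c b d a  ≡⟨ swap₃₄ c b d a ⟩
    ind c b a d  ≡⟨ swap₁₂ c b a d ⟩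
    ind b c a d  ≡⟨ swap₂₃ b c a d ⟩
    ind b a c d  ≡⟨ swap₁₂ b a c d ⟩
    ind a b c d  ∎

  ∑F-values : ∀ {f c} → (∀ w → f w ≡ c) → ∑F f ≡ q ℕ.* c
  ∑F-values e = trans (∑-cong (allFin q) e) (∑F-const _)

  -- The cells now belong to the flag ⟨a⟩ ⊂ ⟨a, b⟩ ⊂ ⟨a, b, c⟩, so the basis enters `∑P-Schubert` in
  -- reverse order.
  ∑P-cellwise : ∀ {a b c d} → ind a b c d ≡ 1 → ∀ H → Homogeneous H → ∀ {h₀ h₁ h₂ h₃} →
    H a ≡ h₀ → (∀ w → H (b ⊕ w ⊙ a) ≡ h₁) → (∀ v w → H (c ⊕ v ⊙ b ⊕ w ⊙ a) ≡ h₂) →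
    (∀ u v w → H (d ⊕ u ⊙ c ⊕ v ⊙ b ⊕ w ⊙ a) ≡ h₃) →
    ∑P H ≡ h₀ ℕ.+ q ℕ.* h₁ ℕ.+ q ℕ.* (q ℕ.* h₂) ℕ.+ q ℕ.* (q ℕ.* (q ℕ.* h₃))
  ∑P-cellwise basis H hom e₀ e₁ e₂ e₃ = trans (∑P-Schubert (trans (ind-reverse _ _ _ _) basis) H hom)
    (cong₂ ℕ._+_ (cong₂ ℕ._+_ (cong₂ ℕ._+_ e₀ (∑F-values e₁)) (∑F-values λ v → ∑F-values λ w → e₂ v w))
                 (∑F-values λ u → ∑F-values λ v → ∑F-values λ w → e₃ u v w))

  -- Counting projective bases

  extensions₃ : V → V → V → ℕ
  extensions₃ a b c = ∑P (ind a b c)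

  extensions₂ : V → V → ℕ
  extensions₂ a b = ∑P (extensions₃ a b)

  extensions₁ : V → ℕ
  extensions₁ a = ∑P (extensions₂ a)

  -- Left as sums over cells, in the form `∑P-cellwise` produces. Each stage counts the points
  -- outside the span so far: q³ off a plane, q² + q³ off a line, q + q² + q³ off a point.
  E₃ E₂ E₁ E₀ : ℕ
  E₃ = q ℕ.* (q ℕ.* (q ℕ.* 1))
  E₂ = q ℕ.* (q ℕ.* E₃) ℕ.+ q ℕ.* (q ℕ.* (q ℕ.* E₃))
  E₁ = q ℕ.* E₂ ℕ.+ q ℕ.* (q ℕ.* E₂) ℕ.+ q ℕ.* (q ℕ.* (q ℕ.* E₂))
  E₀ = E₁ ℕ.+ q ℕ.* E₁ ℕ.+ q ℕ.* (q ℕ.* E₁) ℕ.+ q ℕ.* (q ℕ.* (q ℕ.* E₁))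

  q*0 : q ℕ.* 0 ≡ 0
  q*0 = ℕ.*-zeroʳ q

  extensions₃-value : ∀ {a b c d} → ind a b c d ≡ 1 → extensions₃ a b c ≡ E₃
  extensions₃-value {a} {b} {c} {d} basis = trans
    (∑P-cellwise basis (ind a b c) (λ s v → scale₄ a b c v)
      (equal₁₄ a b c)
      (λ w → trans (add₄₁ a b c _ w) (equal₂₄ a b c))
      (λ v w → trans (add₄₁ a b c _ w) (trans (add₄₂ a b c _ v) (equal₃₄ a b c)))
      (λ u v w → trans (add₄₁ a b c _ w) (trans (add₄₂ a b c _ v) (trans (add₄₃ a b c d u) basis))))
    (cong₂ (λ x y → x ℕ.+ y ℕ.+ E₃) q*0 (trans (cong (q ℕ.*_) q*0) q*0))

  extensions₂-value : ∀ {a b c d} → ind a b c d ≡ 1 → extensions₂ a b ≡ E₂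
  extensions₂-value {a} {b} {c} {d} basis = trans
    (∑P-cellwise basis (extensions₃ a b) (λ s v s≢0 → ∑-cong points λ y → scale₃ a b v y s≢0)
      (∑-zero points λ y → equal₁₃ a b y)
      (λ w → ∑-zero points λ y → trans (add₃₁ a b _ y w) (equal₂₃ a b y))
      (λ v w → extensions₃-value (trans (add₃₁ a b _ d w) (trans (add₃₂ a b _ d v) basis)))
      (λ u v w → extensions₃-value (trans (add₃₁ a b _ c w) (trans (add₃₂ a b _ c v) (trans (add₃₄ a b d c u)
        (trans (swap₃₄ a b d c) basis))))))
    (cong (λ x → x ℕ.+ q ℕ.* (q ℕ.* E₃) ℕ.+ q ℕ.* (q ℕ.* (q ℕ.* E₃))) q*0)

  extensions₁-value : ∀ {a b c d} → ind a b c d ≡ 1 → extensions₁ a ≡ E₁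
  extensions₁-value {a} {b} {c} {d} basis =
    ∑P-cellwise basis (extensions₂ a) (λ s v s≢0 → ∑-cong points λ x → ∑-cong points λ y → scale₂ a v x y s≢0)
      (∑-zero points λ x → ∑-zero points λ y → equal₁₂ a x y)
      (λ w → extensions₂-value (trans (add₂₁ a _ c d w) basis))
      (λ v w → extensions₂-value (trans (add₂₁ a _ b d w) (trans (add₂₃ a _ b d v) (trans (swap₂₃ a c b d) basis))))
      (λ u v w → extensions₂-value (trans (add₂₁ a _ b c w) (trans (add₂₃ a _ b c v) (trans (add₂₄ a d b c u)
        (trans (swap₂₃ a d b c) (trans (swap₃₄ a b d c) basis))))))

  standard-basis : ind ⟨ 1# , 0# , 0# , 0# ⟩ ⟨ 0# , 1# , 0# , 0# ⟩ ⟨ 0# , 0# , 1# , 0# ⟩ ⟨ 0# , 0# , 0# , 1# ⟩ ≡ 1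
  standard-basis = ind≡1 λ { t@(⟨ t₁ , t₂ , t₃ , t₄ ⟩) e → trans (sym (comb-standard t)) e }
    where
    one : ∀ x → x * 1# ≡ x
    one = *-identityʳ
    nil : ∀ x y → x + y * 0# ≡ x
    nil x y = trans (cong (λ z → x + z) (zeroʳ y)) (+-identityʳ x)
    nilˡ : ∀ x y → x ≡ 0# → x + y * 1# ≡ y
    nilˡ x y x≡0 = trans (cong₂ _+_ x≡0 (one y)) (+-identityˡ y)
    comb-standard : ∀ t → comb t ⟨ 1# , 0# , 0# , 0# ⟩ ⟨ 0# , 1# , 0# , 0# ⟩ ⟨ 0# , 0# , 1# , 0# ⟩ ⟨ 0# , 0# , 0# , 1# ⟩ ≡ t
    comb-standard ⟨ t₁ , t₂ , t₃ , t₄ ⟩ = ⟨⟩-cong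
      (trans (nil _ t₄) (trans (nil _ t₃) (trans (nil _ t₂) (one t₁))))
      (trans (nil _ t₄) (trans (nil _ t₃) (nilˡ _ t₂ (zeroʳ t₁))))
      (trans (nil _ t₄) (nilˡ _ t₃ (trans (nil _ t₂) (zeroʳ t₁))))
      (nilˡ _ t₄ (trans (nil _ t₃) (trans (nil _ t₂) (zeroʳ t₁))))

  bases-count : (∑P λ a → ∑P λ b → ∑P λ c → ∑P λ d → ind a b c d) ≡ E₀
  bases-count =
    ∑P-cellwise standard-basis extensions₁
      (λ s v s≢0 → ∑-cong points λ x → ∑-cong points λ y → ∑-cong points λ z → scale₁ v x y z s≢0)
      (extensions₁-value standard-basis)
      (λ w → extensions₁-value {d = e₄} (trans (add₁₂ _ e₁ e₃ e₄ w) (trans (swap₁₂ e₂ e₁ e₃ e₄) standard-basis)))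
      (λ v w → extensions₁-value {d = e₄} (trans (add₁₂ _ e₁ e₂ e₄ w) (trans (add₁₃ _ e₁ e₂ e₄ v)
        (trans (swap₁₂ e₃ e₁ e₂ e₄) (trans (swap₂₃ e₁ e₃ e₂ e₄) standard-basis)))))
      (λ u v w → extensions₁-value {d = e₃} (trans (add₁₂ _ e₁ e₂ e₃ w) (trans (add₁₃ _ e₁ e₂ e₃ v) (trans (add₁₄ _ e₁ e₂ e₃ u)
        (trans (swap₁₂ e₄ e₁ e₂ e₃) (trans (swap₂₃ e₁ e₄ e₂ e₃) (trans (swap₃₄ e₁ e₂ e₄ e₃) standard-basis)))))))
    where
    e₁ e₂ e₃ e₄ : V
    e₁ = ⟨ 1# , 0# , 0# , 0# ⟩
    e₂ = ⟨ 0# , 1# , 0# , 0# ⟩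
    e₃ = ⟨ 0# , 0# , 1# , 0# ⟩
    e₄ = ⟨ 0# , 0# , 0# , 1# ⟩

  -- Closing up a walk of points

  Frame : Set
  Frame = Fin 4 → V

  Basis : Frame → Set
  Basis b = ind (b 0F) (b 1F) (b 2F) (b 3F) ≡ 1

  -- The number of ways to continue …, a₃, a₂, a₁ (a₁ most recent) by m points and then
  -- b₀, b₁, b₂ such that all quadruples of consecutive points are independent.
  G : ℕ → V → V → V → Frame → ℕ
  G zero    a₁ a₂ a₃ b = ind a₃ a₂ a₁ (b 0F) ℕ.* (ind a₂ a₁ (b 0F) (b 1F) ℕ.* ind a₁ (b 0F) (b 1F) (b 2F))
  G (suc m) a₁ a₂ a₃ b = ∑P λ x → ind a₃ a₂ a₁ x ℕ.* G m x a₁ a₂ b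

  -- Together the three say that `G` sees a₁, a₂, a₃ only through the flag ⟨a₁⟩ ⊂ ⟨a₁, a₂⟩ ⊂ ⟨a₁,
  -- a₂, a₃⟩. They are mutual because each new point turns a₁ into the second vector and a₂ into the
  -- third, while a₃ drops out.
  G-scale₁ : ∀ m a₁ a₂ a₃ b {s} → s ≢ 0# → G m (s ⊙ a₁) a₂ a₃ b ≡ G m a₁ a₂ a₃ b
  G-add₂   : ∀ m a₁ a₂ a₃ b {s} r → s ≢ 0# → G m a₁ (s ⊙ a₂ ⊕ r ⊙ a₁) a₃ b ≡ G m a₁ a₂ a₃ b
  G-add₃   : ∀ m a₁ a₂ a₃ b {s} r₁ r₂ → s ≢ 0# → G m a₁ a₂ (s ⊙ a₃ ⊕ r₂ ⊙ a₂ ⊕ r₁ ⊙ a₁) b ≡ G m a₁ a₂ a₃ b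

  G-scale₁ zero a₁ a₂ a₃ b s≢0 = cong₂ ℕ._*_ (scale₃ a₃ a₂ a₁ _ s≢0)
    (cong₂ ℕ._*_ (scale₂ a₂ a₁ _ _ s≢0) (scale₁ a₁ _ _ _ s≢0))
  G-scale₁ (suc m) a₁ a₂ a₃ b {s} s≢0 = ∑-cong points λ x → cong₂ ℕ._*_ (scale₃ a₃ a₂ a₁ x s≢0)
    (trans (cong (λ v → G m x v a₂ b) (sym (⊕-0⊙ (s ⊙ a₁) x))) (G-add₂ m x a₁ a₂ b 0# s≢0))

  G-add₂ zero a₁ a₂ a₃ b r s≢0 = cong₂ ℕ._*_ (trans (add₂₃ a₃ _ a₁ _ r) (scale₂ a₃ a₂ a₁ _ s≢0))
    (cong (ℕ._* _) (trans (add₁₂ _ a₁ _ _ r) (scale₁ a₂ a₁ _ _ s≢0)))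
  G-add₂ (suc m) a₁ a₂ a₃ b {s} r s≢0 = ∑-cong points λ x → cong₂ ℕ._*_
    (trans (add₂₃ a₃ _ a₁ x r) (scale₂ a₃ a₂ a₁ x s≢0))
    (trans (cong (λ v → G m x a₁ v b) (sym (⊕-0⊙ (s ⊙ a₂ ⊕ r ⊙ a₁) x))) (G-add₃ m x a₁ a₂ b 0# r s≢0))

  G-add₃ zero a₁ a₂ a₃ b r₁ r₂ s≢0 = cong (ℕ._* _)
    (trans (add₁₃ _ a₂ a₁ _ r₁) (trans (add₁₂ _ a₂ a₁ _ r₂) (scale₁ a₃ a₂ a₁ _ s≢0)))
  G-add₃ (suc m) a₁ a₂ a₃ b r₁ r₂ s≢0 = ∑-cong points λ x → cong (ℕ._* _)
    (trans (add₁₃ _ a₂ a₁ _ r₁) (trans (add₁₂ _ a₂ a₁ _ r₂) (scale₁ a₃ a₂ a₁ _ s≢0)))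

  infixl 10 _[_≔_]
  _[_≔_] : Frame → Fin 4 → V → Frame
  b [ j ≔ v ] = updateAt b j (const v)

  Basis-update : ∀ b i j {s} r → toℕ i ℕ.< toℕ j → s ≢ 0# → Basis b → Basis (b [ j ≔ s ⊙ b j ⊕ r ⊙ b i ])
  Basis-update b zero (suc zero) r _ s≢0 basis = trans (add₂₁ _ _ _ _ r) (trans (scale₂ _ _ _ _ s≢0) basis)
  Basis-update b zero (suc (suc zero)) r _ s≢0 basis = trans (add₃₁ _ _ _ _ r) (trans (scale₃ _ _ _ _ s≢0) basis)
  Basis-update b zero (suc (suc (suc zero))) r _ s≢0 basis = trans (add₄₁ _ _ _ _ r) (trans (scale₄ _ _ _ _ s≢0) basis)
  Basis-update b (suc zero) (suc (suc zero)) r _ s≢0 basis = trans (add₃₂ _ _ _ _ r) (trans (scale₃ _ _ _ _ s≢0) basis)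
  Basis-update b (suc zero) (suc (suc (suc zero))) r _ s≢0 basis = trans (add₄₂ _ _ _ _ r) (trans (scale₄ _ _ _ _ s≢0) basis)
  Basis-update b (suc (suc zero)) (suc (suc (suc zero))) r _ s≢0 basis = trans (add₄₃ _ _ _ _ r) (trans (scale₄ _ _ _ _ s≢0) basis)
  Basis-update b (suc zero) (suc zero) r (s≤s ())
  Basis-update b (suc (suc zero)) (suc zero) r (s≤s ())
  Basis-update b (suc (suc (suc zero))) (suc zero) r (s≤s ())
  Basis-update b (suc (suc zero)) (suc (suc zero)) r (s≤s (s≤s ()))
  Basis-update b (suc (suc (suc zero))) (suc (suc zero)) r (s≤s (s≤s ()))
  Basis-update b (suc (suc (suc zero))) (suc (suc (suc zero))) r (s≤s (s≤s (s≤s ())))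

  -- The target frame likewise matters only through its flag, whence the restriction to adding
  -- earlier vectors to later ones. The last frame vector does not occur in `G` at all.
  G-update : ∀ m a₁ a₂ a₃ b i j {s} r → toℕ i ℕ.< toℕ j → s ≢ 0# →
             G m a₁ a₂ a₃ (b [ j ≔ s ⊙ b j ⊕ r ⊙ b i ]) ≡ G m a₁ a₂ a₃ b
  G-update (suc m) a₁ a₂ a₃ b i j r i<j s≢0 = ∑-cong points λ x → cong (ind a₃ a₂ a₁ x ℕ.*_) (G-update m x a₁ a₂ b i j r i<j s≢0)
  G-update zero a₁ a₂ a₃ b zero (suc zero) r _ s≢0 = cong (ind a₃ a₂ a₁ (b 0F) ℕ.*_) (cong₂ ℕ._*_
    (trans (add₄₃ _ _ _ _ r) (scale₄ _ _ _ _ s≢0)) (trans (add₃₂ _ _ _ _ r) (scale₃ _ _ _ _ s≢0)))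
  G-update zero a₁ a₂ a₃ b zero (suc (suc zero)) r _ s≢0 = cong (ind a₃ a₂ a₁ (b 0F) ℕ.*_) (cong (ind a₂ a₁ (b 0F) (b 1F) ℕ.*_)
    (trans (add₄₂ _ _ _ _ r) (scale₄ _ _ _ _ s≢0)))
  G-update zero a₁ a₂ a₃ b (suc zero) (suc (suc zero)) r _ s≢0 = cong (ind a₃ a₂ a₁ (b 0F) ℕ.*_) (cong (ind a₂ a₁ (b 0F) (b 1F) ℕ.*_)
    (trans (add₄₃ _ _ _ _ r) (scale₄ _ _ _ _ s≢0)))
  G-update zero a₁ a₂ a₃ b i (suc (suc (suc zero))) r _ s≢0 = refl
  G-update zero a₁ a₂ a₃ b (suc zero) (suc zero) r (s≤s ())
  G-update zero a₁ a₂ a₃ b (suc (suc zero)) (suc zero) r (s≤s ())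
  G-update zero a₁ a₂ a₃ b (suc (suc (suc zero))) (suc zero) r (s≤s ())
  G-update zero a₁ a₂ a₃ b (suc (suc zero)) (suc (suc zero)) r (s≤s (s≤s ()))
  G-update zero a₁ a₂ a₃ b (suc (suc (suc zero))) (suc (suc zero)) r (s≤s (s≤s ()))

  ind-Perm : ∀ b {i j k l} → Perm i j k l → Basis b → ind (b i) (b j) (b k) (b l) ≡ 1
  ind-Perm b identity  basis = basis
  ind-Perm b (swap₁ π) basis = trans (swap₁₂ _ _ _ _) (ind-Perm b π basis)
  ind-Perm b (swap₂ π) basis = trans (swap₂₃ _ _ _ _) (ind-Perm b π basis)
  ind-Perm b (swap₃ π) basis = trans (swap₃₄ _ _ _ _) (ind-Perm b π basis)

  -- The window starting at a₁ forces i = 3, the one before it then j = 2, and the first one k = 1: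
  -- any other index repeats a vector inside a window. For 3, 2, 1 all three windows are
  -- rearrangements of the basis.
  G₀-value : ∀ b → Basis b → ∀ {i j k l} → + G 0 (b i) (b j) (b k) b ≡ δ i j k l
  G₀-value b basis {zero} {j} {k} rewrite equal₁₂ (b 0F) (b 1F) (b 2F)
    | ℕ.*-zeroʳ (ind (b j) (b 0F) (b 0F) (b 1F)) | ℕ.*-zeroʳ (ind (b k) (b j) (b 0F) (b 0F)) = refl
  G₀-value b basis {suc zero} {j} {k} rewrite equal₁₃ (b 1F) (b 0F) (b 2F)
    | ℕ.*-zeroʳ (ind (b j) (b 1F) (b 0F) (b 1F)) | ℕ.*-zeroʳ (ind (b k) (b j) (b 1F) (b 0F)) = refl
  G₀-value b basis {suc (suc zero)} {j} {k} rewrite equal₁₄ (b 2F) (b 0F) (b 1F)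
    | ℕ.*-zeroʳ (ind (b j) (b 2F) (b 0F) (b 1F)) | ℕ.*-zeroʳ (ind (b k) (b j) (b 2F) (b 0F)) = refl
  G₀-value b basis {suc (suc (suc zero))} {zero} {k} rewrite equal₁₃ (b 0F) (b 3F) (b 1F)
    | ℕ.*-zeroʳ (ind (b k) (b 0F) (b 3F) (b 0F)) = refl
  G₀-value b basis {suc (suc (suc zero))} {suc zero} {k} rewrite equal₁₄ (b 1F) (b 3F) (b 0F)
    | ℕ.*-zeroʳ (ind (b k) (b 1F) (b 3F) (b 0F)) = refl
  G₀-value b basis {suc (suc (suc zero))} {suc (suc (suc zero))} {k} rewrite equal₁₂ (b 3F) (b 0F) (b 1F)
    | ℕ.*-zeroʳ (ind (b k) (b 3F) (b 3F) (b 0F)) = refl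
  G₀-value b basis {suc (suc (suc zero))} {suc (suc zero)} {zero} rewrite equal₁₄ (b 0F) (b 2F) (b 3F) = refl
  G₀-value b basis {suc (suc (suc zero))} {suc (suc zero)} {suc (suc zero)} rewrite equal₁₂ (b 2F) (b 3F) (b 0F) = refl
  G₀-value b basis {suc (suc (suc zero))} {suc (suc zero)} {suc (suc (suc zero))} rewrite equal₁₃ (b 3F) (b 2F) (b 0F) = refl
  G₀-value b basis {suc (suc (suc zero))} {suc (suc zero)} {suc zero} rewrite
      ind-Perm b {1F} {2F} {3F} {0F} (swap₃ (swap₂ (swap₁ identity))) basis
    | ind-Perm b {2F} {3F} {0F} {1F} (swap₂ (swap₁ (swap₃ (swap₂ identity)))) basis
    | ind-Perm b {3F} {0F} {1F} {2F} (swap₁ (swap₂ (swap₃ identity))) basis = refl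

  -- Hecke generators from counting neighbouring flags

  <F⇒< : ∀ i j → i <F j ≡ true → toℕ i ℕ.< toℕ j
  <F⇒< i j e = ℕ.<ᵇ⇒< (toℕ i) (toℕ j) (subst T (sym e) _)

  ≮F⇒> : ∀ i j → i ≢ j → i <F j ≡ false → toℕ j ℕ.< toℕ i
  ≮F⇒> i j i≢j e = ℕ.≤∧≢⇒< (ℕ.≮⇒≥ λ i<j → subst T e (ℕ.<⇒<ᵇ i<j)) (i≢j ∘ sym ∘ Fin.toℕ-injective)

  -- A function Ψ of pairs of flags, given by their adapted bases, which is constant on
  -- relative positions: replacing one step of the first flag in all possible ways acts on
  -- the values of Ψ as a generator of the Hecke algebra.  In the sum, the frame can always
  -- be chosen adapted to both flags again.
  module HeckeStep
    (Ψ : V → V → V → V → Frame → ℕ)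
    (Ψ-add : ∀ x y c d b {s} r → s ≢ 0# → Ψ x (s ⊙ y ⊕ r ⊙ x) c d b ≡ Ψ x y c d b)
    (Ψ-update : ∀ x y c d b i j {s} r → toℕ i ℕ.< toℕ j → s ≢ 0# →
                Ψ x y c d (b [ j ≔ s ⊙ b j ⊕ r ⊙ b i ]) ≡ Ψ x y c d b)
    (g : Table ℤ)
    (Ψ-value : ∀ b → Basis b → ∀ {i j k l} → Perm i j k l → + Ψ (b i) (b j) (b k) (b l) b ≡ g i j k l)
    (b : Frame) (basis : Basis b) {i j k l : Fin 4} (π : Perm i j k l)
    where
    open Distinct (Perm⇒Distinct π)

    term : F → ℕ
    term t = Ψ (b j ⊕ t ⊙ b i) (b i) (b k) (b l) b

    Ψ-cong : ∀ {x x′ y y′ c c′ d d′} b → x ≡ x′ → y ≡ y′ → c ≡ c′ → d ≡ d′ → Ψ x y c d b ≡ Ψ x′ y′ c′ d′ b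
    Ψ-cong b refl refl refl refl = refl

    -- Since b i precedes b j, replacing b j by b j + t b i leaves the flag of the frame unchanged;
    -- in the new frame the moved flag has the transposed position.
    term-ascent : toℕ i ℕ.< toℕ j → ∀ t → + term t ≡ g j i k l
    term-ascent i<j t = begin
      + term t
        ≡⟨ cong +_ (Ψ-cong b (trans (cong (_⊕ t ⊙ b i) (sym (⊙-identity (b j)))) (sym (updateAt-updates j b)))
             (sym (updateAt-minimal i j b i≢j)) (sym (updateAt-minimal k j b (j≢k ∘ sym))) (sym (updateAt-minimal l j b (j≢l ∘ sym)))) ⟩
      + Ψ (b′ j) (b′ i) (b′ k) (b′ l) b
        ≡⟨ cong +_ (Ψ-update _ _ _ _ b i j t i<j 1≢0) ⟨
      + Ψ (b′ j) (b′ i) (b′ k) (b′ l) b′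
        ≡⟨ Ψ-value b′ (Basis-update b i j t i<j 1≢0 basis) (swap₁ π) ⟩
      g j i k l ∎
      where
      b′ : Frame
      b′ = b [ j ≔ 1# ⊙ b j ⊕ t ⊙ b i ]

    term-0 : + term 0# ≡ g j i k l
    term-0 = trans (cong +_ (Ψ-cong b (⊕-0⊙ (b j) (b i)) refl refl refl)) (Ψ-value b basis (swap₁ π))

    -- Now b i may be replaced by t b i + b j in the frame. Modulo this first vector, b i is a
    -- nonzero multiple of b j, so the moved flag keeps the old position.
    term-descent : toℕ j ℕ.< toℕ i → ∀ t → t ≢ 0# → + term t ≡ g i j k l
    term-descent j<i t t≢0 = begin
      + Ψ (b j ⊕ t ⊙ b i) (b i) (b k) (b l) b
        ≡⟨ cong +_ (Ψ-cong b refl bi≡ refl refl) ⟩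
      + Ψ (b j ⊕ t ⊙ b i) ((- t ⁻¹) ⊙ b j ⊕ t ⁻¹ ⊙ (b j ⊕ t ⊙ b i)) (b k) (b l) b
        ≡⟨ cong +_ (Ψ-add _ _ _ _ b (t ⁻¹) -t⁻¹≢0) ⟩
      + Ψ (b j ⊕ t ⊙ b i) (b j) (b k) (b l) b
        ≡⟨ cong +_ (Ψ-cong b
             (trans (⊕-comm (b j) _) (trans (cong (t ⊙ b i ⊕_) (sym (⊙-identity (b j)))) (sym (updateAt-updates i b))))
             (sym (updateAt-minimal j i b (i≢j ∘ sym))) (sym (updateAt-minimal k i b (i≢k ∘ sym))) (sym (updateAt-minimal l i b (i≢l ∘ sym)))) ⟩
      + Ψ (b′ i) (b′ j) (b′ k) (b′ l) b
        ≡⟨ cong +_ (Ψ-update _ _ _ _ b j i 1# j<i t≢0) ⟨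
      + Ψ (b′ i) (b′ j) (b′ k) (b′ l) b′
        ≡⟨ Ψ-value b′ (Basis-update b j i 1# j<i t≢0 basis) π ⟩
      g i j k l ∎
      where
      b′ : Frame
      b′ = b [ i ≔ t ⊙ b i ⊕ 1# ⊙ b j ]
      -t⁻¹≢0 : - t ⁻¹ ≢ 0#
      -t⁻¹≢0 e = ⁻¹-nonzero t t≢0 (begin
        t ⁻¹             ≡⟨ +-identityʳ _ ⟨
        t ⁻¹ + 0#        ≡⟨ cong (λ z → t ⁻¹ + z) e ⟨
        t ⁻¹ + - t ⁻¹    ≡⟨ -‿inverseʳ _ ⟩
        0#               ∎)
      bi≡ : b i ≡ (- t ⁻¹) ⊙ b j ⊕ t ⁻¹ ⊙ (b j ⊕ t ⊙ b i)
      bi≡ = sym (begin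
        (- t ⁻¹) ⊙ b j ⊕ t ⁻¹ ⊙ (b j ⊕ t ⊙ b i)           ≡⟨ cong ((- t ⁻¹) ⊙ b j ⊕_) (⊙-distribˡ _ _ _) ⟩
        (- t ⁻¹) ⊙ b j ⊕ (t ⁻¹ ⊙ b j ⊕ t ⁻¹ ⊙ t ⊙ b i)    ≡⟨ ⊕-assoc _ _ _ ⟨
        (- t ⁻¹) ⊙ b j ⊕ t ⁻¹ ⊙ b j ⊕ t ⁻¹ ⊙ t ⊙ b i      ≡⟨ cong₂ _⊕_ (sym (⊙-distribʳ (b j) _ _)) (⊙-assoc _ _ _) ⟩
        (- t ⁻¹ + t ⁻¹) ⊙ b j ⊕ (t ⁻¹ * t) ⊙ b i          ≡⟨ cong₂ (λ x y → x ⊙ b j ⊕ y ⊙ b i) (-‿inverseˡ _) (inverseˡ t t≢0) ⟩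
        0# ⊙ b j ⊕ 1# ⊙ b i                               ≡⟨ cong₂ _⊕_ (⊙-zeroˡ _) (⊙-identity _) ⟩
        0V ⊕ b i                                          ≡⟨ ⊕-identityˡ _ ⟩
        b i                                               ∎)

    hecke-step : + ∑F term ≡ mix (+ q) (i <F j) (g j i k l) (g i j k l)
    hecke-step with i <F j in i<?j
    ... | true = begin
      + ∑F term               ≡⟨ cong +_ (∑F-values λ t → ℤ.+-injective (trans (term-ascent i<j t) (sym term-0))) ⟩
      + (q ℕ.* term 0#)       ≡⟨ ℤ.pos-* q (term 0#) ⟩
      + q ℤ.* + term 0#       ≡⟨ cong (+ q ℤ.*_) term-0 ⟩
      + q ℤ.* g j i k l       ∎
      where i<j = <F⇒< i j i<?j
    ... | false = trans
        (except-value {q = q} (trans (∑-split (Fin-enumeration q) 0# term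
             λ t t≢0 → ℤ.+-injective (trans (term-descent j<i t t≢0) (sym value)))
           (cong (λ n → term 0# ℕ.+ n ℕ.* v) (length-tabulate {n = q} id))))
        (cong₂ (λ x y → (x ℤ.- y) ℤ.+ + q ℤ.* y) term-0 value)
      where
      j<i = ≮F⇒> i j i≢j i<?j
      v = Ψ (b i) (b j) (b k) (b l) b
      value : + v ≡ g i j k l
      value = Ψ-value b basis π

  -- On the smaller Schubert cells of the flag of a₁, a₂, a₃ the next point depends on these three
  -- and the weight is 0; on the open cell it is 1. The cell coordinates u, v, w supply the three
  -- Hecke steps.
  G-step : ∀ m {a₁ a₂ a₃ a₄} b → ind a₁ a₂ a₃ a₄ ≡ 1 →
    G (suc m) a₁ a₂ a₃ b ≡ ∑F λ u → ∑F λ v → ∑F λ w → G m (a₄ ⊕ u ⊙ a₃ ⊕ v ⊙ a₂ ⊕ w ⊙ a₁) a₁ a₂ b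
  G-step m {a₁} {a₂} {a₃} {a₄} b basis = trans
    (∑P-Schubert (trans (ind-reverse a₁ a₂ a₃ a₄) basis) _
      (λ s v s≢0 → cong₂ ℕ._*_ (scale₄ a₃ a₂ a₁ v s≢0) (G-scale₁ m v a₁ a₂ b s≢0)))
    (cong₂ ℕ._+_ (cong₂ ℕ._+_ (cong₂ ℕ._+_
      (weighted a₁ (equal₃₄ a₃ a₂ a₁))
      (∑-zero (allFin q) λ w → weighted (a₂ ⊕ w ⊙ a₁) (trans (add₄₃ a₃ a₂ a₁ _ w) (equal₂₄ a₃ a₂ a₁))))
      (∑-zero (allFin q) λ v → ∑-zero (allFin q) λ w → weighted (a₃ ⊕ v ⊙ a₂ ⊕ w ⊙ a₁)
        (trans (add₄₃ a₃ a₂ a₁ _ w) (trans (add₄₂ a₃ a₂ a₁ _ v) (equal₁₄ a₃ a₂ a₁)))))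
      (∑-cong (allFin q) λ u → ∑-cong (allFin q) λ v → ∑-cong (allFin q) λ w → trans
        (weighted (a₄ ⊕ u ⊙ a₃ ⊕ v ⊙ a₂ ⊕ w ⊙ a₁)
          (trans (add₄₃ a₃ a₂ a₁ _ w) (trans (add₄₂ a₃ a₂ a₁ _ v) (trans (add₄₁ a₃ a₂ a₁ _ u) basis′))))
        (ℕ.*-identityˡ _)))
    where
    weighted : ∀ x {n} → ind a₃ a₂ a₁ x ≡ n → ind a₃ a₂ a₁ x ℕ.* G m x a₁ a₂ b ≡ n ℕ.* G m x a₁ a₂ b
    weighted x = cong (ℕ._* G m x a₁ a₂ b)
    basis′ : ind a₃ a₂ a₁ a₄ ≡ 1
    basis′ = begin
      ind a₃ a₂ a₁ a₄  ≡⟨ swap₃₄ a₃ a₂ a₁ a₄ ⟩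
      ind a₃ a₂ a₄ a₁  ≡⟨ swap₂₃ a₃ a₂ a₄ a₁ ⟩
      ind a₃ a₄ a₂ a₁  ≡⟨ swap₁₂ a₃ a₄ a₂ a₁ ⟩
      ind a₄ a₃ a₂ a₁  ≡⟨ ind-reverse a₁ a₂ a₃ a₄ ⟩
      ind a₁ a₂ a₃ a₄  ≡⟨ basis ⟩
      1                ∎

  -- Summing over one cell coordinate replaces one member of the flag: u the three-dimensional one,
  -- then v the two-dimensional one, then w the line. The outermost sum is over u, so `T₃` is
  -- applied last.
  G-value : ∀ m b → Basis b → ∀ {i j k l} → Perm i j k l →
            + G m (b i) (b j) (b k) b ≡ M^ (+ q) m δ i j k l
  G-value zero    b basis {i} {j} {k} {l} π = G₀-value b basis {i} {j} {k} {l}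
  G-value (suc m) b basis π = trans (cong +_ (G-step m b (ind-Perm b π basis))) (φ₃-value b basis π)
    where
    g = M^ (+ q) m δ

    φ₁ φ₂ : V → V → V → Frame → ℕ
    φ₁ a₁ a₂ a₃ b = ∑F λ w → G m (a₂ ⊕ w ⊙ a₁) a₁ a₃ b
    φ₂ a₁ a₂ a₃ b = ∑F λ v → φ₁ a₁ (a₃ ⊕ v ⊙ a₂) a₂ b

    -- The vector x is (x + w c) - w c, a combination of the first two arguments of `G`, so `G-add₃`
    -- absorbs r x for every w.
    φ₁-add : ∀ c x y b {s} r → s ≢ 0# → φ₁ c x (s ⊙ y ⊕ r ⊙ x) b ≡ φ₁ c x y b
    φ₁-add c x y b {s} r s≢0 = ∑-cong (allFin q) λ w → trans
      (cong (λ z → G m (x ⊕ w ⊙ c) c z b) (rearrange w)) (G-add₃ m (x ⊕ w ⊙ c) c y b r (- (r * w)) s≢0)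
      where
      rearrange : ∀ w → s ⊙ y ⊕ r ⊙ x ≡ s ⊙ y ⊕ (- (r * w)) ⊙ c ⊕ r ⊙ (x ⊕ w ⊙ c)
      rearrange w = sym (begin
        s ⊙ y ⊕ (- (r * w)) ⊙ c ⊕ r ⊙ (x ⊕ w ⊙ c)                ≡⟨ ⊕-assoc _ _ _ ⟩
        s ⊙ y ⊕ ((- (r * w)) ⊙ c ⊕ r ⊙ (x ⊕ w ⊙ c))              ≡⟨ cong (s ⊙ y ⊕_) (begin
          (- (r * w)) ⊙ c ⊕ r ⊙ (x ⊕ w ⊙ c)                      ≡⟨ ⊕-comm _ _ ⟩
          r ⊙ (x ⊕ w ⊙ c) ⊕ (- (r * w)) ⊙ c                      ≡⟨ cong (_⊕ (- (r * w)) ⊙ c) (⊙-distribˡ r x _) ⟩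
          r ⊙ x ⊕ r ⊙ w ⊙ c ⊕ (- (r * w)) ⊙ c                    ≡⟨ cong (λ z → r ⊙ x ⊕ z ⊕ (- (r * w)) ⊙ c) (⊙-assoc r w c) ⟩
          r ⊙ x ⊕ (r * w) ⊙ c ⊕ (- (r * w)) ⊙ c                  ≡⟨ ⊕-assoc _ _ _ ⟩
          r ⊙ x ⊕ ((r * w) ⊙ c ⊕ (- (r * w)) ⊙ c)                ≡⟨ cong (r ⊙ x ⊕_) (⊙-distribʳ c _ _) ⟨
          r ⊙ x ⊕ (r * w + - (r * w)) ⊙ c                        ≡⟨ cong (λ z → r ⊙ x ⊕ z ⊙ c) (-‿inverseʳ (r * w)) ⟩
          r ⊙ x ⊕ 0# ⊙ c                                         ≡⟨ ⊕-0⊙ _ c ⟩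
          r ⊙ x                                                  ∎) ⟩
        s ⊙ y ⊕ r ⊙ x                                            ∎)

    φ₁-update : ∀ x y z b i j {s} r → toℕ i ℕ.< toℕ j → s ≢ 0# →
                φ₁ x y z (b [ j ≔ s ⊙ b j ⊕ r ⊙ b i ]) ≡ φ₁ x y z b
    φ₁-update x y z b i j r i<j s≢0 = ∑-cong (allFin q) λ w → G-update m _ _ _ b i j r i<j s≢0

    φ₁-value : ∀ b → Basis b → ∀ {i j k l} → Perm i j k l →
               + φ₁ (b i) (b j) (b k) b ≡ T₁ (+ q) g i j k l
    φ₁-value = HeckeStep.hecke-step (λ x y c d b → G m x y c b)
      (λ x y c d b → G-add₂ m x y c b) (λ x y c d → G-update m x y c) g (λ b basis π → G-value m b basis π)

    φ₂-value : ∀ b → Basis b → ∀ {i j k l} → Perm i j k l →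
               + φ₂ (b i) (b j) (b k) b ≡ T₂ (+ q) (T₁ (+ q) g) i j k l
    -- `HeckeStep` exchanges its first two indices, so table and permutation are read in the order
    -- j, k, i, l; for `φ₃` the order is k, l, i, j.
    φ₂-value b basis π = HeckeStep.hecke-step (λ x y c d b → φ₁ c x y b)
      (λ x y c d b → φ₁-add c x y b) (λ x y c d → φ₁-update c x y) (λ i j k l → T₁ (+ q) g k i j l)
      (λ b basis π → φ₁-value b basis (swap₁ (swap₂ π))) b basis (swap₂ (swap₁ π))

    φ₃-value : ∀ b → Basis b → ∀ {i j k l} → Perm i j k l →
               + (∑F λ u → φ₂ (b i) (b j) (b l ⊕ u ⊙ b k) b) ≡ T₃ (+ q) (T₂ (+ q) (T₁ (+ q) g)) i j k l
    φ₃-value b basis π = HeckeStep.hecke-step (λ x y c d b → φ₂ c d x b)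
      (λ x y c d b r s≢0 → refl) (λ x y c d b i j r i<j s≢0 → ∑-cong (allFin q) λ v → φ₁-update _ _ _ b i j r i<j s≢0)
      (λ i j k l → T₂ (+ q) (T₁ (+ q) g) k l i j)
      (λ b basis π → φ₂-value b basis (swap₂ (swap₁ (swap₃ (swap₂ π))))) b basis (swap₂ (swap₁ (swap₃ (swap₂ π))))

  frame : V → V → V → V → Frame
  frame a b c d zero = a
  frame a b c d (suc zero) = b
  frame a b c d (suc (suc zero)) = c
  frame a b c d (suc (suc (suc zero))) = d

  -- The first four points play two roles: d, c, b give the starting flag, and a, b, c are the
  -- points to return to, with d completing the frame. Hence `m` is the number of further points and
  -- the walk has length m + 4.
  closedWalks : ℕ → ℕ
  closedWalks m = ∑P λ a → ∑P λ b → ∑P λ c → ∑P λ d → ind a b c d ℕ.* G m d c b (frame a b c d)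

  -- Read against the frame a, b, c, d, the starting flag always has position 3, 2, 1, 0. The number
  -- of completions is therefore the same for every basis and may be taken at the standard one.
  closedWalks-value : ∀ m → + closedWalks m ≡ + E₀ ℤ.* M^ (+ q) m δ 3F 2F 1F 0F
  closedWalks-value m = begin
    + closedWalks m
      ≡⟨ cong +_ (∑-cong points λ a → trans (∑-cong points λ b → trans (∑-cong points λ c → trans (∑-cong points λ d → constant a b c d)
          (∑-*ˡ points C _)) (∑-*ˡ points C _)) (∑-*ˡ points C _)) ⟩
    + (∑P λ a → C ℕ.* ∑P λ b → ∑P λ c → ∑P λ d → ind a b c d)
      ≡⟨ cong +_ (∑-*ˡ points C _) ⟩
    + (C ℕ.* ∑P λ a → ∑P λ b → ∑P λ c → ∑P λ d → ind a b c d)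
      ≡⟨ cong (λ n → + (C ℕ.* n)) bases-count ⟩
    + (C ℕ.* E₀)
      ≡⟨ cong +_ (ℕ.*-comm C E₀) ⟩
    + (E₀ ℕ.* C)
      ≡⟨ ℤ.pos-* E₀ C ⟩
    + E₀ ℤ.* + C
      ≡⟨ cong (+ E₀ ℤ.*_) (value e standard-basis) ⟩
    + E₀ ℤ.* M^ (+ q) m δ 3F 2F 1F 0F ∎
    where
    e : Frame
    e = frame ⟨ 1# , 0# , 0# , 0# ⟩ ⟨ 0# , 1# , 0# , 0# ⟩ ⟨ 0# , 0# , 1# , 0# ⟩ ⟨ 0# , 0# , 0# , 1# ⟩
    C : ℕ
    C = G m (e 3F) (e 2F) (e 1F) e
    value : ∀ b → Basis b → + G m (b 3F) (b 2F) (b 1F) b ≡ M^ (+ q) m δ 3F 2F 1F 0F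
    value b basis = G-value m b basis
      (swap₁ (swap₂ (swap₁ (swap₃ (swap₂ (swap₁ identity))))))
    constant : ∀ a b c d → ind a b c d ℕ.* G m d c b (frame a b c d) ≡ C ℕ.* ind a b c d
    constant a b c d with Ind? a b c d
    ... | no _  = sym (ℕ.*-zeroʳ C)
    ... | yes h = begin
      1 ℕ.* G m d c b (frame a b c d)  ≡⟨ ℕ.*-identityˡ _ ⟩
      G m d c b (frame a b c d)        ≡⟨ ℤ.+-injective (trans (value (frame a b c d) (ind≡1 h)) (sym (value e standard-basis))) ⟩
      C                                ≡⟨ ℕ.*-identityʳ C ⟨
      C ℕ.* 1                          ∎

  -- Closed walks as lists of cyclic tuples

  Windows : List V → Set
  Windows (a ∷ b ∷ c ∷ d ∷ vs) = Ind a b c d × Windows (b ∷ c ∷ d ∷ vs)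
  Windows _ = ⊤

  Windows? : ∀ vs → Dec (Windows vs)
  Windows? (a ∷ b ∷ c ∷ d ∷ vs) = Ind? a b c d ×-dec Windows? (b ∷ c ∷ d ∷ vs)
  Windows? [] = yes tt
  Windows? (_ ∷ []) = yes tt
  Windows? (_ ∷ _ ∷ []) = yes tt
  Windows? (_ ∷ _ ∷ _ ∷ []) = yes tt

  tuples : ∀ n → List (Vec V n)
  tuples zero    = [] ∷ []
  tuples (suc n) = cartesianProductWith _∷_ points (tuples n)

  G-windows : ∀ m a₁ a₂ a₃ b →
    G m a₁ a₂ a₃ b ≡ ∑ (tuples m) λ xs → ⟦ Windows? (a₃ ∷ a₂ ∷ a₁ ∷ (toList xs ++ b 0F ∷ b 1F ∷ b 2F ∷ [])) ⟧
  G-windows zero a₁ a₂ a₃ b = sym (begin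
    ⟦ A? ×-dec (B? ×-dec (C? ×-dec yes tt)) ⟧ ℕ.+ 0   ≡⟨ ℕ.+-identityʳ _ ⟩
    ⟦ A? ×-dec (B? ×-dec (C? ×-dec yes tt)) ⟧         ≡⟨ ⟦⟧-× A? (B? ×-dec (C? ×-dec yes tt)) ⟩
    ⟦ A? ⟧ ℕ.* ⟦ B? ×-dec (C? ×-dec yes tt) ⟧         ≡⟨ cong (⟦ A? ⟧ ℕ.*_) (⟦⟧-× B? (C? ×-dec yes tt)) ⟩
    ⟦ A? ⟧ ℕ.* (⟦ B? ⟧ ℕ.* ⟦ C? ×-dec yes tt ⟧)       ≡⟨ cong (λ n → ⟦ A? ⟧ ℕ.* (⟦ B? ⟧ ℕ.* n)) (trans (⟦⟧-× C? (yes tt)) (ℕ.*-identityʳ _)) ⟩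
    ⟦ A? ⟧ ℕ.* (⟦ B? ⟧ ℕ.* ⟦ C? ⟧)                    ∎)
    where
    A? = Ind? a₃ a₂ a₁ (b 0F)
    B? = Ind? a₂ a₁ (b 0F) (b 1F)
    C? = Ind? a₁ (b 0F) (b 1F) (b 2F)
  G-windows (suc m) a₁ a₂ a₃ b = begin
    (∑P λ x → ind a₃ a₂ a₁ x ℕ.* G m x a₁ a₂ b)
      ≡⟨ ∑-cong points (λ x → cong (ind a₃ a₂ a₁ x ℕ.*_) (G-windows m x a₁ a₂ b)) ⟩
    (∑P λ x → ind a₃ a₂ a₁ x ℕ.* ∑ (tuples m) λ xs → ⟦ Windows? (a₂ ∷ a₁ ∷ x ∷ (toList xs ++ end)) ⟧)
      ≡⟨ ∑-cong points (λ x → sym (∑-*ˡ (tuples m) (ind a₃ a₂ a₁ x) _)) ⟩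
    (∑P λ x → ∑ (tuples m) λ xs → ind a₃ a₂ a₁ x ℕ.* ⟦ Windows? (a₂ ∷ a₁ ∷ x ∷ (toList xs ++ end)) ⟧)
      ≡⟨ ∑-cong points (λ x → ∑-cong (tuples m) λ xs → sym (⟦⟧-× (Ind? a₃ a₂ a₁ x) (Windows? (a₂ ∷ a₁ ∷ x ∷ (toList xs ++ end))))) ⟩
    (∑P λ x → ∑ (tuples m) λ xs → ⟦ Windows? (a₃ ∷ a₂ ∷ a₁ ∷ x ∷ (toList xs ++ end)) ⟧)
      ≡⟨ ∑-product _∷_ points (tuples m) _ ⟨
    ∑ (tuples (suc m)) (λ xs → ⟦ Windows? (a₃ ∷ a₂ ∷ a₁ ∷ (toList xs ++ end)) ⟧) ∎
    where
    end : List V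
    end = b 0F ∷ b 1F ∷ b 2F ∷ []

  -- With the first three points repeated at the end, the n cyclic windows are the n ordinary
  -- windows of a list of length n + 3.
  closure : ∀ {m} → Vec V (4 ℕ.+ m) → List V
  closure v@(a ∷ b ∷ c ∷ _) = toList v ++ a ∷ b ∷ c ∷ []

  Cyclic : ∀ {m} → Vec V (4 ℕ.+ m) → Set
  Cyclic v = Windows (closure v)

  Cyclic? : ∀ {m} (v : Vec V (4 ℕ.+ m)) → Dec (Cyclic v)
  Cyclic? v = Windows? (closure v)

  cyclicTuples : ∀ m → List (Vec V (4 ℕ.+ m))
  cyclicTuples m = filter Cyclic? (tuples (4 ℕ.+ m))

  cyclicTuples-length : ∀ m → length (cyclicTuples m) ≡ closedWalks m
  cyclicTuples-length m = begin
    length (cyclicTuples m)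
      ≡⟨ length-∑ (cyclicTuples m) ⟩
    ∑ (cyclicTuples m) (λ _ → 1)
      ≡⟨ ∑-filter Cyclic? (tuples (4 ℕ.+ m)) (λ _ → 1) ⟩
    ∑ (tuples (4 ℕ.+ m)) (λ v → ⟦ Cyclic? v ⟧ ℕ.* 1)
      ≡⟨ ∑-cong (tuples (4 ℕ.+ m)) (λ v → ℕ.*-identityʳ _) ⟩
    ∑ (tuples (4 ℕ.+ m)) (λ v → ⟦ Cyclic? v ⟧)
      ≡⟨ (trans (∑-product _∷_ points (tuples (3 ℕ.+ m)) _) (∑-cong points λ a →
          trans (∑-product _∷_ points (tuples (2 ℕ.+ m)) _) (∑-cong points λ b →
          trans (∑-product _∷_ points (tuples (1 ℕ.+ m)) _) (∑-cong points λ c →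
          ∑-product _∷_ points (tuples m) _)))) ⟩
    (∑P λ a → ∑P λ b → ∑P λ c → ∑P λ d → ∑ (tuples m) λ xs → ⟦ Cyclic? (a ∷ b ∷ c ∷ d ∷ xs) ⟧)
      ≡⟨ (∑-cong points λ a → ∑-cong points λ b → ∑-cong points λ c → ∑-cong points λ d → sym (begin
          ind a b c d ℕ.* G m d c b (frame a b c d)
            ≡⟨ cong (ind a b c d ℕ.*_) (G-windows m d c b (frame a b c d)) ⟩
          ind a b c d ℕ.* (∑ (tuples m) λ xs → ⟦ Windows? (b ∷ c ∷ d ∷ (toList xs ++ a ∷ b ∷ c ∷ [])) ⟧)
            ≡⟨ ∑-*ˡ (tuples m) (ind a b c d) _ ⟨
          (∑ (tuples m) λ xs → ind a b c d ℕ.* ⟦ Windows? (b ∷ c ∷ d ∷ (toList xs ++ a ∷ b ∷ c ∷ [])) ⟧)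
            ≡⟨ ∑-cong (tuples m) (λ xs → sym (⟦⟧-× (Ind? a b c d) (Windows? (b ∷ c ∷ d ∷ (toList xs ++ a ∷ b ∷ c ∷ []))))) ⟩
          (∑ (tuples m) λ xs → ⟦ Cyclic? (a ∷ b ∷ c ∷ d ∷ xs) ⟧) ∎)) ⟩
    closedWalks m ∎

  -- Out of range, nth returns the zero vector.
  nth : List V → ℕ → V
  nth []       _       = 0V
  nth (v ∷ vs) zero    = v
  nth (v ∷ vs) (suc k) = nth vs k

  -- The summand 0 is kept so that `CyclicAt` agrees with `shift` by computation.
  WindowAt : (ℕ → V) → ℕ → Set
  WindowAt u i = Ind (u (i ℕ.+ 0)) (u (i ℕ.+ 1)) (u (i ℕ.+ 2)) (u (i ℕ.+ 3))

  Windows⇒ : ∀ vs → Windows vs → ∀ i → i ℕ.+ 3 ℕ.< length vs → WindowAt (nth vs) i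
  Windows⇒ (a ∷ b ∷ c ∷ d ∷ vs) (h , _) zero _ = h
  Windows⇒ (a ∷ b ∷ c ∷ d ∷ vs) (_ , hs) (suc i) (s≤s i<) = Windows⇒ (b ∷ c ∷ d ∷ vs) hs i i<
  Windows⇒ (a ∷ []) _ zero (s≤s ())
  Windows⇒ (a ∷ []) _ (suc i) (s≤s ())
  Windows⇒ (a ∷ b ∷ []) _ zero (s≤s (s≤s ()))
  Windows⇒ (a ∷ b ∷ []) _ (suc zero) (s≤s (s≤s ()))
  Windows⇒ (a ∷ b ∷ []) _ (suc (suc i)) (s≤s (s≤s ()))
  Windows⇒ (a ∷ b ∷ c ∷ []) _ i i< = ⊥-elim (ℕ.<⇒≱ i< (ℕ.m≤n+m 3 i))

  ⇒Windows : ∀ vs → (∀ i → i ℕ.+ 3 ℕ.< length vs → WindowAt (nth vs) i) → Windows vs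
  ⇒Windows (a ∷ b ∷ c ∷ d ∷ vs) h = h 0 (s≤s (s≤s (s≤s (s≤s z≤n)))) , ⇒Windows (b ∷ c ∷ d ∷ vs) (λ i i< → h (suc i) (s≤s i<))
  ⇒Windows [] _ = tt
  ⇒Windows (_ ∷ []) _ = tt
  ⇒Windows (_ ∷ _ ∷ []) _ = tt
  ⇒Windows (_ ∷ _ ∷ _ ∷ []) _ = tt

  nth-++ˡ : ∀ vs ws {k} → k ℕ.< length vs → nth (vs ++ ws) k ≡ nth vs k
  nth-++ˡ (v ∷ vs) ws {zero}  _        = refl
  nth-++ˡ (v ∷ vs) ws {suc k} (s≤s k<) = nth-++ˡ vs ws k<

  nth-++ʳ : ∀ vs ws k → nth (vs ++ ws) (k ℕ.+ length vs) ≡ nth ws k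
  nth-++ʳ []       ws k = cong (nth ws) (ℕ.+-identityʳ k)
  nth-++ʳ (v ∷ vs) ws k = trans (cong (nth (v ∷ vs ++ ws)) (ℕ.+-suc k (length vs))) (nth-++ʳ vs ws k)

  nth-toList : ∀ {n} (v : Vec V n) i → nth (toList v) (toℕ i) ≡ Vec.lookup v i
  nth-toList (x ∷ v) zero    = refl
  nth-toList (x ∷ v) (suc i) = nth-toList v i

  nth-mod : ∀ {n} (v : Vec V n) .{{_ : NonZero n}} k → nth (toList v) (k % n) ≡ Vec.lookup v (k mod n)
  nth-mod {n} v k = trans (cong (nth (toList v)) (sym (Fin.toℕ-fromℕ< (m%n<n k n)))) (nth-toList v (k mod n))

  nth-closure : ∀ {m} (v : Vec V (4 ℕ.+ m)) k → k ℕ.< 4 ℕ.+ m ℕ.+ 3 → nth (closure v) k ≡ Vec.lookup v (k mod (4 ℕ.+ m))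
  nth-closure {m} v@(a ∷ b ∷ c ∷ vs) k k< with k ℕ.<? 4 ℕ.+ m
  ... | yes k<n = begin
    nth (closure v) k                ≡⟨ nth-++ˡ (toList v) _ (subst (k ℕ.<_) (sym (length-toList v)) k<n) ⟩
    nth (toList v) k                 ≡⟨ cong (nth (toList v)) (m<n⇒m%n≡m k<n) ⟨
    nth (toList v) (k % (4 ℕ.+ m))   ≡⟨ nth-mod v k ⟩
    Vec.lookup v (k mod (4 ℕ.+ m))   ∎
  ... | no k≮n = begin
    nth (closure v) k                              ≡⟨ cong (nth (closure v)) k≡ ⟩
    nth (closure v) (r ℕ.+ (4 ℕ.+ m))              ≡⟨ cong (λ l → nth (closure v) (r ℕ.+ l)) (length-toList v) ⟨
    nth (closure v) (r ℕ.+ length (toList v))      ≡⟨ nth-++ʳ (toList v) _ r ⟩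
    nth (a ∷ b ∷ c ∷ []) r                         ≡⟨ first-three r r<3 ⟩
    nth (toList v) r                               ≡⟨ cong (nth (toList v)) (m<n⇒m%n≡m (ℕ.≤-trans r<3 (ℕ.m≤m+n 3 (suc m)))) ⟨
    nth (toList v) (r % (4 ℕ.+ m))                 ≡⟨ cong (nth (toList v)) ([m+n]%n≡m%n r (4 ℕ.+ m)) ⟨
    nth (toList v) ((r ℕ.+ (4 ℕ.+ m)) % (4 ℕ.+ m)) ≡⟨ cong (λ l → nth (toList v) (l % (4 ℕ.+ m))) k≡ ⟨
    nth (toList v) (k % (4 ℕ.+ m))                 ≡⟨ nth-mod v k ⟩
    Vec.lookup v (k mod (4 ℕ.+ m))                 ∎
    where
    r = k ℕ.∸ (4 ℕ.+ m)
    k≡ : k ≡ r ℕ.+ (4 ℕ.+ m)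
    k≡ = sym (ℕ.m∸n+n≡m (ℕ.≮⇒≥ k≮n))
    r<3 : r ℕ.< 3
    r<3 = ℕ.+-cancelʳ-< (4 ℕ.+ m) r 3 (subst₂ ℕ._<_ k≡ (ℕ.+-comm (4 ℕ.+ m) 3) k<)
    first-three : ∀ r → r ℕ.< 3 → nth (a ∷ b ∷ c ∷ []) r ≡ nth (a ∷ b ∷ c ∷ toList vs) r
    first-three 0 _ = refl
    first-three 1 _ = refl
    first-three 2 _ = refl
    first-three (suc (suc (suc _))) (s≤s (s≤s (s≤s ())))

  CyclicAt : ∀ {n} .{{_ : NonZero n}} → (Fin n → V) → Fin n → Set
  CyclicAt {n} u i = WindowAt (λ k → u (k mod n)) (toℕ i)

  length-closure : ∀ {m} (v : Vec V (4 ℕ.+ m)) → length (closure v) ≡ 4 ℕ.+ m ℕ.+ 3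
  length-closure v@(_ ∷ _ ∷ _ ∷ _) = trans (length-++ (toList v)) (cong (ℕ._+ 3) (length-toList v))

  closure-window : ∀ {m} (v : Vec V (4 ℕ.+ m)) i → i ℕ.< 4 ℕ.+ m →
    WindowAt (nth (closure v)) i ≡ WindowAt (λ k → Vec.lookup v (k mod (4 ℕ.+ m))) i
  closure-window {m} v i i< = Ind-cong (at 0 z≤n) (at 1 (s≤s z≤n)) (at 2 (s≤s (s≤s z≤n))) (at 3 ℕ.≤-refl)
    where
    at : ∀ j → j ℕ.≤ 3 → nth (closure v) (i ℕ.+ j) ≡ Vec.lookup v ((i ℕ.+ j) mod (4 ℕ.+ m))
    at j j≤3 = nth-closure v (i ℕ.+ j) (ℕ.+-mono-<-≤ i< j≤3)

  Cyclic⇒ : ∀ {m} (v : Vec V (4 ℕ.+ m)) → Cyclic v → ∀ i → CyclicAt (Vec.lookup v) i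
  Cyclic⇒ {m} v h i = subst id (closure-window v (toℕ i) (Fin.toℕ<n i))
    (Windows⇒ (closure v) h (toℕ i)
      (subst (toℕ i ℕ.+ 3 ℕ.<_) (sym (length-closure v)) (ℕ.+-monoˡ-< 3 (Fin.toℕ<n i))))

  ⇒Cyclic : ∀ {m} (v : Vec V (4 ℕ.+ m)) → (∀ i → CyclicAt (Vec.lookup v) i) → Cyclic v
  ⇒Cyclic {m} v h = ⇒Windows (closure v) λ k k< → window k
    (ℕ.+-cancelʳ-< 3 k (4 ℕ.+ m) (subst (k ℕ.+ 3 ℕ.<_) (length-closure v) k<))
    where
    window : ∀ k → k ℕ.< 4 ℕ.+ m → WindowAt (nth (closure v)) k
    window k k<n = subst id (sym (closure-window v k k<n))
      (subst (WindowAt (λ k → Vec.lookup v (k mod (4 ℕ.+ m)))) (Fin.toℕ-fromℕ< k<n) (h (fromℕ< k<n)))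

-- Counting a quotient

lookup-injective : {C : Set} {xs : List C} → Unique xs → ∀ i j → List.lookup xs i ≡ List.lookup xs j → i ≡ j
lookup-injective (_ ∷ _)      zero    zero    _ = refl
lookup-injective (x∉ ∷ _)     zero    (suc j) e = ⊥-elim (All.lookup x∉ (∈-lookup j) e)
lookup-injective (x∉ ∷ _)     (suc i) zero    e = ⊥-elim (All.lookup x∉ (∈-lookup i) (sym e))
lookup-injective (_ ∷ unique) (suc i) (suc j) e = cong suc (lookup-injective unique i j e)

-- Classes are told apart by a complete invariant; its place in a list without repetitions is the
-- required map to `Fin`.
cardQuot : {A C : Set} {_~_ : A → A → Set} (xs : List C) → Unique xs → (code : A → C) → (∀ x → code x ∈ xs) →
           (∀ x y → code x ≡ code y → x ~ y) → (∀ x y → x ~ y → code x ≡ code y) →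
           (∀ {c} → c ∈ xs → ∃[ x ] code x ≡ c) → CardQuot (length xs) _~_
cardQuot xs unique code code∈ reflects preserves onto =
    (λ x → index (code∈ x))
  , (λ x y → (λ e → reflects x y (trans (lookup-index (code∈ x)) (trans (cong (List.lookup xs) e) (sym (lookup-index (code∈ y))))))
           , (λ x~y → lookup-injective unique _ _ (trans (sym (lookup-index (code∈ x))) (trans (preserves x y x~y) (lookup-index (code∈ y))))))
  , (λ k → let x , e = onto (∈-lookup k) in x , lookup-injective unique _ k (trans (sym (lookup-index (code∈ x))) e))

-- Transport of the field structure to Fin q

module Transport (K : CommutativeRing 0ℓ 0ℓ) (isField : IsField K) (q : ℕ) (size : HasSize K q) where
  private module K = CommutativeRing K
  open K using (Carrier; _≈_)

  encode : Carrier → Fin q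
  encode = proj₁ size

  decode : Fin q → Carrier
  decode a = proj₁ (proj₂ (proj₂ size) a)

  encode-decode : ∀ a → encode (decode a) ≡ a
  encode-decode a = proj₂ (proj₂ (proj₂ size) a)

  encode-cong : ∀ {x y} → x ≈ y → encode x ≡ encode y
  encode-cong {x} {y} = proj₂ (proj₁ (proj₂ size) x y)

  encode-injective : ∀ {x y} → encode x ≡ encode y → x ≈ y
  encode-injective {x} {y} = proj₁ (proj₁ (proj₂ size) x y)

  decode-encode : ∀ x → decode (encode x) ≈ x
  decode-encode x = encode-injective (encode-decode (encode x))

  rawRing : RawRing 0ℓ 0ℓ
  rawRing = record
    { Carrier = Fin q
    ; _≈_ = _≡_
    ; _+_ = λ a b → encode (decode a K.+ decode b)
    ; _*_ = λ a b → encode (decode a K.* decode b)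
    ; -_  = λ a → encode (K.- decode a)
    ; 0#  = encode K.0#
    ; 1#  = encode K.1#
    }

  -- The operations on `Fin q` are computed in K and encoded again, so `decode` is a homomorphism
  -- and its injectivity pulls all ring laws back.
  decode-isRingMonomorphism : IsRingMonomorphism rawRing K.rawRing decode
  decode-isRingMonomorphism = record
    { isRingHomomorphism = record
      { isSemiringHomomorphism = record
        { isNearSemiringHomomorphism = record
          { +-isMonoidHomomorphism = record
            { isMagmaHomomorphism = record
              { isRelHomomorphism = record { cong = λ { refl → K.refl } }
              ; homo = λ a b → decode-encode _
              }
            ; ε-homo = decode-encode _
            }
          ; *-homo = λ a b → decode-encode _
          }
        ; 1#-homo = decode-encode _
        }
      ; -‿homo = λ a → decode-encode _
      }
    ; injective = λ {a} {b} e → trans (sym (encode-decode a)) (trans (encode-cong e) (encode-decode b))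
    }

  inv : Fin q → Fin q
  inv a with a Fin.≟ encode K.0#
  -- A dummy value: the field law speaks of nonzero elements only.
  ... | yes _  = a
  ... | no a≢0 = encode (proj₁ (proj₂ isField (decode a) λ e → a≢0 (trans (sym (encode-decode a)) (encode-cong e))))

  inv-inverse : ∀ a → a ≢ encode K.0# → encode (decode a K.* decode (inv a)) ≡ encode K.1#
  inv-inverse a a≢0 with a Fin.≟ encode K.0#
  ... | yes a≡0 = ⊥-elim (a≢0 a≡0)
  ... | no _    = encode-cong (K.trans (K.*-cong K.refl (decode-encode _)) (proj₂ (proj₂ isField (decode a) _)))

  𝔽 : FiniteField q
  𝔽 = record
    { RawRing rawRing
    ; _⁻¹ = inv
    ; isCommutativeRing = RingMonomorphism.isCommutativeRing decode-isRingMonomorphism K.isCommutativeRing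
    ; 1≢0 = proj₁ isField ∘ encode-injective
    ; inverse = inv-inverse
    }

  open FiniteField 𝔽
  open Geometry 𝔽

  encode-+ : ∀ x y → encode (x K.+ y) ≡ encode x + encode y
  encode-+ x y = encode-cong (K.+-cong (K.sym (decode-encode x)) (K.sym (decode-encode y)))

  encode-* : ∀ x y → encode (x K.* y) ≡ encode x * encode y
  encode-* x y = encode-cong (K.*-cong (K.sym (decode-encode x)) (K.sym (decode-encode y)))

  encodeV : K⁴ K → V
  encodeV w = ⟨ encode (w 0F) , encode (w 1F) , encode (w 2F) , encode (w 3F) ⟩

  decodeV : V → K⁴ K
  decodeV ⟨ a , b , c , d ⟩ zero = decode a
  decodeV ⟨ a , b , c , d ⟩ (suc zero) = decode b
  decodeV ⟨ a , b , c , d ⟩ (suc (suc zero)) = decode c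
  decodeV ⟨ a , b , c , d ⟩ (suc (suc (suc zero))) = decode d

  encodeV-decodeV : ∀ v → encodeV (decodeV v) ≡ v
  encodeV-decodeV v = ⟨⟩-cong (encode-decode _) (encode-decode _) (encode-decode _) (encode-decode _)

  coordinate : V → Fin 4 → F
  coordinate ⟨ a , b , c , d ⟩ zero = a
  coordinate ⟨ a , b , c , d ⟩ (suc zero) = b
  coordinate ⟨ a , b , c , d ⟩ (suc (suc zero)) = c
  coordinate ⟨ a , b , c , d ⟩ (suc (suc (suc zero))) = d

  encodeV-coordinate : ∀ w i → coordinate (encodeV w) i ≡ encode (w i)
  encodeV-coordinate w zero = refl
  encodeV-coordinate w (suc zero) = refl
  encodeV-coordinate w (suc (suc zero)) = refl
  encodeV-coordinate w (suc (suc (suc zero))) = refl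

  encodeV≡0 : ∀ w → encodeV w ≡ 0V → ∀ i → w i ≈ K.0#
  encodeV≡0 w e i = encode-injective (trans (sym (encodeV-coordinate w i)) (trans (cong (λ v → coordinate v i) e) (0V-coordinate i)))
    where
    0V-coordinate : ∀ i → coordinate 0V i ≡ encode K.0#
    0V-coordinate zero = refl
    0V-coordinate (suc zero) = refl
    0V-coordinate (suc (suc zero)) = refl
    0V-coordinate (suc (suc (suc zero))) = refl

  ≈0⇒encodeV≡0 : ∀ w → (∀ i → w i ≈ K.0#) → encodeV w ≡ 0V
  ≈0⇒encodeV≡0 w e = ⟨⟩-cong (encode-cong (e 0F)) (encode-cong (e 1F)) (encode-cong (e 2F)) (encode-cong (e 3F))

  combination : (Fin 4 → Carrier) → (Fin 4 → K⁴ K) → K⁴ K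
  combination c w k = ((c 0F K.* w 0F k K.+ c 1F K.* w 1F k) K.+ c 2F K.* w 2F k) K.+ c 3F K.* w 3F k

  encodeV-combination : ∀ c w → encodeV (combination c w) ≡
    comb (encodeV c) (encodeV (w 0F)) (encodeV (w 1F)) (encodeV (w 2F)) (encodeV (w 3F))
  encodeV-combination c w = ⟨⟩-cong (linear 0F) (linear 1F) (linear 2F) (linear 3F)
    where
    linear : ∀ k → encode (combination c w k) ≡
      encode (c 0F) * encode (w 0F k) + encode (c 1F) * encode (w 1F k) + encode (c 2F) * encode (w 2F k) + encode (c 3F) * encode (w 3F k)
    linear k = trans (encode-+ _ _) (cong₂ _+_ (trans (encode-+ _ _) (cong₂ _+_ (trans (encode-+ _ _)
      (cong₂ _+_ (encode-* _ _) (encode-* _ _))) (encode-* _ _))) (encode-* _ _))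

  LinIndep4⇒Ind : ∀ w → LinIndep4 K w → Ind (encodeV (w 0F)) (encodeV (w 1F)) (encodeV (w 2F)) (encodeV (w 3F))
  LinIndep4⇒Ind w h t e = begin
    t                         ≡⟨ encodeV-decodeV t ⟨
    encodeV (decodeV t)       ≡⟨ ≈0⇒encodeV≡0 (decodeV t) (h (decodeV t) (encodeV≡0 (combination (decodeV t) w) sum≡0)) ⟩
    0V                        ∎
    where
    sum≡0 : encodeV (combination (decodeV t) w) ≡ 0V
    sum≡0 = trans (encodeV-combination (decodeV t) w)
      (trans (cong (λ s → comb s (encodeV (w 0F)) (encodeV (w 1F)) (encodeV (w 2F)) (encodeV (w 3F))) (encodeV-decodeV t)) e)

  Ind⇒LinIndep4 : ∀ w → Ind (encodeV (w 0F)) (encodeV (w 1F)) (encodeV (w 2F)) (encodeV (w 3F)) → LinIndep4 K w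
  Ind⇒LinIndep4 w h c e = encodeV≡0 c (h (encodeV c)
    (trans (sym (encodeV-combination c w)) (≈0⇒encodeV≡0 (combination c w) e)))

  normalise : V → V
  normalise v = lead v ⁻¹ ⊙ v

  lead-normalise : ∀ v → lead v ≢ 0# → lead (normalise v) ≡ 1#
  lead-normalise v l≢0 = trans (lead-⊙ _ v) (inverseˡ (lead v) l≢0)

  normalise-normal : ∀ v → lead v ≡ 1# → normalise v ≡ v
  normalise-normal v e = begin
    lead v ⁻¹ ⊙ v          ≡⟨ cong (lead v ⁻¹ ⊙_) (⊙-identity v) ⟨
    lead v ⁻¹ ⊙ 1# ⊙ v     ≡⟨ cong (λ s → lead v ⁻¹ ⊙ s ⊙ v) e ⟨
    lead v ⁻¹ ⊙ lead v ⊙ v ≡⟨ ⊙-assoc _ _ v ⟩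
    (lead v ⁻¹ * lead v) ⊙ v ≡⟨ cong (_⊙ v) (inverseˡ (lead v) λ e′ → 1≢0 (trans (sym e) e′)) ⟩
    1# ⊙ v                 ≡⟨ ⊙-identity v ⟩
    v                      ∎

  unnormalise : ∀ v → lead v ≢ 0# → lead v ⊙ normalise v ≡ v
  unnormalise v l≢0 = trans (⊙-assoc _ _ v) (trans (cong (_⊙ v) (inverse (lead v) l≢0)) (⊙-identity v))

  normalise-⊙ : ∀ s v → s ≢ 0# → lead v ≢ 0# → normalise (s ⊙ v) ≡ normalise v
  normalise-⊙ s v s≢0 l≢0 = ⊙-injective {lead (s ⊙ v)} sl≢0 (begin
    lead (s ⊙ v) ⊙ normalise (s ⊙ v)   ≡⟨ unnormalise (s ⊙ v) sl≢0 ⟩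
    s ⊙ v                              ≡⟨ cong (s ⊙_) (unnormalise v l≢0) ⟨
    s ⊙ lead v ⊙ normalise v           ≡⟨ ⊙-assoc s _ _ ⟩
    (s * lead v) ⊙ normalise v         ≡⟨ cong (_⊙ normalise v) (lead-⊙ s v) ⟨
    lead (s ⊙ v) ⊙ normalise v         ∎)
    where
    sl≢0 : lead (s ⊙ v) ≢ 0#
    sl≢0 e = l≢0 (*-cancel-0 s (lead v) s≢0 (trans (sym (lead-⊙ s v)) e))

  ind-normalise : ∀ a b c d → lead a ≢ 0# → lead b ≢ 0# → lead c ≢ 0# → lead d ≢ 0# →
                  ind (normalise a) (normalise b) (normalise c) (normalise d) ≡ ind a b c d
  ind-normalise a b c d a≢0 b≢0 c≢0 d≢0 = begin
    ind (normalise a) (normalise b) (normalise c) (normalise d) ≡⟨ scale₁ a _ _ _ (⁻¹-nonzero _ a≢0) ⟩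
    ind a (normalise b) (normalise c) (normalise d)             ≡⟨ scale₂ a b _ _ (⁻¹-nonzero _ b≢0) ⟩
    ind a b (normalise c) (normalise d)                         ≡⟨ scale₃ a b c _ (⁻¹-nonzero _ c≢0) ⟩
    ind a b c (normalise d)                                     ≡⟨ scale₄ a b c d (⁻¹-nonzero _ d≢0) ⟩
    ind a b c d                                                 ∎

  vector : P³ K → V
  vector x = encodeV (lift K x)

  lead-vector : ∀ x → lead (vector x) ≢ 0#
  lead-vector (w , w≢0) e = w≢0 (encodeV≡0 w (lead≡0 _ e))

  encodeV-* : ∀ s x y → (∀ i → lift K x i ≈ s K.* lift K y i) → vector x ≡ encode s ⊙ vector y
  encodeV-* s x y e = ⟨⟩-cong (at 0F) (at 1F) (at 2F) (at 3F)
    where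
    at : ∀ i → encode (lift K x i) ≡ encode s * encode (lift K y i)
    at i = trans (encode-cong (e i)) (encode-* s _)

  ∼P⇒≡ : ∀ x y → _∼P_ K x y → normalise (vector x) ≡ normalise (vector y)
  ∼P⇒≡ x y (s , s≢0 , e) = trans (cong normalise (encodeV-* s x y e))
    (normalise-⊙ (encode s) (vector y) (s≢0 ∘ encode-injective) (lead-vector y))

  ≡⇒∼P : ∀ x y → normalise (vector x) ≡ normalise (vector y) → _∼P_ K x y
  ≡⇒∼P x y e = decode s , (λ s≈0 → s≢0 (trans (sym (encode-decode s)) (encode-cong s≈0))) , λ i → encode-injective (begin
    encode (lift K x i)                    ≡⟨ encodeV-coordinate (lift K x) i ⟨
    coordinate (vector x) i                ≡⟨ cong (λ v → coordinate v i) x≡sy ⟩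
    coordinate (s ⊙ vector y) i            ≡⟨ ⊙-coordinate s (vector y) i ⟩
    s * coordinate (vector y) i            ≡⟨ cong₂ _*_ (sym (encode-decode s)) (encodeV-coordinate (lift K y) i) ⟩
    encode (decode s) * encode (lift K y i) ≡⟨ encode-* (decode s) (lift K y i) ⟨
    encode (decode s K.* lift K y i)       ∎)
    where
    s : F
    -- Equal normal forms make the vectors proportional in the ratio of their leading coordinates.
    s = lead (vector x) * lead (vector y) ⁻¹
    s≢0 : s ≢ 0#
    s≢0 e = ⁻¹-nonzero _ (lead-vector y) (*-cancel-0 _ _ (lead-vector x) e)
    x≡sy : vector x ≡ s ⊙ vector y
    x≡sy = begin
      vector x                                    ≡⟨ unnormalise (vector x) (lead-vector x) ⟨
      lead (vector x) ⊙ normalise (vector x)      ≡⟨ cong (lead (vector x) ⊙_) e ⟩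
      lead (vector x) ⊙ normalise (vector y)      ≡⟨ ⊙-assoc _ _ _ ⟩
      s ⊙ vector y                                ∎
    ⊙-coordinate : ∀ s v i → coordinate (s ⊙ v) i ≡ s * coordinate v i
    ⊙-coordinate s v zero = refl
    ⊙-coordinate s v (suc zero) = refl
    ⊙-coordinate s v (suc (suc zero)) = refl
    ⊙-coordinate s v (suc (suc (suc zero))) = refl

  ∈-points : ∀ {v} → lead v ≡ 1# → v ∈ points
  ∈-points {v} = ∈-filter⁺ (λ v → lead v ≟ 1#) (Enumeration.complete V-enumeration v)

  points-unique : Unique points
  points-unique = filter⁺ (λ v → lead v ≟ 1#) (Enumeration.unique V-enumeration)

  tuples-unique : ∀ n → Unique (tuples n)
  tuples-unique zero    = [] ∷ []
  tuples-unique (suc n) = cartesianProductWith⁺ _∷_ ∷-injective points-unique (tuples-unique n)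

  ∈-tuples : ∀ {n} (v : Vec V n) → (∀ i → lead (Vec.lookup v i) ≡ 1#) → v ∈ tuples n
  ∈-tuples []      _ = here refl
  ∈-tuples (x ∷ v) h = ∈-cartesianProductWith⁺ _∷_ (∈-points (h zero)) (∈-tuples v (h ∘ suc))

  tuples-normal : ∀ {n} {v : Vec V n} → v ∈ tuples n → ∀ i → lead (Vec.lookup v i) ≡ 1#
  tuples-normal {suc n} v∈ i
    with _ , _ , x∈ , w∈ , refl ← ∈-cartesianProductWith⁻ _∷_ points (tuples n) v∈ with i
  ... | zero  = proj₂ (∈-filter⁻ (λ v → lead v ≟ 1#) {xs = vectors} x∈)
  ... | suc i = tuples-normal w∈ i

  module _ (m : ℕ) where

    private
      n : ℕ
      n = 4 ℕ.+ m

    code : C4Tuple K n → Vec V n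
    code (p , _) = Vec.tabulate λ i → normalise (vector (p i))

    code-lookup : ∀ x i → Vec.lookup (code x) i ≡ normalise (vector (proj₁ x i))
    code-lookup (p , _) = lookup∘tabulate λ i → normalise (vector (p i))

    code∈ : ∀ x → code x ∈ cyclicTuples m
    code∈ x@(p , independent) = ∈-filter⁺ Cyclic?
      (∈-tuples (code x) λ i → trans (cong lead (code-lookup x i)) (lead-normalise _ (lead-vector (p i))))
      (⇒Cyclic (code x) λ i → ind⇒Ind (begin
        ind (u i 0F) (u i 1F) (u i 2F) (u i 3F)
          ≡⟨ ind-cong (code-lookup x _) (code-lookup x _) (code-lookup x _) (code-lookup x _) ⟩
        ind (normalise (w i 0F)) (normalise (w i 1F)) (normalise (w i 2F)) (normalise (w i 3F))
          ≡⟨ ind-normalise _ _ _ _ (lead-vector (p _)) (lead-vector (p _)) (lead-vector (p _)) (lead-vector (p _)) ⟩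
        ind (w i 0F) (w i 1F) (w i 2F) (w i 3F)
          ≡⟨ ind≡1 (LinIndep4⇒Ind (λ j → lift K (p (shift K n i j))) (independent i)) ⟩
        1 ∎))
      where
      u w : Fin n → Fin 4 → V
      u i j = Vec.lookup (code x) (shift K n i j)
      w i j = vector (p (shift K n i j))
      ind-cong : ∀ {a a′ b b′ c c′ d d′} → a ≡ a′ → b ≡ b′ → c ≡ c′ → d ≡ d′ → ind a b c d ≡ ind a′ b′ c′ d′
      ind-cong refl refl refl refl = refl

    code-reflects : ∀ x y → code x ≡ code y → _∼C_ K x y
    code-reflects x y e i = ≡⇒∼P (proj₁ x i) (proj₁ y i)
      (trans (sym (code-lookup x i)) (trans (cong (λ v → Vec.lookup v i) e) (code-lookup y i)))

    code-preserves : ∀ x y → _∼C_ K x y → code x ≡ code y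
    code-preserves x y h = tabulate-cong λ i → ∼P⇒≡ (proj₁ x i) (proj₁ y i) (h i)

    code-onto : ∀ {v} → v ∈ cyclicTuples m → ∃[ x ] code x ≡ v
    code-onto {v} v∈ = ((λ i → decodeV (Vec.lookup v i) , nonzero-at i) , independent) ,
      trans (tabulate-cong λ i → trans (cong normalise (encodeV-decodeV (Vec.lookup v i))) (normalise-normal (Vec.lookup v i) (normal-at i)))
            (tabulate∘lookup v)
      where
      v∈′ : v ∈ tuples n × Cyclic v
      v∈′ = ∈-filter⁻ Cyclic? {xs = tuples n} v∈
      normal-at : ∀ i → lead (Vec.lookup v i) ≡ 1#
      normal-at = tuples-normal (proj₁ v∈′)
      nonzero-at : ∀ i → NonZeroVec K (decodeV (Vec.lookup v i))
      nonzero-at i h = 1≢0 (begin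
        1#                                             ≡⟨ normal-at i ⟨
        lead (Vec.lookup v i)                          ≡⟨ cong lead (encodeV-decodeV (Vec.lookup v i)) ⟨
        lead (encodeV (decodeV (Vec.lookup v i)))      ≡⟨ cong lead (≈0⇒encodeV≡0 (decodeV (Vec.lookup v i)) h) ⟩
        lead 0V                                        ≡⟨ lead-0 ⟩
        0#                                             ∎)
      independent : ∀ i → LinIndep4 K (λ j → decodeV (Vec.lookup v (shift K n i j)))
      independent i = Ind⇒LinIndep4 (λ j → decodeV (u j)) (subst id
        (sym (Ind-cong (encodeV-decodeV (u 0F)) (encodeV-decodeV (u 1F)) (encodeV-decodeV (u 2F)) (encodeV-decodeV (u 3F))))
        (Cyclic⇒ v (proj₂ v∈′) i))
        where
        u : Fin 4 → V
        u j = Vec.lookup v (shift K n i j)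

    C4-card : CardQuot {C4Tuple K n} (closedWalks m) (_∼C_ K)
    C4-card = subst (λ N → CardQuot N (_∼C_ K)) (cyclicTuples-length m)
      (cardQuot (cyclicTuples m) (filter⁺ Cyclic? (tuples-unique n)) code code∈ code-reflects code-preserves code-onto)

open import Data.Integer using (-[1+_]; _+_; _-_; _*_; -_; _^_; -1ℤ)

-- Linearity of the Hecke operators

infix 4 _≐_
_≐_ : Table ℤ → Table ℤ → Set
g ≐ h = ∀ i j k l → g i j k l ≡ h i j k l

_⊖_·_ : Table ℤ → ℤ → Table ℤ → Table ℤ
(g ⊖ c · h) i j k l = g i j k l - c * h i j k l

module _ (Q : ℤ) where

  mix-linear : ∀ b c x y x′ y′ → mix Q b (x - c * x′) (y - c * y′) ≡ mix Q b x y - c * mix Q b x′ y′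
  mix-linear true c x y x′ y′ = lem Q c x x′
    where
    lem : ∀ Q c x x′ → Q * (x - c * x′) ≡ Q * x - c * (Q * x′)
    lem = solve-∀
  mix-linear false c x y x′ y′ = lem Q c x y x′ y′
    where
    lem : ∀ Q c x y x′ y′ → (x - c * x′) - (y - c * y′) + Q * (y - c * y′) ≡ (x - y + Q * y) - c * (x′ - y′ + Q * y′)
    lem = solve-∀

  T₁-linear : ∀ {f g h} c → f ≐ g ⊖ c · h → T₁ Q f ≐ T₁ Q g ⊖ c · T₁ Q h
  T₁-linear c e i j k l = trans (cong₂ (mix Q (i <F j)) (e j i k l) (e i j k l)) (mix-linear (i <F j) c _ _ _ _)

  T₂-linear : ∀ {f g h} c → f ≐ g ⊖ c · h → T₂ Q f ≐ T₂ Q g ⊖ c · T₂ Q h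
  T₂-linear c e i j k l = trans (cong₂ (mix Q (j <F k)) (e i k j l) (e i j k l)) (mix-linear (j <F k) c _ _ _ _)

  T₃-linear : ∀ {f g h} c → f ≐ g ⊖ c · h → T₃ Q f ≐ T₃ Q g ⊖ c · T₃ Q h
  T₃-linear c e i j k l = trans (cong₂ (mix Q (k <F l)) (e i j l k) (e i j k l)) (mix-linear (k <F l) c _ _ _ _)

  M^-linear : ∀ m {f g h} c → f ≐ g ⊖ c · h → M^ Q m f ≐ M^ Q m g ⊖ c · M^ Q m h
  M^-linear zero    c e = e
  M^-linear (suc m) {f} {g} {h} c e =
    T₃-linear {g = T₂ Q (T₁ Q (M^ Q m g))} {T₂ Q (T₁ Q (M^ Q m h))} c
      (T₂-linear {g = T₁ Q (M^ Q m g)} {T₁ Q (M^ Q m h)} c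
        (T₁-linear {g = M^ Q m g} {M^ Q m h} c (M^-linear m c e)))

  M-cong : ∀ {f g} → f ≐ g → M Q f ≐ M Q g
  M-cong e i j k l = cong₂ (mix Q (k <F l)) (T₂T₁ i j l k) (T₂T₁ i j k l)
    where
    T₁e : ∀ i j k l → _
    T₁e i j k l = cong₂ (mix Q (i <F j)) (e j i k l) (e i j k l)
    T₂T₁ : ∀ i j k l → _
    T₂T₁ i j k l = cong₂ (mix Q (j <F k)) (T₁e i k j l) (T₁e i j k l)

  Vanishing : Table ℤ → Set
  Vanishing g = ∀ {i j k l} → Perm i j k l → g i j k l ≡ + 0

  mix-0 : ∀ b {x y} → x ≡ + 0 → y ≡ + 0 → mix Q b x y ≡ + 0
  mix-0 true  refl refl = ℤ.*-zeroʳ Q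
  mix-0 false refl refl = trans (ℤ.+-identityˡ _) (ℤ.*-zeroʳ Q)

  -- Each operator combines an entry only with the one at a neighbouring transposition, so values at
  -- permutations come from values at permutations.
  M^-vanishing : ∀ m {g} → Vanishing g → Vanishing (M^ Q m g)
  M^-vanishing zero    g≐0 = g≐0
  M^-vanishing (suc m) {g} g≐0 {i} {j} {k} {l} π = mix-0 (k <F l) (V₂ (swap₃ π)) (V₂ π)
    where
    V₀ : Vanishing (M^ Q m g)
    V₀ = M^-vanishing m g≐0
    V₁ : Vanishing (T₁ Q (M^ Q m g))
    V₁ {i} {j} π = mix-0 (i <F j) (V₀ (swap₁ π)) (V₀ π)
    V₂ : Vanishing (T₂ Q (T₁ Q (M^ Q m g)))
    V₂ {j = j} {k} π = mix-0 (j <F k) (V₁ (swap₂ π)) (V₁ π)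

  M^-M : ∀ m g → M^ Q m (M Q g) ≡ M Q (M^ Q m g)
  M^-M zero    g = refl
  M^-M (suc m) g = cong (M Q) (M^-M m g)

  M^-M⁴ : ∀ m g → M^ Q m (M^ Q 4 g) ≡ M^ Q (4 ℕ.+ m) g
  M^-M⁴ m g = begin
    M^ Q m (M^ Q 4 g)                 ≡⟨ M^-M m (M^ Q 3 g) ⟩
    M Q (M^ Q m (M^ Q 3 g))           ≡⟨ cong (M Q) (M^-M m (M^ Q 2 g)) ⟩
    M^ Q 2 (M^ Q m (M^ Q 2 g))        ≡⟨ cong (M^ Q 2) (M^-M m (M Q g)) ⟩
    M^ Q 3 (M^ Q m (M Q g))           ≡⟨ cong (M^ Q 3) (M^-M m g) ⟩
    M^ Q (4 ℕ.+ m) g                  ∎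

-- Polynomials in q, as lists of coefficients

-- Coefficients from the constant term upwards. Trailing zeros are never removed, which is why zero
-- is tested by `isZero`.
Poly : Set
Poly = List ℤ

infixl 6 _⊞_
_⊞_ : Poly → Poly → Poly
[]      ⊞ b       = b
(x ∷ a) ⊞ []      = x ∷ a
(x ∷ a) ⊞ (y ∷ b) = (x + y) ∷ (a ⊞ b)

infix 7 ⊟_
⊟_ : Poly → Poly
⊟_ = List.map (λ x → - x)

infixr 8 X^_·_ _⊠_
X^_·_ : ℕ → Poly → Poly
X^ zero  · a = a
X^ suc n · a = + 0 ∷ X^ n · a

_⊠_ : Poly → Poly → Poly
[]      ⊠ b = []
(x ∷ a) ⊠ b = List.map (x *_) b ⊞ (+ 0 ∷ a ⊠ b)

isZero : Poly → Bool
isZero []          = true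
isZero (+ 0 ∷ a)   = isZero a
isZero (_ ∷ _)     = false

Stored : Set
Stored = Vec (Vec (Vec (Vec Poly 4) 4) 4) 4

store : Table Poly → Stored
store f = tabulate λ i → tabulate λ j → tabulate λ k → tabulate λ l → f i j k l

look : Stored → Table Poly
look v i j k l = lookup (lookup (lookup (lookup v i) j) k) l

look-store : ∀ f i j k l → look (store f) i j k l ≡ f i j k l
look-store f i j k l
  rewrite lookup∘tabulate (λ i → tabulate λ j → tabulate λ k → tabulate λ l → f i j k l) i
        | lookup∘tabulate (λ j → tabulate λ k → tabulate λ l → f i j k l) j
        | lookup∘tabulate (λ k → tabulate λ l → f i j k l) k
        = lookup∘tabulate (λ l → f i j k l) l

mixᴾ : Bool → Poly → Poly → Poly
mixᴾ true  x y = X^ 1 · x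
mixᴾ false x y = (x ⊞ ⊟ y) ⊞ X^ 1 · y

t₁ t₂ t₃ : Stored → Table Poly
t₁ v i j k l = mixᴾ (i <F j) (look v j i k l) (look v i j k l)
t₂ v i j k l = mixᴾ (j <F k) (look v i k j l) (look v i j k l)
t₃ v i j k l = mixᴾ (k <F l) (look v i j l k) (look v i j k l)

-- Storing the table after each operator keeps the evaluation of Mᴾ linear in its size.
Mᴾ : Stored → Stored
Mᴾ v = store (t₃ (store (t₂ (store (t₁ v)))))

subtract : ℕ → Stored → Stored → Table Poly
subtract e w v i j k l = look w i j k l ⊞ ⊟ X^ e · look v i j k l

δᴾ : Table Poly
δᴾ i j k l = δ i j k l ∷ []

allFour : (Fin 4 → Bool) → Bool
allFour p = p 0F ∧ p 1F ∧ p 2F ∧ p 3F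

distinctᵇ : Table Bool
distinctᵇ i j k l = i ≠ j ∧ i ≠ k ∧ i ≠ l ∧ j ≠ k ∧ j ≠ l ∧ k ≠ l
  where
  _≠_ : Fin 4 → Fin 4 → Bool
  i ≠ j = does (¬? (i Fin.≟ j))

allTable : Table Bool → Bool
allTable p = allFour λ i → allFour λ j → allFour λ k → allFour λ l → p i j k l

vanishesAt : Stored → Table Bool
vanishesAt v i j k l = if distinctᵇ i j k l then isZero (look v i j k l) else true

∧-true : ∀ {a b} → a ∧ b ≡ true → a ≡ true × b ≡ true
∧-true {true} {true} refl = refl , refl

allFour-sound : ∀ p → allFour p ≡ true → ∀ i → p i ≡ true
allFour-sound p e i
  with e₀ , e′ ← ∧-true {p 0F} e
  with e₁ , e″ ← ∧-true {p 1F} e′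
  with e₂ , e₃ ← ∧-true {p 2F} e″ = case i
  where
  case : ∀ i → p i ≡ true
  case zero = e₀
  case (suc zero) = e₁
  case (suc (suc zero)) = e₂
  case (suc (suc (suc zero))) = e₃

allTable-sound : ∀ p → allTable p ≡ true → ∀ i j k l → p i j k l ≡ true
allTable-sound p e i j k =
  allFour-sound (p i j k)
    (allFour-sound (λ k → allFour (p i j k))
      (allFour-sound (λ j → allFour λ k → allFour (p i j k))
        (allFour-sound (λ i → allFour λ j → allFour λ k → allFour (p i j k)) e i) j) k)

module Evaluation (Q : ℤ) where

  eval : Poly → ℤ
  eval []      = + 0
  eval (x ∷ a) = x + Q * eval a

  eval-⊞ : ∀ a b → eval (a ⊞ b) ≡ eval a + eval b
  eval-⊞ []      b       = sym (ℤ.+-identityˡ _)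
  eval-⊞ (x ∷ a) []      = sym (ℤ.+-identityʳ _)
  eval-⊞ (x ∷ a) (y ∷ b) = trans (cong (λ z → x + y + Q * z) (eval-⊞ a b)) (lem Q x y (eval a) (eval b))
    where
    lem : ∀ Q x y a b → x + y + Q * (a + b) ≡ x + Q * a + (y + Q * b)
    lem = solve-∀

  eval-⊟ : ∀ a → eval (⊟ a) ≡ - eval a
  eval-⊟ []      = refl
  eval-⊟ (x ∷ a) = trans (cong (λ z → - x + Q * z) (eval-⊟ a)) (lem Q x (eval a))
    where
    lem : ∀ Q x a → - x + Q * (- a) ≡ - (x + Q * a)
    lem = solve-∀

  eval-X^ : ∀ n a → eval (X^ n · a) ≡ Q ^ n * eval a
  eval-X^ zero    a = sym (ℤ.*-identityˡ _)
  eval-X^ (suc n) a = begin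
    + 0 + Q * eval (X^ n · a)   ≡⟨ ℤ.+-identityˡ _ ⟩
    Q * eval (X^ n · a)         ≡⟨ cong (Q *_) (eval-X^ n a) ⟩
    Q * (Q ^ n * eval a)        ≡⟨ ℤ.*-assoc Q _ _ ⟨
    Q ^ suc n * eval a          ∎

  eval-scale : ∀ x a → eval (List.map (x *_) a) ≡ x * eval a
  eval-scale x []      = sym (ℤ.*-zeroʳ x)
  eval-scale x (y ∷ a) = trans (cong (λ z → x * y + Q * z) (eval-scale x a)) (lem Q x y (eval a))
    where
    lem : ∀ Q x y a → x * y + Q * (x * a) ≡ x * (y + Q * a)
    lem = solve-∀

  eval-⊠ : ∀ a b → eval (a ⊠ b) ≡ eval a * eval b
  eval-⊠ []      b = refl
  eval-⊠ (x ∷ a) b = begin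
    eval (List.map (x *_) b ⊞ (+ 0 ∷ a ⊠ b))           ≡⟨ eval-⊞ (List.map (x *_) b) _ ⟩
    eval (List.map (x *_) b) + (+ 0 + Q * eval (a ⊠ b)) ≡⟨ cong₂ (λ y z → y + (+ 0 + Q * z)) (eval-scale x b) (eval-⊠ a b) ⟩
    x * eval b + (+ 0 + Q * (eval a * eval b))          ≡⟨ lem Q x (eval a) (eval b) ⟩
    (x + Q * eval a) * eval b                           ∎
    where
    lem : ∀ Q x a b → x * b + (+ 0 + Q * (a * b)) ≡ (x + Q * a) * b
    lem = solve-∀

  isZero-sound : ∀ a → isZero a ≡ true → eval a ≡ + 0
  isZero-sound []              e = refl
  isZero-sound (+ 0 ∷ a)       e = trans (ℤ.+-identityˡ _) (trans (cong (Q *_) (isZero-sound a e)) (ℤ.*-zeroʳ Q))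
  isZero-sound (+ (suc _) ∷ _) ()
  isZero-sound (-[1+ _ ] ∷ _)  ()

  ⟪_⟫ : Stored → Table ℤ
  ⟪ v ⟫ i j k l = eval (look v i j k l)

  eval-mix : ∀ b x y → eval (mixᴾ b x y) ≡ mix Q b (eval x) (eval y)
  eval-mix true  x y = ℤ.+-identityˡ _
  eval-mix false x y = begin
    eval ((x ⊞ ⊟ y) ⊞ (+ 0 ∷ y))               ≡⟨ eval-⊞ (x ⊞ ⊟ y) (+ 0 ∷ y) ⟩
    eval (x ⊞ ⊟ y) + (+ 0 + Q * eval y)        ≡⟨ cong₂ _+_ (trans (eval-⊞ x (⊟ y)) (cong (λ z → eval x + z) (eval-⊟ y))) (ℤ.+-identityˡ _) ⟩
    (eval x - eval y) + Q * eval y             ∎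

  ⟪⟫-t₁ : ∀ v {g} → ⟪ v ⟫ ≐ g → ⟪ store (t₁ v) ⟫ ≐ T₁ Q g
  ⟪⟫-t₁ v e i j k l = trans (cong eval (look-store (t₁ v) i j k l))
    (trans (eval-mix (i <F j) (look v j i k l) (look v i j k l)) (cong₂ (mix Q (i <F j)) (e j i k l) (e i j k l)))

  ⟪⟫-t₂ : ∀ v {g} → ⟪ v ⟫ ≐ g → ⟪ store (t₂ v) ⟫ ≐ T₂ Q g
  ⟪⟫-t₂ v e i j k l = trans (cong eval (look-store (t₂ v) i j k l))
    (trans (eval-mix (j <F k) (look v i k j l) (look v i j k l)) (cong₂ (mix Q (j <F k)) (e i k j l) (e i j k l)))

  ⟪⟫-t₃ : ∀ v {g} → ⟪ v ⟫ ≐ g → ⟪ store (t₃ v) ⟫ ≐ T₃ Q g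
  ⟪⟫-t₃ v e i j k l = trans (cong eval (look-store (t₃ v) i j k l))
    (trans (eval-mix (k <F l) (look v i j l k) (look v i j k l)) (cong₂ (mix Q (k <F l)) (e i j l k) (e i j k l)))

  ⟪⟫-M : ∀ v {g} → ⟪ v ⟫ ≐ g → ⟪ Mᴾ v ⟫ ≐ M Q g
  ⟪⟫-M v {g} e = ⟪⟫-t₃ (store (t₂ (store (t₁ v)))) {T₂ Q (T₁ Q g)} (⟪⟫-t₂ (store (t₁ v)) {T₁ Q g} (⟪⟫-t₁ v {g} e))

  ⟪⟫-subtract : ∀ e w v → ⟪ store (subtract e w v) ⟫ ≐ ⟪ w ⟫ ⊖ Q ^ e · ⟪ v ⟫
  ⟪⟫-subtract e w v i j k l = begin
    eval (look (store (subtract e w v)) i j k l)      ≡⟨ cong eval (look-store (subtract e w v) i j k l) ⟩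
    eval (a ⊞ ⊟ X^ e · b)                             ≡⟨ eval-⊞ a (⊟ X^ e · b) ⟩
    eval a + eval (⊟ X^ e · b)                        ≡⟨ cong (λ z → eval a + z) (trans (eval-⊟ (X^ e · b)) (cong (λ z → - z) (eval-X^ e b))) ⟩
    eval a - Q ^ e * eval b                           ∎
    where
    a = look w i j k l
    b = look v i j k l

  ⟪δ⟫ : ⟪ store δᴾ ⟫ ≐ δ
  ⟪δ⟫ i j k l = trans (cong eval (look-store δᴾ i j k l))
    (trans (cong (λ z → δ i j k l + z) (ℤ.*-zeroʳ Q)) (ℤ.+-identityʳ _))

  vanishing-sound : ∀ v → allTable (vanishesAt v) ≡ true → Vanishing Q ⟪ v ⟫
  vanishing-sound v e {i} {j} {k} {l} π = isZero-sound (look v i j k l)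
    (subst (λ b → (if b then isZero (look v i j k l) else true) ≡ true) is-distinct
      (allTable-sound (vanishesAt v) e i j k l))
    where
    open Distinct (Perm⇒Distinct π)
    is-distinct : distinctᵇ i j k l ≡ true
    is-distinct rewrite dec-true (¬? (i Fin.≟ j)) i≢j | dec-true (¬? (i Fin.≟ k)) i≢k | dec-true (¬? (i Fin.≟ l)) i≢l
      | dec-true (¬? (j Fin.≟ k)) j≢k | dec-true (¬? (j Fin.≟ l)) j≢l | dec-true (¬? (k Fin.≟ l)) k≢l = refl

-- Solving the recurrence

-- q⁶ [4]_q!, the number of projective bases
R : Poly
R = X^ 6 · (+ 1 ∷ + 3 ∷ + 5 ∷ + 6 ∷ + 5 ∷ + 3 ∷ + 1 ∷ [])

-- A term (e , A) of the closed form contributes A_r (qᵉ)ᵏ at m = 4k + r.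
Term : Set
Term = ℕ × Vec Poly 4

initial : ∀ {n} → Vec Term n → Fin 4 → Poly
initial []             r = []
initial ((_ , A) ∷ ts) r = lookup A r ⊞ initial ts r

-- The difference operator f(k+1) - q^e f(k) multiplies a term with exponent e′ by q^e′ - q^e. It
-- annihilates the term with exponent e, which is the one `check` discards.
shrinkCoefficient : ℕ → ℕ → Poly → Poly
shrinkCoefficient e e′ a = X^ e′ · a ⊞ ⊟ X^ e · a

shrink : ∀ {n} → ℕ → Vec Term n → Vec Term n
shrink e []              = []
shrink e ((e′ , A) ∷ ts) = (e′ , Vec.map (shrinkCoefficient e e′) A) ∷ shrink e ts

-- Makes the evaluator share x among its uses in f.
share : {A B : Set} → A → (A → B) → B
share x f = f x

module ClosedForm (Q : ℤ) where
  open Evaluation Q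

  closed : ∀ {n} → Vec Term n → Fin 4 → ℕ → ℤ
  closed []             r k = + 0
  closed ((e , A) ∷ ts) r k = eval (lookup A r) * (Q ^ e) ^ k + closed ts r k

  closed-initial : ∀ {n} (ts : Vec Term n) r → closed ts r 0 ≡ eval (initial ts r)
  closed-initial []             r = refl
  closed-initial ((e , A) ∷ ts) r = trans (cong₂ _+_ (ℤ.*-identityʳ (eval (lookup A r))) (closed-initial ts r)) (sym (eval-⊞ (lookup A r) (initial ts r)))

  closed-shrink : ∀ {n} e (ts : Vec Term n) r k → closed ts r (suc k) ≡ closed (shrink e ts) r k + Q ^ e * closed ts r k
  closed-shrink e [] r k = sym (trans (ℤ.+-identityˡ _) (ℤ.*-zeroʳ (Q ^ e)))
  closed-shrink e ((e′ , A) ∷ ts) r k = begin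
    a * (x * y) + closed ts r (suc k)
      ≡⟨ cong (λ z → a * (x * y) + z) (closed-shrink e ts r k) ⟩
    a * (x * y) + (closed (shrink e ts) r k + z * closed ts r k)
      ≡⟨ lem a x y z (closed (shrink e ts) r k) (closed ts r k) ⟩
    (x * a - z * a) * y + closed (shrink e ts) r k + z * (a * y + closed ts r k)
      ≡⟨ cong (λ b → b * y + closed (shrink e ts) r k + z * (a * y + closed ts r k)) coefficient ⟨
    eval (lookup (Vec.map (shrinkCoefficient e e′) A) r) * y + closed (shrink e ts) r k + z * (a * y + closed ts r k) ∎
    where
    a = eval (lookup A r)
    x = Q ^ e′
    y = (Q ^ e′) ^ k
    z = Q ^ e
    lem : ∀ a x y z s t → a * (x * y) + (s + z * t) ≡ (x * a - z * a) * y + s + z * (a * y + t)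
    lem = solve-∀
    coefficient : eval (lookup (Vec.map (shrinkCoefficient e e′) A) r) ≡ x * a - z * a
    coefficient = begin
      eval (lookup (Vec.map (shrinkCoefficient e e′) A) r)      ≡⟨ cong eval (lookup-map r (shrinkCoefficient e e′) A) ⟩
      eval (X^ e′ · b ⊞ ⊟ X^ e · b)                             ≡⟨ eval-⊞ (X^ e′ · b) (⊟ X^ e · b) ⟩
      eval (X^ e′ · b) + eval (⊟ X^ e · b)                      ≡⟨ cong₂ _+_ (eval-X^ e′ b) (trans (eval-⊟ (X^ e · b)) (cong (λ z → - z) (eval-X^ e b))) ⟩
      x * a - z * a                                             ∎
      where b = lookup A r

-- The type of tables is a parameter: unfolding the tables is only affordable in a closed computation.
module Reflection {S : Set} (step : S → S) (sub : ℕ → S → S → S) (corner : S → Poly) (vanishes : S → Bool) where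

  agrees : S → Poly → Bool
  agrees v a = isZero (R ⊠ corner v ⊞ ⊟ a)

  -- Passing from v to M⁴v - q^e v acts on the entries as the difference operator acts on the closed
  -- form. Agreement at k = 0 in the four residue classes, together with agreement of the
  -- differences, gives agreement for all k. With no terms left, the table itself has to vanish at
  -- the permutations.
  check : ∀ {n} → Vec Term n → S → Bool
  check [] v = vanishes v
  check ts@((e , A) ∷ ts′) v = share (step v) λ v₁ → share (step v₁) λ v₂ → share (step v₂) λ v₃ →
    agrees v (initial ts 0F) ∧ agrees v₁ (initial ts 1F) ∧ agrees v₂ (initial ts 2F) ∧ agrees v₃ (initial ts 3F) ∧
    check (shrink e ts′) (sub e (step v₃) v)

  module Soundness (Q : ℤ) (⟪_⟫ : S → Table ℤ)
    (⟪⟫-step : ∀ v → ⟪ step v ⟫ ≐ M Q ⟪ v ⟫)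
    (⟪⟫-sub : ∀ e w v → ⟪ sub e w v ⟫ ≐ ⟪ w ⟫ ⊖ Q ^ e · ⟪ v ⟫)
    (corner-value : ∀ v → Evaluation.eval Q (corner v) ≡ ⟪ v ⟫ 3F 2F 1F 0F)
    (vanishes-sound : ∀ v → vanishes v ≡ true → Vanishing Q ⟪ v ⟫)
    where
    open Evaluation Q hiding (⟪_⟫)
    open ClosedForm Q

    step≐ : ∀ {v g} → ⟪ v ⟫ ≐ g → ⟪ step v ⟫ ≐ M Q g
    step≐ {v} e i j k l = trans (⟪⟫-step v i j k l) (M-cong Q e i j k l)

    entry : ℕ → S → ℤ
    entry m v = eval R * M^ Q m ⟪ v ⟫ 3F 2F 1F 0F

    agrees-sound : ∀ {m v w a} → ⟪ w ⟫ ≐ M^ Q m ⟪ v ⟫ → agrees w a ≡ true → entry m v ≡ eval a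
    agrees-sound {m} {v} {w} {a} e ok = begin
      entry m v                                     ≡⟨ cong (eval R *_) (trans (corner-value w) (e 3F 2F 1F 0F)) ⟨
      eval R * eval b                               ≡⟨ add-sub (eval R * eval b) (eval a) ⟩
      (eval R * eval b - eval a) + eval a           ≡⟨ cong (λ z → z + eval a) difference ⟩
      + 0 + eval a                                  ≡⟨ ℤ.+-identityˡ _ ⟩
      eval a                                        ∎
      where
      b = corner w
      add-sub : ∀ x y → x ≡ (x - y) + y
      add-sub = solve-∀
      difference : eval R * eval b - eval a ≡ + 0
      difference = begin
        eval R * eval b - eval a         ≡⟨ cong₂ _+_ (eval-⊠ R b) (eval-⊟ a) ⟨
        eval (R ⊠ b) + eval (⊟ a)        ≡⟨ eval-⊞ (R ⊠ b) (⊟ a) ⟨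
        eval (R ⊠ b ⊞ ⊟ a)               ≡⟨ isZero-sound (R ⊠ b ⊞ ⊟ a) ok ⟩
        + 0                              ∎

    -- Linearity of Mᵐ applied to M⁴v = (M⁴v - q^e v) + q^e v.
    entry-recurrence : ∀ m e v w → ⟪ w ⟫ ≐ M^ Q 4 ⟪ v ⟫ →
      entry (4 ℕ.+ m) v ≡ entry m (sub e w v) + Q ^ e * entry m v
    entry-recurrence m e v w w≐ = begin
      eval R * x                                 ≡⟨ lem (eval R) x (Q ^ e) y ⟩
      eval R * (x - Q ^ e * y) + Q ^ e * (eval R * y)
        ≡⟨ cong (λ z → eval R * z + Q ^ e * (eval R * y)) linear ⟨
      eval R * M^ Q m ⟪ sub e w v ⟫ 3F 2F 1F 0F + Q ^ e * (eval R * y) ∎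
      where
      x = M^ Q (4 ℕ.+ m) ⟪ v ⟫ 3F 2F 1F 0F
      y = M^ Q m ⟪ v ⟫ 3F 2F 1F 0F
      lem : ∀ r x z y → r * x ≡ r * (x - z * y) + z * (r * y)
      lem = solve-∀
      linear : M^ Q m ⟪ sub e w v ⟫ 3F 2F 1F 0F ≡ x - Q ^ e * y
      linear = begin
        M^ Q m ⟪ sub e w v ⟫ 3F 2F 1F 0F
          ≡⟨ M^-linear Q m {g = M^ Q 4 ⟪ v ⟫} {⟪ v ⟫} (Q ^ e)
               (λ i j k l → trans (⟪⟫-sub e w v i j k l) (cong (λ z → z - Q ^ e * ⟪ v ⟫ i j k l) (w≐ i j k l))) 3F 2F 1F 0F ⟩
        M^ Q m (M^ Q 4 ⟪ v ⟫) 3F 2F 1F 0F - Q ^ e * y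
          ≡⟨ cong (λ g → g 3F 2F 1F 0F - Q ^ e * y) (M^-M⁴ Q m ⟪ v ⟫) ⟩
        x - Q ^ e * y ∎

    module Step {n} (e : ℕ) (A : Vec Poly 4) (ts : Vec Term n) (v v₁ v₂ v₃ v₄ : S)
      (M₁ : ⟪ v₁ ⟫ ≐ M^ Q 1 ⟪ v ⟫) (M₂ : ⟪ v₂ ⟫ ≐ M^ Q 2 ⟪ v ⟫) (M₃ : ⟪ v₃ ⟫ ≐ M^ Q 3 ⟪ v ⟫) (M₄ : ⟪ v₄ ⟫ ≐ M^ Q 4 ⟪ v ⟫)
      (a₀ : agrees v (initial ((e , A) ∷ ts) 0F) ≡ true) (a₁ : agrees v₁ (initial ((e , A) ∷ ts) 1F) ≡ true)
      (a₂ : agrees v₂ (initial ((e , A) ∷ ts) 2F) ≡ true) (a₃ : agrees v₃ (initial ((e , A) ∷ ts) 3F) ≡ true)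
      (rest : ∀ r k → entry (k ℕ.* 4 ℕ.+ toℕ r) (sub e v₄ v) ≡ closed (shrink e ts) r k)
      where

      terms⁺ : Vec Term (suc n)
      terms⁺ = (e , A) ∷ ts

      start : ∀ r → entry (toℕ r) v ≡ eval (initial terms⁺ r)
      start zero                   = agrees-sound {0} {v} {v} {initial terms⁺ 0F} (λ i j k l → refl) a₀
      start (suc zero)             = agrees-sound {1} {v} {v₁} {initial terms⁺ 1F} M₁ a₁
      start (suc (suc zero))       = agrees-sound {2} {v} {v₂} {initial terms⁺ 2F} M₂ a₂
      start (suc (suc (suc zero))) = agrees-sound {3} {v} {v₃} {initial terms⁺ 3F} M₃ a₃

      -- The leading term is geometric with ratio q^e, so it leaves nothing in the difference; the
      -- other terms are `closed-shrink`.
      closed-step : ∀ r k → closed terms⁺ r (suc k) ≡ closed (shrink e ts) r k + Q ^ e * closed terms⁺ r k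
      closed-step r k = trans (cong (λ z → eval (lookup A r) * (Q ^ e * (Q ^ e) ^ k) + z) (closed-shrink e ts r k))
        (lem (eval (lookup A r)) (Q ^ e) ((Q ^ e) ^ k) (closed (shrink e ts) r k) (closed ts r k))
        where
        lem : ∀ a x y s t → a * (x * y) + (s + x * t) ≡ s + x * (a * y + t)
        lem = solve-∀

      solved : ∀ r k → entry (k ℕ.* 4 ℕ.+ toℕ r) v ≡ closed terms⁺ r k
      solved r zero    = trans (start r) (sym (closed-initial terms⁺ r))
      solved r (suc k) = begin
        entry (4 ℕ.+ (k ℕ.* 4 ℕ.+ toℕ r)) v
          ≡⟨ entry-recurrence (k ℕ.* 4 ℕ.+ toℕ r) e v v₄ M₄ ⟩
        entry (k ℕ.* 4 ℕ.+ toℕ r) (sub e v₄ v) + Q ^ e * entry (k ℕ.* 4 ℕ.+ toℕ r) v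
          ≡⟨ cong₂ (λ x y → x + Q ^ e * y) (rest r k) (solved r k) ⟩
        closed (shrink e ts) r k + Q ^ e * closed terms⁺ r k
          ≡⟨ closed-step r k ⟨
        closed terms⁺ r (suc k) ∎

    solution : ∀ {n} (ts : Vec Term n) v → check ts v ≡ true → ∀ r k → entry (k ℕ.* 4 ℕ.+ toℕ r) v ≡ closed ts r k
    solution [] v ok r k = trans
      (cong (eval R *_) (M^-vanishing Q (k ℕ.* 4 ℕ.+ toℕ r) {⟪ v ⟫} (vanishes-sound v ok)
        (swap₁ (swap₂ (swap₁ (swap₃ (swap₂ (swap₁ identity))))))))
      (ℤ.*-zeroʳ (eval R))
    solution ((e , A) ∷ ts) v ok = Step.solved e A ts v v₁ v₂ v₃ (step v₃) M₁ M₂ M₃ (step≐ M₃)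
      (proj₁ s₀) (proj₁ s₁) (proj₁ s₂) (proj₁ s₃) (solution (shrink e ts) (sub e (step v₃) v) (proj₂ s₃))
      where
      v₁ v₂ v₃ : S
      v₁ = step v
      v₂ = step v₁
      v₃ = step v₂
      M₁ : ⟪ v₁ ⟫ ≐ M^ Q 1 ⟪ v ⟫
      M₁ = ⟪⟫-step v
      M₂ : ⟪ v₂ ⟫ ≐ M^ Q 2 ⟪ v ⟫
      M₂ = step≐ M₁
      M₃ : ⟪ v₃ ⟫ ≐ M^ Q 3 ⟪ v ⟫
      M₃ = step≐ M₂
      ok₀ ok₁ ok₂ ok₃ ok₄ : Bool
      ok₀ = agrees v (initial ((e , A) ∷ ts) 0F)
      ok₁ = agrees v₁ (initial ((e , A) ∷ ts) 1F)
      ok₂ = agrees v₂ (initial ((e , A) ∷ ts) 2F)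
      ok₃ = agrees v₃ (initial ((e , A) ∷ ts) 3F)
      ok₄ = check (shrink e ts) (sub e (step v₃) v)
      s₀ = ∧-true {ok₀} {ok₁ ∧ ok₂ ∧ ok₃ ∧ ok₄} ok
      s₁ = ∧-true {ok₁} {ok₂ ∧ ok₃ ∧ ok₄} (proj₂ s₀)
      s₂ = ∧-true {ok₂} {ok₃ ∧ ok₄} (proj₂ s₁)
      s₃ = ∧-true {ok₃} {ok₄} (proj₂ s₂)

-- For c = 1, and with a factor q⁶ added for the sign character, these are the generic degrees of
-- the characters of S₄: trivial, reflection, two-dimensional, reflection times sign. In `terms` the
-- argument c is the character value at the power n = 4k + 4 + r of a 4-cycle, for instance 3, -1,
-- -1, -1 for the reflection character, and the preceding power of q is the value at k = 0 of
-- q^(en/4), apart from that sign factor.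
one refl₃ two dual₃ : ℤ → Poly
one   c = c ∷ []
refl₃ c = + 0 ∷ c ∷ c ∷ c ∷ []
two   c = + 0 ∷ + 0 ∷ c ∷ + 0 ∷ c ∷ []
dual₃ c = + 0 ∷ + 0 ∷ + 0 ∷ c ∷ c ∷ c ∷ []

-- The exponents belong to the irreducible representations of S₄: the fourth power of the
-- Coxeter element is central and acts on them by q¹², q⁸, q⁶, q⁴ and 1.
terms : Vec Term 5
terms =
    (12 , X^ 12 · one (+ 1) ∷ X^ 15 · one (+ 1) ∷ X^ 18 · one (+ 1) ∷ X^ 21 · one (+ 1) ∷ [])
  ∷ (8  , X^ 8 · refl₃ (+ 3) ∷ X^ 10 · refl₃ -1ℤ ∷ X^ 12 · refl₃ -1ℤ ∷ X^ 14 · refl₃ -1ℤ ∷ [])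
  ∷ (6  , X^ 6 · two (+ 2) ∷ X^ 7 · two (+ 0) ∷ X^ 9 · two (+ 2) ∷ X^ 10 · two (+ 0) ∷ [])
  ∷ (4  , X^ 4 · dual₃ (+ 3) ∷ X^ 5 · dual₃ (+ 1) ∷ X^ 6 · dual₃ -1ℤ ∷ X^ 7 · dual₃ (+ 1) ∷ [])
  ∷ (0  , X^ 6 · one (+ 1) ∷ X^ 6 · one -1ℤ ∷ X^ 6 · one (+ 1) ∷ X^ 6 · one -1ℤ ∷ [])
  ∷ []


open Reflection Mᴾ (λ e w v → store (subtract e w v)) (λ v → look v 3F 2F 1F 0F) (λ v → allTable (vanishesAt v))

-- Evaluation confirms twenty initial values and that the product of the five factors M⁴ - q^e kills
-- `δ` at every permutation, as polynomial identities in q.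
terms-check : check terms (store δᴾ) ≡ true
terms-check = refl

M^-cong : ∀ Q m {f g} → f ≐ g → M^ Q m f ≐ M^ Q m g
M^-cong Q zero    e = e
M^-cong Q (suc m) e = M-cong Q (M^-cong Q m e)

M^δ-value : ∀ Q r k → Evaluation.eval Q R * M^ Q (k ℕ.* 4 ℕ.+ toℕ r) δ 3F 2F 1F 0F ≡ ClosedForm.closed Q terms r k
M^δ-value Q r k = trans
  (cong (λ z → Evaluation.eval Q R * z) (sym (M^-cong Q (k ℕ.* 4 ℕ.+ toℕ r) (Evaluation.⟪δ⟫ Q) 3F 2F 1F 0F)))
  (Soundness.solution Q ⟪_⟫ (λ v → ⟪⟫-M v {⟪ v ⟫} λ i j k l → refl) ⟪⟫-subtract (λ v → refl) vanishing-sound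
    terms (store δᴾ) terms-check r k)
  where open Evaluation Q

-- The closed form rewritten in terms of n

module Formulas (Q : ℤ) where
  open Evaluation Q
  open ClosedForm Q

  term-value : ∀ p e k a N → N ≡ p ℕ.+ e ℕ.* k → eval (X^ p · a) * (Q ^ e) ^ k ≡ eval a * Q ^ N
  term-value p e k a N refl = begin
    eval (X^ p · a) * (Q ^ e) ^ k      ≡⟨ cong₂ _*_ (eval-X^ p a) (ℤ.^-*-assoc Q e k) ⟩
    Q ^ p * eval a * Q ^ (e ℕ.* k)     ≡⟨ lem (Q ^ p) (eval a) (Q ^ (e ℕ.* k)) ⟩
    eval a * (Q ^ p * Q ^ (e ℕ.* k))   ≡⟨ cong (eval a *_) (ℤ.^-distribˡ-+-* Q p (e ℕ.* k)) ⟨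
    eval a * Q ^ (p ℕ.+ e ℕ.* k)       ∎
    where
    lem : ∀ x y z → x * y * z ≡ y * (x * z)
    lem = solve-∀

  -- The common shape of the three formulas: they differ in the character values c₁, ..., c₅ only.
  combination : ℤ → ℤ → ℤ → ℤ → ℤ → ℕ → ℕ → ℕ → ℕ → ℤ
  combination c₁ c₂ c₃ c₄ c₅ N₁ N₂ N₃ N₄ =
    c₁ * Q ^ N₁ + c₂ * (Q ^ 3 + Q ^ 2 + Q) * Q ^ N₂ + c₃ * (Q ^ 4 + Q ^ 2) * Q ^ N₃
      + c₄ * (Q ^ 5 + Q ^ 4 + Q ^ 3) * Q ^ N₄ + c₅ * Q ^ 6

  combine : ∀ k p₁ p₂ p₃ p₄ c₁ c₂ c₃ c₄ c₅ N₁ N₂ N₃ N₄ →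
    N₁ ≡ p₁ ℕ.+ 12 ℕ.* k → N₂ ≡ p₂ ℕ.+ 8 ℕ.* k → N₃ ≡ p₃ ℕ.+ 6 ℕ.* k → N₄ ≡ p₄ ℕ.+ 4 ℕ.* k →
    eval (X^ p₁ · one c₁) * (Q ^ 12) ^ k + (eval (X^ p₂ · refl₃ c₂) * (Q ^ 8) ^ k + (eval (X^ p₃ · two c₃) * (Q ^ 6) ^ k
      + (eval (X^ p₄ · dual₃ c₄) * (Q ^ 4) ^ k + (eval (X^ 6 · one c₅) * (Q ^ 0) ^ k + + 0)))) ≡
    combination c₁ c₂ c₃ c₄ c₅ N₁ N₂ N₃ N₄
  combine k p₁ p₂ p₃ p₄ c₁ c₂ c₃ c₄ c₅ N₁ N₂ N₃ N₄ e₁ e₂ e₃ e₄ = begin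
    _ ≡⟨ cong₂ _+_ (term-value p₁ 12 k (one c₁) N₁ e₁) (cong₂ _+_ (term-value p₂ 8 k (refl₃ c₂) N₂ e₂)
           (cong₂ _+_ (term-value p₃ 6 k (two c₃) N₃ e₃) (cong₂ _+_ (term-value p₄ 4 k (dual₃ c₄) N₄ e₄)
             (cong (λ z → z + + 0) (term-value 6 0 k (one c₅) 6 refl))))) ⟩
    eval (one c₁) * Q ^ N₁ + (eval (refl₃ c₂) * Q ^ N₂ + (eval (two c₃) * Q ^ N₃
      + (eval (dual₃ c₄) * Q ^ N₄ + (eval (one c₅) * Q ^ 6 + + 0))))
      ≡⟨ lem Q c₁ c₂ c₃ c₄ c₅ (Q ^ N₁) (Q ^ N₂) (Q ^ N₃) (Q ^ N₄) (Q ^ 6) ⟩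
    combination c₁ c₂ c₃ c₄ c₅ N₁ N₂ N₃ N₄ ∎
    where
    -- `eval` and the small powers of Q are written out to expose a polynomial identity to the
    -- solver; the powers depending on k remain variables.
    lem : ∀ Q c₁ c₂ c₃ c₄ c₅ P₁ P₂ P₃ P₄ P₅ →
      (c₁ + Q * + 0) * P₁ + ((+ 0 + Q * (c₂ + Q * (c₂ + Q * (c₂ + Q * + 0)))) * P₂
        + ((+ 0 + Q * (+ 0 + Q * (c₃ + Q * (+ 0 + Q * (c₃ + Q * + 0))))) * P₃
        + ((+ 0 + Q * (+ 0 + Q * (+ 0 + Q * (c₄ + Q * (c₄ + Q * (c₄ + Q * + 0)))))) * P₄
        + ((c₅ + Q * + 0) * P₅ + + 0)))) ≡
      c₁ * P₁ + c₂ * (Q * (Q * (Q * + 1)) + Q * (Q * + 1) + Q) * P₂ + c₃ * (Q * (Q * (Q * (Q * + 1))) + Q * (Q * + 1)) * P₃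
        + c₄ * (Q * (Q * (Q * (Q * (Q * + 1)))) + Q * (Q * (Q * (Q * + 1))) + Q * (Q * (Q * + 1))) * P₄ + c₅ * P₅
    lem = solve-∀

  closed₀ : ∀ k → let n = 4 ℕ.+ (k ℕ.* 4 ℕ.+ 0) in closed terms 0F k ≡
    Q ^ (3 ℕ.* n) + + 3 * (Q ^ 3 + Q ^ 2 + Q) * Q ^ (2 ℕ.* n) + + 2 * (Q ^ 4 + Q ^ 2) * Q ^ (3 ℕ.* (n ℕ./ 2))
      + + 3 * (Q ^ 5 + Q ^ 4 + Q ^ 3) * Q ^ n + Q ^ 6
  closed₀ k = trans (combine k 12 8 6 4 (+ 1) (+ 3) (+ 2) (+ 3) (+ 1) (3 ℕ.* n) (2 ℕ.* n) (3 ℕ.* (n ℕ./ 2)) n (e₁ k) (e₂ k) (trans (cong (3 ℕ.*_) half) (e₃ k)) (e₄ k))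
    (cong₂ (λ x y → x + + 3 * (Q ^ 3 + Q ^ 2 + Q) * Q ^ (2 ℕ.* n) + + 2 * (Q ^ 4 + Q ^ 2) * Q ^ (3 ℕ.* (n ℕ./ 2))
      + + 3 * (Q ^ 5 + Q ^ 4 + Q ^ 3) * Q ^ n + y) (ℤ.*-identityˡ (Q ^ (3 ℕ.* n))) (ℤ.*-identityˡ (Q ^ 6)))
    where
    n = 4 ℕ.+ (k ℕ.* 4 ℕ.+ 0)
    e₁ : ∀ k → 3 ℕ.* (4 ℕ.+ (k ℕ.* 4 ℕ.+ 0)) ≡ 12 ℕ.+ 12 ℕ.* k
    e₁ = ℕ-Solver.solve-∀
    e₂ : ∀ k → 2 ℕ.* (4 ℕ.+ (k ℕ.* 4 ℕ.+ 0)) ≡ 8 ℕ.+ 8 ℕ.* k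
    e₂ = ℕ-Solver.solve-∀
    e₃ : ∀ k → 3 ℕ.* (2 ℕ.+ k ℕ.* 2) ≡ 6 ℕ.+ 6 ℕ.* k
    e₃ = ℕ-Solver.solve-∀
    e₄ : ∀ k → 4 ℕ.+ (k ℕ.* 4 ℕ.+ 0) ≡ 4 ℕ.+ 4 ℕ.* k
    e₄ = ℕ-Solver.solve-∀
    double : ∀ k → 4 ℕ.+ (k ℕ.* 4 ℕ.+ 0) ≡ (2 ℕ.+ k ℕ.* 2) ℕ.* 2
    double = ℕ-Solver.solve-∀
    half : n ℕ./ 2 ≡ 2 ℕ.+ k ℕ.* 2
    half = trans (cong (ℕ._/ 2) (double k)) (m*n/n≡m (2 ℕ.+ k ℕ.* 2) 2)

  odd-formula : ∀ P₁ a P₂ P₃ b P₄ c → + 1 * P₁ + -1ℤ * a * P₂ + + 0 * b * P₃ + + 1 * c * P₄ + -1ℤ * Q ^ 6 ≡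
    P₁ - a * P₂ + c * P₄ - Q ^ 6
  odd-formula P₁ a P₂ P₃ b P₄ c = lem P₁ a P₂ P₃ b P₄ c (Q ^ 6)
    where
    lem : ∀ P₁ a P₂ P₃ b P₄ c P₅ → + 1 * P₁ + -1ℤ * a * P₂ + + 0 * b * P₃ + + 1 * c * P₄ + -1ℤ * P₅ ≡
      P₁ - a * P₂ + c * P₄ - P₅
    lem = solve-∀

  closed₁ : ∀ k → let n = 4 ℕ.+ (k ℕ.* 4 ℕ.+ 1) in closed terms 1F k ≡
    Q ^ (3 ℕ.* n) - (Q ^ 3 + Q ^ 2 + Q) * Q ^ (2 ℕ.* n) + (Q ^ 5 + Q ^ 4 + Q ^ 3) * Q ^ n - Q ^ 6
  -- For odd n the two-dimensional character has value 0; 7 + 6k merely stands for 3n/2 rounded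
  -- down.
  closed₁ k = trans (combine k 15 10 7 5 (+ 1) -1ℤ (+ 0) (+ 1) -1ℤ (3 ℕ.* n) (2 ℕ.* n) (7 ℕ.+ 6 ℕ.* k) n (e₁ k) (e₂ k) refl (e₄ k))
    (odd-formula (Q ^ (3 ℕ.* n)) (Q ^ 3 + Q ^ 2 + Q) (Q ^ (2 ℕ.* n)) (Q ^ (7 ℕ.+ 6 ℕ.* k)) (Q ^ 4 + Q ^ 2) (Q ^ n) (Q ^ 5 + Q ^ 4 + Q ^ 3))
    where
    n = 4 ℕ.+ (k ℕ.* 4 ℕ.+ 1)
    e₁ : ∀ k → 3 ℕ.* (4 ℕ.+ (k ℕ.* 4 ℕ.+ 1)) ≡ 15 ℕ.+ 12 ℕ.* k
    e₁ = ℕ-Solver.solve-∀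
    e₂ : ∀ k → 2 ℕ.* (4 ℕ.+ (k ℕ.* 4 ℕ.+ 1)) ≡ 10 ℕ.+ 8 ℕ.* k
    e₂ = ℕ-Solver.solve-∀
    e₄ : ∀ k → 4 ℕ.+ (k ℕ.* 4 ℕ.+ 1) ≡ 5 ℕ.+ 4 ℕ.* k
    e₄ = ℕ-Solver.solve-∀

  closed₂ : ∀ k → let n = 4 ℕ.+ (k ℕ.* 4 ℕ.+ 2) in closed terms 2F k ≡
    Q ^ (3 ℕ.* n) - (Q ^ 3 + Q ^ 2 + Q) * Q ^ (2 ℕ.* n) + + 2 * (Q ^ 4 + Q ^ 2) * Q ^ (3 ℕ.* (n ℕ./ 2))
      - (Q ^ 5 + Q ^ 4 + Q ^ 3) * Q ^ n + Q ^ 6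
  closed₂ k = trans (combine k 18 12 9 6 (+ 1) -1ℤ (+ 2) -1ℤ (+ 1) (3 ℕ.* n) (2 ℕ.* n) (3 ℕ.* (n ℕ./ 2)) n (e₁ k) (e₂ k) (trans (cong (3 ℕ.*_) half) (e₃ k)) (e₄ k))
    (lem (Q ^ (3 ℕ.* n)) (Q ^ 3 + Q ^ 2 + Q) (Q ^ (2 ℕ.* n)) (Q ^ (3 ℕ.* (n ℕ./ 2))) (Q ^ 4 + Q ^ 2) (Q ^ n) (Q ^ 5 + Q ^ 4 + Q ^ 3) (Q ^ 6))
    where
    n = 4 ℕ.+ (k ℕ.* 4 ℕ.+ 2)
    lem : ∀ P₁ a P₂ P₃ b P₄ c P₅ → + 1 * P₁ + -1ℤ * a * P₂ + + 2 * b * P₃ + -1ℤ * c * P₄ + + 1 * P₅ ≡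
      P₁ - a * P₂ + + 2 * b * P₃ - c * P₄ + P₅
    lem = solve-∀
    e₁ : ∀ k → 3 ℕ.* (4 ℕ.+ (k ℕ.* 4 ℕ.+ 2)) ≡ 18 ℕ.+ 12 ℕ.* k
    e₁ = ℕ-Solver.solve-∀
    e₂ : ∀ k → 2 ℕ.* (4 ℕ.+ (k ℕ.* 4 ℕ.+ 2)) ≡ 12 ℕ.+ 8 ℕ.* k
    e₂ = ℕ-Solver.solve-∀
    e₃ : ∀ k → 3 ℕ.* (3 ℕ.+ k ℕ.* 2) ≡ 9 ℕ.+ 6 ℕ.* k
    e₃ = ℕ-Solver.solve-∀
    e₄ : ∀ k → 4 ℕ.+ (k ℕ.* 4 ℕ.+ 2) ≡ 6 ℕ.+ 4 ℕ.* k
    e₄ = ℕ-Solver.solve-∀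
    double : ∀ k → 4 ℕ.+ (k ℕ.* 4 ℕ.+ 2) ≡ (3 ℕ.+ k ℕ.* 2) ℕ.* 2
    double = ℕ-Solver.solve-∀
    half : n ℕ./ 2 ≡ 3 ℕ.+ k ℕ.* 2
    half = trans (cong (ℕ._/ 2) (double k)) (m*n/n≡m (3 ℕ.+ k ℕ.* 2) 2)

  closed₃ : ∀ k → let n = 4 ℕ.+ (k ℕ.* 4 ℕ.+ 3) in closed terms 3F k ≡
    Q ^ (3 ℕ.* n) - (Q ^ 3 + Q ^ 2 + Q) * Q ^ (2 ℕ.* n) + (Q ^ 5 + Q ^ 4 + Q ^ 3) * Q ^ n - Q ^ 6
  closed₃ k = trans (combine k 21 14 10 7 (+ 1) -1ℤ (+ 0) (+ 1) -1ℤ (3 ℕ.* n) (2 ℕ.* n) (10 ℕ.+ 6 ℕ.* k) n (e₁ k) (e₂ k) refl (e₄ k))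
    (odd-formula (Q ^ (3 ℕ.* n)) (Q ^ 3 + Q ^ 2 + Q) (Q ^ (2 ℕ.* n)) (Q ^ (10 ℕ.+ 6 ℕ.* k)) (Q ^ 4 + Q ^ 2) (Q ^ n) (Q ^ 5 + Q ^ 4 + Q ^ 3))
    where
    n = 4 ℕ.+ (k ℕ.* 4 ℕ.+ 3)
    e₁ : ∀ k → 3 ℕ.* (4 ℕ.+ (k ℕ.* 4 ℕ.+ 3)) ≡ 21 ℕ.+ 12 ℕ.* k
    e₁ = ℕ-Solver.solve-∀
    e₂ : ∀ k → 2 ℕ.* (4 ℕ.+ (k ℕ.* 4 ℕ.+ 3)) ≡ 14 ℕ.+ 8 ℕ.* k
    e₂ = ℕ-Solver.solve-∀
    e₄ : ∀ k → 4 ℕ.+ (k ℕ.* 4 ℕ.+ 3) ≡ 7 ℕ.+ 4 ℕ.* k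
    e₄ = ℕ-Solver.solve-∀

horner : ℕ → List ℕ → ℕ
horner q []       = 0
horner q (c ∷ cs) = c ℕ.+ q ℕ.* horner q cs

horner-eval : ∀ q cs → + horner q cs ≡ Evaluation.eval (+ q) (List.map +_ cs)
horner-eval q []       = refl
horner-eval q (c ∷ cs) = cong (λ z → + c + z) (trans (ℤ.pos-* q (horner q cs)) (cong (+ q *_) (horner-eval q cs)))

-- The cell sums are multiplied out over ℕ, where `horner` mirrors `eval`, and only the result is
-- moved to ℤ.
bases-R : ∀ {q} (𝔽 : FiniteField q) → + Geometry.E₀ 𝔽 ≡ Evaluation.eval (+ q) R
bases-R {q} 𝔽 = trans (cong +_ (expand q)) (horner-eval q (0 ∷ 0 ∷ 0 ∷ 0 ∷ 0 ∷ 0 ∷ 1 ∷ 3 ∷ 5 ∷ 6 ∷ 5 ∷ 3 ∷ 1 ∷ []))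
  where
  expand : ∀ q →
    let e₃ = q ℕ.* (q ℕ.* (q ℕ.* 1))
        e₂ = q ℕ.* (q ℕ.* e₃) ℕ.+ q ℕ.* (q ℕ.* (q ℕ.* e₃))
        e₁ = q ℕ.* e₂ ℕ.+ q ℕ.* (q ℕ.* e₂) ℕ.+ q ℕ.* (q ℕ.* (q ℕ.* e₂))
    in e₁ ℕ.+ q ℕ.* e₁ ℕ.+ q ℕ.* (q ℕ.* e₁) ℕ.+ q ℕ.* (q ℕ.* (q ℕ.* e₁)) ≡
       0 ℕ.+ q ℕ.* (0 ℕ.+ q ℕ.* (0 ℕ.+ q ℕ.* (0 ℕ.+ q ℕ.* (0 ℕ.+ q ℕ.* (0 ℕ.+ q ℕ.* (1 ℕ.+ q ℕ.* (3 ℕ.+ q ℕ.* (5 ℕ.+ q ℕ.* (6 ℕ.+ q ℕ.*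
         (5 ℕ.+ q ℕ.* (3 ℕ.+ q ℕ.* (1 ℕ.+ q ℕ.* 0))))))))))))
  expand = ℕ-Solver.solve-∀

closedWalks-closed : ∀ {q} (𝔽 : FiniteField q) r k →
  + Geometry.closedWalks 𝔽 (k ℕ.* 4 ℕ.+ toℕ r) ≡ ClosedForm.closed (+ q) terms r k
closedWalks-closed {q} 𝔽 r k = begin
  + Geometry.closedWalks 𝔽 m                            ≡⟨ Geometry.closedWalks-value 𝔽 m ⟩
  + Geometry.E₀ 𝔽 * M^ (+ q) m δ 3F 2F 1F 0F            ≡⟨ cong (_* M^ (+ q) m δ 3F 2F 1F 0F) (bases-R 𝔽) ⟩
  Evaluation.eval (+ q) R * M^ (+ q) m δ 3F 2F 1F 0F     ≡⟨ M^δ-value (+ q) r k ⟩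
  ClosedForm.closed (+ q) terms r k                      ∎
  where m = k ℕ.* 4 ℕ.+ toℕ r

-- The residue of n modulo 4 and the value of the gcd

module _ (k r : ℕ) where

  private
    n : ℕ
    n = 4 ℕ.+ (k ℕ.* 4 ℕ.+ r)

  ∣remainder : ∀ {d} → d ∣ 4 → d ∣ n → d ∣ r
  ∣remainder d∣4 d∣n = ∣m+n∣m⇒∣n (∣m+n∣m⇒∣n d∣n d∣4) (∣n⇒∣m*n k d∣4)

  remainder∣ : ∀ {d} → d ∣ 4 → d ∣ r → d ∣ n
  remainder∣ d∣4 d∣r = ∣m∣n⇒∣m+n d∣4 (∣m∣n⇒∣m+n (∣n⇒∣m*n k d∣4) d∣r)

  gcd∣remainder : ∀ {d g} → d ∣ 4 → d ∣ g → gcd n 4 ≡ g → d ∣ r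
  gcd∣remainder d∣4 d∣g refl = ∣remainder d∣4 (∣-trans d∣g (gcd[m,n]∣m n 4))

  remainder∣gcd : ∀ {d g} → d ∣ 4 → d ∣ r → gcd n 4 ≡ g → d ∣ g
  remainder∣gcd d∣4 d∣r refl = gcd-greatest (remainder∣ d∣4 d∣r) d∣4

2∣4 : 2 ∣ 4
2∣4 = divides 2 refl

4∣4 : 4 ∣ 4
4∣4 = ∣-refl

-- The conclusion as a family in n, to be transported along the division of m by 4.
Formula : ℕ → ℕ → ℕ → Set
Formula q n N =
      ((gcd n 4 ≡ 1 →
          + N ≡ (+ q) ^ (3 Data.Nat.* n)
                - ((+ q) ^ 3 + (+ q) ^ 2 + + q) * (+ q) ^ (2 Data.Nat.* n)
                + ((+ q) ^ 5 + (+ q) ^ 4 + (+ q) ^ 3) * (+ q) ^ n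
                - (+ q) ^ 6) ×
       (gcd n 4 ≡ 2 →
          + N ≡ (+ q) ^ (3 Data.Nat.* n)
                - ((+ q) ^ 3 + (+ q) ^ 2 + + q) * (+ q) ^ (2 Data.Nat.* n)
                + + 2 * ((+ q) ^ 4 + (+ q) ^ 2) * (+ q) ^ (3 Data.Nat.* (n Data.Nat./ 2))
                - ((+ q) ^ 5 + (+ q) ^ 4 + (+ q) ^ 3) * (+ q) ^ n
                + (+ q) ^ 6) ×
       (gcd n 4 ≡ 4 →
          + N ≡ (+ q) ^ (3 Data.Nat.* n)
                + + 3 * ((+ q) ^ 3 + (+ q) ^ 2 + + q) * (+ q) ^ (2 Data.Nat.* n)
                + + 2 * ((+ q) ^ 4 + (+ q) ^ 2) * (+ q) ^ (3 Data.Nat.* (n Data.Nat./ 2))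
                + + 3 * ((+ q) ^ 5 + (+ q) ^ 4 + (+ q) ^ 3) * (+ q) ^ n
                + (+ q) ^ 6))

-- A divisor of 4 divides n exactly when it divides r. Testing 2 and 4 leaves one possible gcd for
-- each residue.
formula : ∀ q r k N → + N ≡ ClosedForm.closed (+ q) terms r k → Formula q (4 ℕ.+ (k ℕ.* 4 ℕ.+ toℕ r)) N
formula q zero k N e =
    (λ g → ⊥-elim (from-no (4 ∣? 1) (remainder∣gcd k 0 4∣4 (divides 0 refl) g)))
  , (λ g → ⊥-elim (from-no (4 ∣? 2) (remainder∣gcd k 0 4∣4 (divides 0 refl) g)))
  , (λ _ → trans e (Formulas.closed₀ (+ q) k))
formula q (suc zero) k N e =
    (λ _ → trans e (Formulas.closed₁ (+ q) k))
  , (λ g → ⊥-elim (from-no (2 ∣? 1) (gcd∣remainder k 1 2∣4 ∣-refl g)))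
  , (λ g → ⊥-elim (from-no (2 ∣? 1) (gcd∣remainder k 1 2∣4 2∣4 g)))
formula q (suc (suc zero)) k N e =
    (λ g → ⊥-elim (from-no (2 ∣? 1) (remainder∣gcd k 2 2∣4 ∣-refl g)))
  , (λ _ → trans e (Formulas.closed₂ (+ q) k))
  , (λ g → ⊥-elim (from-no (4 ∣? 2) (gcd∣remainder k 2 4∣4 ∣-refl g)))
formula q (suc (suc (suc zero))) k N e =
    (λ _ → trans e (Formulas.closed₃ (+ q) k))
  , (λ g → ⊥-elim (from-no (2 ∣? 3) (gcd∣remainder k 3 2∣4 ∣-refl g)))
  , (λ g → ⊥-elim (from-no (2 ∣? 3) (gcd∣remainder k 3 2∣4 2∣4 g)))

theorem5p4 : (K : CommutativeRing 0ℓ 0ℓ) → IsField K → (q : ℕ) → HasSize K q →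
    (n : ℕ) .{{_ : NonZero n}} → 4 ≤ n →
    Σ[ N ∈ ℕ ] (CardQuot {C4Tuple K n} N (_∼C_ K) ×
      ((gcd n 4 ≡ 1 →
          + N ≡ (+ q) ^ (3 Data.Nat.* n)
                - ((+ q) ^ 3 + (+ q) ^ 2 + + q) * (+ q) ^ (2 Data.Nat.* n)
                + ((+ q) ^ 5 + (+ q) ^ 4 + (+ q) ^ 3) * (+ q) ^ n
                - (+ q) ^ 6) ×
       (gcd n 4 ≡ 2 →
          + N ≡ (+ q) ^ (3 Data.Nat.* n)
                - ((+ q) ^ 3 + (+ q) ^ 2 + + q) * (+ q) ^ (2 Data.Nat.* n)
                + + 2 * ((+ q) ^ 4 + (+ q) ^ 2) * (+ q) ^ (3 Data.Nat.* (n Data.Nat./ 2))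
                - ((+ q) ^ 5 + (+ q) ^ 4 + (+ q) ^ 3) * (+ q) ^ n
                + (+ q) ^ 6) ×
       (gcd n 4 ≡ 4 →
          + N ≡ (+ q) ^ (3 Data.Nat.* n)
                + + 3 * ((+ q) ^ 3 + (+ q) ^ 2 + + q) * (+ q) ^ (2 Data.Nat.* n)
                + + 2 * ((+ q) ^ 4 + (+ q) ^ 2) * (+ q) ^ (3 Data.Nat.* (n Data.Nat./ 2))
                + + 3 * ((+ q) ^ 5 + (+ q) ^ 4 + (+ q) ^ 3) * (+ q) ^ n
                + (+ q) ^ 6)))
theorem5p4 K isField q size (suc (suc (suc (suc m)))) (s≤s (s≤s (s≤s (s≤s z≤n)))) =
  closedWalks m , C4-card m , count m (m divMod 4)
  where
  open Transport K isField q size using (𝔽; C4-card)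
  open Geometry 𝔽 using (closedWalks)
  count : ∀ m → DivMod m 4 → Formula q (4 ℕ.+ m) (closedWalks m)
  count m (result k r m≡) =
    subst (λ m → Formula q (4 ℕ.+ m) (closedWalks m)) (sym (trans m≡ (ℕ.+-comm (toℕ r) (k ℕ.* 4))))
      (formula q r k (closedWalks (k ℕ.* 4 ℕ.+ toℕ r)) (closedWalks-closed 𝔽 r k))
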